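{- Assume the $k$-Sum Conjecture. Then any algorithm for 2DK, and any algorithm for 2DKR, that computes a $(1+\epsilon)$-approximate solution for every given $\epsilon>0$ must have running time $n^{\Omega(1/\epsilon)}$, even in the cardinality case. More precisely, there is no algorithm and no function $f$ such that, for every $\epsilon>0$ and every instance of the cardinality case of 2DK (respectively 2DKR) with $n$ items, the algorithm outputs a $(1+\epsilon)$-approximate solution in time $f(\epsilon)\cdot n^{1/(9\epsilon)}$.
   Context: Two-dimensional geometric knapsack (2DK): an instance consists of an integer $N\ge 1$ and a set $I$ of $n$ items; each item $i\in I$ has a width $w(i)\in\mathbb N$, a height $h(i)\in\mathbb N$ and a profit $p(i)\in\mathbb N$. Let $K=[0,N]\times[0,N]$. A feasible solution is a subset $S\subseteq I$ together with a placement of each $i\in S$ as an open axis-parallel rectangle $(x_i,x_i+w(i))\times(y_i,y_i+h(i))\subseteq K$ such that the rectangles of distinct items are pairwise disjoint; its profit is $p(S)=\sum_{i\in S}p(i)$, to be maximized. In the variant with rotations (2DKR) each selected item may alternatively be placed rotated by $90^\circ$. The cardinality case is $p(i)=1$ for all $i$. A $(1+\epsilon)$-approximate solution has profit at least $p(\mathrm{OPT})/(1+\epsilon)$. The $k$-Sum problem: given $n$ integers (a multiset), decide whether some $k$ of them (with distinct indices) sum to $0$. The $k$-Sum Conjecture: there do not exist $k\ge 2$, $\delta>0$ and a randomized algorithm that solves $k$-Sum with high probability in time $O(n^{\lceil k/2\rceil-\delta})$. -}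

module Defs where

open import Data.Bool.Base using (Bool; true; false; if_then_else_; _∧_; _∨_; _xor_)
open import Data.Fin.Base using (Fin; toℕ)
open import Data.Integer.Base as ℤ using (ℤ; +_; -[1+_])
open import Data.List.Base using (List; []; _∷_; _++_; length; map; foldr; concatMap; cartesianProductWith; filterᵇ; allFin)
open import Data.List.Relation.Unary.All using (All)
open import Data.List.Relation.Unary.AllPairs using (AllPairs)
open import Data.Nat.Base using (ℕ; zero; suc; _+_; _*_; _∸_; _^_; _≤_; _⊔_; _≡ᵇ_; _<ᵇ_; _/_; _%_; ⌈_/2⌉)
open import Data.Nat.ListAction using (sum)
open import Data.Nat.Properties using (m^n≢0)
open import Data.Product.Base using (Σ-syntax; _×_; _,_)
open import Data.Rational.Base as ℚ using (ℚ; mkℚ; 0ℚ; 1ℚ; Positive; ↥_; ↧ₙ_)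
open import Data.Rational.Properties using (pos⇒nonZero; pos+pos⇒pos)
open import Data.Unit.Base using (⊤)
open import Data.Vec.Base using (Vec; []; _∷_)
import Data.Vec.Functional as Vector
open import Function.Definitions using (Injective)
open import Relation.Binary.PropositionalEquality using (_≡_; _≢_)
open import Relation.Nullary using (¬_)

-- The word size w is a parameter of the execution, not of the program.
-- Registers and memory cells hold numbers below 2 ^ w, and arithmetic is
-- modulo 2 ^ w.  Only finitely many registers occur in a program.

data Op : Set where
  add sub mul div mod and or xor shl shr lt eq : Op

data Expr : Set where
  lit      : ℕ → Expr
  reg      : ℕ → Expr
  load     : Expr → Expr
  wordSize : Expr
  op       : Op → Expr → Expr → Expr

infix 4 _≔_ [_]≔_

data Stmt : Set where
  _≔_    : ℕ → Expr → Stmt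
  [_]≔_  : Expr → Expr → Stmt
  random : ℕ → Stmt
  branch : Expr → List Stmt → List Stmt → Stmt
  while  : Expr → List Stmt → Stmt

Program : Set
Program = List Stmt

record State : Set where
  constructor state
  field
    regs : ℕ → ℕ
    mem  : ℕ → ℕ

open State public

update : (ℕ → ℕ) → ℕ → ℕ → (ℕ → ℕ)
update f i v j = if i ≡ᵇ j then v else f j

wrap : ℕ → ℕ → ℕ
wrap w a = _%_ a (2 ^ w) {{m^n≢0 2 w}}

bit : Bool → ℕ
bit b = if b then 1 else 0

bitwise : (Bool → Bool → Bool) → ℕ → ℕ → ℕ → ℕ
bitwise f zero    a b = 0
bitwise f (suc w) a b =
  bit (f (a % 2 ≡ᵇ 1) (b % 2 ≡ᵇ 1)) + 2 * bitwise f w (a / 2) (b / 2)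

-- Division and remainder by 0 return 0.
evalOp : ℕ → Op → ℕ → ℕ → ℕ
evalOp w add a b       = a + b
evalOp w sub a b       = a + (2 ^ w ∸ b)
evalOp w mul a b       = a * b
evalOp w div a zero    = 0
evalOp w div a (suc b) = a / suc b
evalOp w mod a zero    = 0
evalOp w mod a (suc b) = a % suc b
evalOp w and a b       = bitwise _∧_ w a b
evalOp w or  a b       = bitwise _∨_ w a b
evalOp w xor a b       = bitwise _xor_ w a b
evalOp w shl a b       = a * 2 ^ b
evalOp w shr a b       = _/_ a (2 ^ b) {{m^n≢0 2 b}}
evalOp w lt  a b       = bit (a <ᵇ b)
evalOp w eq  a b       = bit (a ≡ᵇ b)

eval : ℕ → State → Expr → ℕ
eval w s (lit a)     = wrap w a
eval w s (reg x)     = regs s x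
eval w s (load e)    = mem s (eval w s e)
eval w s wordSize    = wrap w w
eval w s (op o e e′) = wrap w (evalOp w o (eval w s e) (eval w s e′))

Config : Set
Config = List Stmt × State

-- Every step is given a fresh uniformly random word, which only `random`
-- uses.  A step evaluates at most two expressions of the program; these have
-- constant size, so counting steps is counting word operations up to a
-- constant factor depending on the program only.
step : ∀ w → Fin (2 ^ w) → Config → Config
step w r ([] , s)                  = [] , s
step w r ((x ≔ e) ∷ k , s)         = k , state (update (regs s) x (eval w s e)) (mem s)
step w r (([ a ]≔ e) ∷ k , s)      = k , state (regs s) (update (mem s) (eval w s a) (eval w s e))
step w r (random x ∷ k , s)        = k , state (update (regs s) x (toℕ r)) (mem s)
step w r (branch e p q ∷ k , s)    = (if eval w s e ≡ᵇ 0 then q else p) ++ k , s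
step w r (while e p ∷ k , s)       = (if eval w s e ≡ᵇ 0 then k else p ++ while e p ∷ k) , s

Tape : ℕ → ℕ → Set
Tape w t = Vec (Fin (2 ^ w)) t

run : ∀ {t} w → Tape w t → Config → Config
run w []      c = c
run w (r ∷ ω) c = run w ω (step w r c)

cell : List ℕ → ℕ → ℕ
cell []       _       = 0
cell (a ∷ as) zero    = a
cell (a ∷ as) (suc i) = cell as i

initial : Program → List ℕ → Config
initial p input = p , state (λ _ → 0) (cell input)

tapes : ∀ w t → List (Tape w t)
tapes w zero    = [] ∷ []
tapes w (suc t) = cartesianProductWith _∷_ (allFin (2 ^ w)) (tapes w t)

-- w ≥ (1 + κ) · log₂ (1 + length + largest entry): words of O(log) bits.
WordsSuffice : ℕ → ℕ → List ℕ → Set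
WordsSuffice κ w input = (1 + length input + foldr _⊔_ 0 input) ^ (1 + κ) ≤ 2 ^ w

-- T ≤ C · n ^ q for rational q = a / d, written as T ^ d ≤ C ^ d · n ^ a
-- (respectively T ^ d · n ^ ∣ a ∣ ≤ C ^ d when a is negative).
TimeBound : (T C n : ℕ) (q : ℚ) → Set
TimeBound T C n (mkℚ (+ a)    d-1 _) = T ^ suc d-1 ≤ C ^ suc d-1 * n ^ a
TimeBound T C n (mkℚ -[1+ a ] d-1 _) = T ^ suc d-1 * n ^ suc a ≤ C ^ suc d-1

sumℤ : ∀ {k} → (Fin k → ℤ) → ℤ
sumℤ = Vector.foldr ℤ._+_ (+ 0)

HasKSum : ℕ → ∀ {n} → (Fin n → ℤ) → Set
HasKSum k {n} z = Σ[ ι ∈ (Fin k → Fin n) ] Injective _≡_ _≡_ ι × sumℤ (λ j → z (ι j)) ≡ + 0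

encodeℤ : ℤ → List ℕ
encodeℤ (+ a)    = 0 ∷ a ∷ []
encodeℤ -[1+ a ] = 1 ∷ suc a ∷ []

encodeKSum : ∀ {n} → (Fin n → ℤ) → List ℕ
encodeKSum {n} z = n ∷ concatMap (λ i → encodeℤ (z i)) (allFin n)

-- The answer is read from register 0, and only once the machine has halted.
answers : ℕ → Config → Bool
answers a ([] , s)    = regs s 0 ≡ᵇ a
answers a (_ ∷ _ , s) = false

-- Probability at least 1 - 1/n over a uniformly random tape.
WithHighProbability : (n w t : ℕ) → (Tape w t → Bool) → Set
WithHighProbability n w t E = (n ∸ 1) * length (tapes w t) ≤ n * length (filterᵇ E (tapes w t))

SolvesKSum : (k : ℕ) (q : ℚ) → Program → Set
SolvesKSum k q p =
  Σ[ κ ∈ ℕ ] Σ[ C ∈ ℕ ]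
    (∀ n → 1 ≤ n → (z : Fin n → ℤ) → ∀ w → WordsSuffice κ w (encodeKSum z) →
      Σ[ t ∈ ℕ ] TimeBound t C n q
        × (HasKSum k z →
             WithHighProbability n w t (λ ω → answers 1 (run w ω (initial p (encodeKSum z)))))
        × (¬ HasKSum k z →
             WithHighProbability n w t (λ ω → answers 0 (run w ω (initial p (encodeKSum z))))))

KSumConjecture : Set
KSumConjecture =
  ¬ (Σ[ k ∈ ℕ ] Σ[ δ ∈ ℚ ] 2 ≤ k × Positive δ
       × Σ[ p ∈ Program ] SolvesKSum k ((+ ⌈ k /2⌉ ℚ./ 1) ℚ.- δ) p)

record Instance : Set where
  field
    N   : ℕ
    1≤N : 1 ≤ N
    n   : ℕ
    width height profit : Fin n → ℕ

data Variant : Set where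
  2DK 2DKR : Variant

ℕ→ℚ : ℕ → ℚ
ℕ→ℚ a = + a ℚ./ 1

record Rect : Set where
  field
    left bottom : ℚ
    sizeX sizeY : ℕ

Point : Set
Point = ℚ × ℚ

infix 4 _∈ᵒ_

_∈ᵒ_ : Point → Rect → Set
(u , v) ∈ᵒ r = (left ℚ.< u × u ℚ.< left ℚ.+ ℕ→ℚ sizeX) × (bottom ℚ.< v × v ℚ.< bottom ℚ.+ ℕ→ℚ sizeY)
  where open Rect r

Disjoint : Rect → Rect → Set
Disjoint r r′ = ∀ pt → ¬ (pt ∈ᵒ r × pt ∈ᵒ r′)

module _ (I : Instance) where
  open Instance I

  InKnapsack : Point → Set
  InKnapsack (u , v) = (0ℚ ℚ.≤ u × u ℚ.≤ ℕ→ℚ N) × (0ℚ ℚ.≤ v × v ℚ.≤ ℕ→ℚ N)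

  record PlacedItem : Set where
    field
      item    : Fin n
      x y     : ℚ
      rotated : Bool

  open PlacedItem public

  rect : PlacedItem → Rect
  rect a = record
    { left   = x a
    ; bottom = y a
    ; sizeX  = if rotated a then height (item a) else width (item a)
    ; sizeY  = if rotated a then width (item a) else height (item a)
    }

  Solution : Set
  Solution = List PlacedItem

  RotationAllowed : Variant → PlacedItem → Set
  RotationAllowed 2DK  a = rotated a ≡ false
  RotationAllowed 2DKR a = ⊤

  Feasible : Variant → Solution → Set
  Feasible v S =
      All (RotationAllowed v) S
    × All (λ a → ∀ pt → pt ∈ᵒ rect a → InKnapsack pt) S
    × AllPairs (λ a b → item a ≢ item b × Disjoint (rect a) (rect b)) S

  totalProfit : Solution → ℕ
  totalProfit S = sum (map (λ a → profit (item a)) S)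

  Optimal : Variant → Solution → Set
  Optimal v S = Feasible v S × (∀ S′ → Feasible v S′ → totalProfit S′ ≤ totalProfit S)

  Approximate : Variant → (ε : ℚ) .{{_ : Positive ε}} → Solution → Set
  Approximate v ε S =
    Feasible v S
      × (Σ[ OPT ∈ Solution ] Optimal v OPT
           × (ℕ→ℚ (totalProfit OPT) ℚ.÷ (1ℚ ℚ.+ ε)) {{pos⇒nonZero (1ℚ ℚ.+ ε) {{pos+pos⇒pos 1ℚ ε}}}}
               ℚ.≤ ℕ→ℚ (totalProfit S))

  Cardinality : Set
  Cardinality = ∀ i → profit i ≡ 1

  encode2DK : ℚ → List ℕ
  encode2DK ε =
    ℤ.∣ ↥ ε ∣ ∷ ↧ₙ ε ∷ N ∷ n ∷
    concatMap (λ i → width i ∷ height i ∷ profit i ∷ []) (allFin n)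

  -- A placed item occupies six consecutive cells.  The cells holding
  -- denominators store the denominator minus one, and fractions need not be
  -- in lowest terms.
  StoredAt : (ℕ → ℕ) → ℕ → PlacedItem → Set
  StoredAt m a b =
      m a ≡ toℕ (item b)
    × x b ≡ + m (1 + a) ℚ./ suc (m (2 + a))
    × y b ≡ + m (3 + a) ℚ./ suc (m (4 + a))
    × m (5 + a) ≡ bit (rotated b)

  data ListStoredAt (m : ℕ → ℕ) : ℕ → Solution → Set where
    []  : ∀ {a} → ListStoredAt m a []
    _∷_ : ∀ {a b S} → StoredAt m a b → ListStoredAt m (6 + a) S → ListStoredAt m a (b ∷ S)

  -- Halted, with the number of selected items in register 0 and the address
  -- of the first one in register 1.
  Outputs : Config → Solution → Set
  Outputs (k , s) S = k ≡ [] × regs s 0 ≡ length S × ListStoredAt (mem s) (regs s 1) S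

-- A single program that receives ε together with the instance and, for every
-- ε in D, always returns a (1+ε)-approximate solution of every nonempty
-- cardinality instance within f(ε) · n ^ (c / ε) steps.  (For n = 0 this
-- bound would be 0.)  The word size constant κ may depend on ε, since words
-- must be able to address all the memory used within the time bound.
CardinalityScheme : Variant → (D : ℚ → Set) → (c : ℚ) → Set
CardinalityScheme v D c =
  Σ[ p ∈ Program ] Σ[ κ ∈ (ℚ → ℕ) ] Σ[ f ∈ (ℚ → ℕ) ]
    (∀ ε .{{_ : Positive ε}} → D ε →
     ∀ I → Cardinality I → 1 ≤ Instance.n I →
     ∀ w → WordsSuffice (κ ε) w (encode2DK I ε) →
      Σ[ t ∈ ℕ ] TimeBound t (f ε) (Instance.n I) ((c ℚ.÷ ε) {{pos⇒nonZero ε}})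
        × (∀ (ω : Tape w t) →
             Σ[ S ∈ Solution I ] Outputs I (run w ω (initial p (encode2DK I ε))) S
               × Approximate I v ε S))

-- Running time n ^ Ω(1/ε), the Ω being for ε → 0: for some c > 0, no scheme
-- achieves f(ε) · n ^ (c / ε), not even on the small ε only.
NeedsExponentΩ[1/ε] : Variant → Set
NeedsExponentΩ[1/ε] v =
  Σ[ c ∈ ℚ ] Positive c × (∀ ε₀ → Positive ε₀ → ¬ CardinalityScheme v (ℚ._≤ ε₀) c)

{-# OPTIONS --safe #-}

-- Let k = 2r, K = k + 1 and β > K max |aᵢ|.  Items of size (2U + s) × (KU - s),
-- with s = ±(β + aᵢ) for each integer aᵢ and s = ±kβ for two extra items, go into
-- a square of side 2KU.  Every item contains 2 × K (rotated: K × 2) points of a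
-- 2K × 2K grid, so 2K packed items partition the grid; as K is odd, no column
-- meets both orientations, hence all items have the same one.  The two items of
-- a column force the sum of their s to be ≥ 0, the K items of a row force it to
-- be ≤ 0, so it is 0 in every row; by the size of β and the parity of K, a row
-- then consists of an item ∓kβ and k items ±(β + aᵢ) with Σ aᵢ = 0.  Conversely a
-- solution of k-Sum gives a packing of 2K items.  For k = 2m + 2 and ε = 1/(9m)
-- ≤ 1/(2K), time f(ε) n^(1/(9ε)) thus solves k-Sum in time O(n^(k/2 - 1)).
module Submission where

open import Defs hiding (eq)
open import Data.Bool.Base using (Bool; true; false; not; T; _∧_; if_then_else_)
open import Data.Bool.Properties as Bool using (T?)
open import Data.Empty using (⊥; ⊥-elim)
open import Data.Fin.Base using (Fin; zero; suc; toℕ; fromℕ<; inject≤; combine; remQuot)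
import Data.Fin.Properties as Fin
open import Data.Integer.Base as ℤ using (ℤ; +_; -[1+_])
import Data.Integer.Properties as ℤ
import Data.Integer.Tactic.RingSolver as ℤ
open import Data.List.Base using (List; []; _∷_; _++_; length; map; lookup; tabulate; allFin; concatMap; foldr)
open import Data.List.Membership.Propositional using (_∈_)
open import Data.List.Membership.Propositional.Properties using (∈-lookup)
open import Data.List.Properties using (length-map; map-∘; length-tabulate; length-++; ++-assoc; filter-all)
open import Data.List.Relation.Binary.Permutation.Propositional as ↭ using (_↭_; ↭-sym)
import Data.List.Relation.Binary.Permutation.Propositional.Properties as Perm
open import Data.List.Relation.Unary.All as All using (All; []; _∷_)
open import Data.List.Relation.Unary.AllPairs using (AllPairs; []; _∷_)
open import Data.List.Relation.Unary.Any using (here; there)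
open import Data.List.Relation.Unary.Linked.Properties using (Linked⇒AllPairs)
open import Data.List.Relation.Unary.Unique.Propositional using (Unique)
import Data.List.Relation.Unary.Unique.Propositional.Properties as Unique
import Data.List.Sort
open import Data.Nat.Base as ℕ hiding (_/_)
open import Data.Nat.Coprimality as Coprime using (1-coprimeTo)
open import Data.Nat.DivMod
  using (m≡m%n+[m/n]*n; m%n<n; m/n*n≤m; m/n≤m; n/1≡n; m*n/n≡m; /-monoˡ-≤; m<n⇒m%n≡m; [m+n]%n≡m%n)
open import Data.Nat.ListAction using (sum)
open import Data.Nat.ListAction.Properties using (sum-↭)
open import Data.Nat.Properties
open import Data.Nat.Tactic.RingSolver using (solve-∀)
open import Data.Product.Base using (∃; Σ-syntax; _×_; _,_; proj₁; proj₂; uncurry)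
open import Data.Rational.Base as ℚ using (ℚ; mkℚ; 0ℚ; 1ℚ; Positive; toℚᵘ; _/_)
import Data.Rational.Properties as ℚ
import Data.Rational.Unnormalised.Base as ℚᵘ
import Data.Rational.Unnormalised.Properties as ℚᵘ
open import Data.Sum.Base as Sum using (_⊎_; inj₁; inj₂)
open import Data.Unit.Base using (⊤; tt)
open import Data.Vec.Base using ([]; _∷_)
open import Function.Base using (_∘_; id)
import Relation.Binary.Construct.Flip.EqAndOrd as Flip
import Relation.Binary.Construct.On as On
open import Relation.Binary.PropositionalEquality
open import Relation.Nullary using (¬_; contradiction; yes; no)
open import Algebra.Properties.Semiring.Sum +-*-semiring
  using (sum-cong-≗; ∑-distrib-+; ∑-comm; *-distribˡ-sum; *-distribʳ-sum) renaming (sum to ∑)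

-- Stabbing grids and perfect tilings

-- Approximation settles an exact question because ε ≤ 1/(2K): a (1+ε)-approximation of an optimum
-- of at least 2K items has more than 2K - 1 items. The offset s enters width and height with
-- opposite signs, so columns and rows bound the sum of all s from opposite sides, and only together
-- do they give an equation. Each integer needs both a plus and a minus item, since the items above
-- a balanced row of the packing carry the negated offsets. The grid has spacing Q = U - g, where g
-- = kβ is the largest |s|: every item keeps its grid points whatever its s, and as Q > 2Kg no
-- further grid line enters the knapsack. Positions may be rational; as sizes are integral, all
-- coordinates can be rounded down first. On the machine, β is not computed from the integers. It is
-- 2 ^ ⌊w / (E + 1)⌋, a root of the number of words, obtained by one shift: for a large enough word
-- size constant it exceeds every required bound, while all numbers of the instance stay below β²
-- and fit into words.

∑-mono-≤ : ∀ {n} {f g : Fin n → ℕ} → (∀ i → f i ≤ g i) → ∑ f ≤ ∑ g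
∑-mono-≤ {zero}  f≤g = z≤n
∑-mono-≤ {suc n} f≤g = +-mono-≤ (f≤g zero) (∑-mono-≤ (λ i → f≤g (suc i)))

-- All exact statements about a packing (grid points per item, coverage of the grid, balance of a
-- row) come from squeezing a total between two bounds and reading off the terms here.
∑-tight : ∀ {n} {f g : Fin n → ℕ} → (∀ i → f i ≤ g i) → ∑ g ≤ ∑ f → ∀ i → f i ≡ g i
∑-tight {suc n} {f} {g} f≤g ∑g≤∑f zero =
  ≤-antisym (f≤g zero) (+-cancelʳ-≤ (∑ (λ i → g (suc i))) _ _
    (≤-trans ∑g≤∑f (+-monoʳ-≤ (f zero) (∑-mono-≤ (λ i → f≤g (suc i))))))
∑-tight {suc n} {f} {g} f≤g ∑g≤∑f (suc i) = ∑-tight (λ i → f≤g (suc i))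
  (+-cancelˡ-≤ (g zero) _ _ (≤-trans ∑g≤∑f (+-monoˡ-≤ _ (f≤g zero)))) i

∑-const : ∀ n c → ∑ {n} (λ _ → c) ≡ n * c
∑-const zero    c = refl
∑-const (suc n) c = cong (λ a → c + a) (∑-const n c)

bit≤1 : ∀ b → bit b ≤ 1
bit≤1 false = z≤n
bit≤1 true  = ≤-refl

0<bit⇒true : ∀ b → 0 < bit b → b ≡ true
0<bit⇒true true  _ = refl

0<∑⇒∃ : ∀ {n} (b : Fin n → ℕ) → 0 < ∑ b → ∃ λ i → 0 < b i
0<∑⇒∃ {suc n} b 0<∑ with b zero in eq
... | suc _ = zero , subst (0 <_) (sym eq) z<s
... | zero  = let i , 0<bi = 0<∑⇒∃ (λ i → b (suc i)) 0<∑ in suc i , 0<bi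

∑-atMostOne : ∀ {n} (b : Fin n → Bool) → (∀ i j → i ≢ j → b i ≡ true → b j ≡ true → ⊥) →
              ∑ (λ i → bit (b i)) ≤ 1
∑-atMostOne {zero}  b _ = z≤n
∑-atMostOne {suc n} b excl with b zero in eq
... | false = ∑-atMostOne (λ i → b (suc i)) (λ i j i≢j → excl (suc i) (suc j) (λ e → i≢j (Fin.suc-injective e)))
... | true  = s≤s (≤-reflexive (trans (sum-cong-≗ none) (trans (∑-const n 0) (*-zeroʳ n))))
  where
  none : ∀ i → bit (b (suc i)) ≡ 0
  none i with b (suc i) in eq′
  ... | false = refl
  ... | true  = ⊥-elim (excl zero (suc i) (λ ()) eq eq′)

count-interval : ∀ M q c (f : ℕ → ℕ) → q + c ≤ M → (∀ i → q ≤ i → i < q + c → 1 ≤ f i) →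
                 c ≤ ∑ {M} (λ i → f (toℕ i))
count-interval M       q       zero    f _ _ = z≤n
count-interval (suc M) zero    (suc c) f (s≤s le) h =
  +-mono-≤ (h 0 z≤n z<s) (count-interval M zero c (λ i → f (suc i)) le (λ i _ i<c → h (suc i) z≤n (s≤s i<c)))
count-interval (suc M) (suc q) (suc c) f (s≤s le) h =
  ≤-trans (count-interval M q (suc c) (λ i → f (suc i)) le (λ i q≤i i< → h (suc i) (s≤s q≤i) (s≤s i<)))
          (m≤n+m _ (f 0))
count-interval zero    zero    (suc c) f () h
count-interval zero    (suc q) (suc c) f () h

-- The half-open interval `(l , l + ℓ]`: intervals that merely touch share no point, and one of
-- length `c * Q` contains `c` consecutive multiples of `Q` wherever it starts.
inside : ℕ → ℕ → ℕ → Bool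
inside l ℓ p = (l <ᵇ p) ∧ (p ≤ᵇ l + ℓ)

inside-sound : ∀ l ℓ p → inside l ℓ p ≡ true → l < p × p ≤ l + ℓ
inside-sound l ℓ p eq with l <ᵇ p in e | p ≤ᵇ l + ℓ in e′
... | true | true = <ᵇ⇒< l p (subst T (sym e) _) , ≤ᵇ⇒≤ p (l + ℓ) (subst T (sym e′) _)

inside-complete : ∀ l ℓ p → l < p → p ≤ l + ℓ → 1 ≤ bit (inside l ℓ p)
inside-complete l ℓ p l<p p≤ with l <ᵇ p | <⇒<ᵇ l<p | p ≤ᵇ l + ℓ | ≤⇒≤ᵇ p≤
... | true | _ | true | _ = ≤-refl

-- The grid coordinates are Q, 2Q, …, MQ.
stab : ∀ Q M N c l ℓ → 0 < Q → N < suc M * Q → c * Q ≤ ℓ → l + ℓ ≤ N →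
       c ≤ ∑ {M} (λ i → bit (inside l ℓ (suc (toℕ i) * Q)))
stab Q@(suc _) M N c l ℓ _ N< cQ≤ℓ l+ℓ≤N =
  -- Index `i` stands for the coordinate `suc i * Q`, so the first grid point beyond `l` has index
  -- `l / Q`. The bound `N < suc M * Q` keeps the last of the `c` points on the grid.
  count-interval M (l ℕ./ Q) c (λ i → bit (inside l ℓ (suc i * Q))) q+c≤M
    (λ i q≤i i<q+c → inside-complete l ℓ (suc i * Q)
      (<-≤-trans l< (*-monoˡ-≤ Q (s≤s q≤i)))
      (≤-trans (*-monoˡ-≤ Q i<q+c) hi))
  where
  l< : l < suc (l ℕ./ Q) * Q
  l< = subst (_< suc (l ℕ./ Q) * Q) (sym (m≡m%n+[m/n]*n l Q)) (+-monoˡ-< _ (m%n<n l Q))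
  hi : (l ℕ./ Q + c) * Q ≤ l + ℓ
  hi = subst (_≤ l + ℓ) (sym (*-distribʳ-+ Q (l ℕ./ Q) c)) (+-mono-≤ (m/n*n≤m l Q) cQ≤ℓ)
  q+c≤M : l ℕ./ Q + c ≤ M
  q+c≤M = ≤-pred (*-cancelʳ-< Q _ _ (≤-<-trans (≤-trans hi l+ℓ≤N) N<))

Apart : (l len l′ len′ : ℕ) → Set
Apart l len l′ len′ = l + len ≤ l′ ⊎ l′ + len′ ≤ l

apart⇒exclusive : ∀ {l len l′ len′} → Apart l len l′ len′ → ∀ p →
                  inside l len p ≡ true → inside l′ len′ p ≡ true → ⊥
apart⇒exclusive {l} {len} {l′} {len′} a p i i′
  with inside-sound l len p i | inside-sound l′ len′ p i′ | a
... | _ , p≤ | l′<p , _ | inj₁ le = <-irrefl refl (<-≤-trans l′<p (≤-trans p≤ le))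
... | l<p , _ | _ , p≤ | inj₂ le = <-irrefl refl (<-≤-trans l<p (≤-trans p≤ le))

∧-true : ∀ a b → a ∧ b ≡ true → a ≡ true × b ≡ true
∧-true true true _ = refl , refl

bit-∧ : ∀ a b → bit (a ∧ b) ≡ bit a * bit b
bit-∧ false b = refl
bit-∧ true  b = sym (+-identityʳ (bit b))

-- Disjoint intervals fit into [0 , N] only if their lengths do: count unit cells.
∑-lengths≤ : ∀ {n} N (b : Fin n → Bool) (l len : Fin n → ℕ) →
  (∀ t t′ → t ≢ t′ → b t ≡ true → b t′ ≡ true → Apart (l t) (len t) (l t′) (len t′)) →
  (∀ t → l t + len t ≤ N) → ∑ (λ t → bit (b t) * len t) ≤ N
∑-lengths≤ {n} N b l len apart fits = begin
  ∑ (λ t → bit (b t) * len t)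
    ≤⟨ ∑-mono-≤ (λ t → *-monoʳ-≤ (bit (b t)) (cells t)) ⟩
  ∑ (λ t → bit (b t) * ∑ {N} (λ i → hit t i))
    ≡⟨ sum-cong-≗ (λ t → *-distribˡ-sum {N} (bit (b t)) (hit t)) ⟩
  ∑ (λ t → ∑ {N} (λ i → bit (b t) * hit t i))
    ≡⟨ ∑-comm {n} {N} (λ t i → bit (b t) * hit t i) ⟩
  ∑ {N} (λ i → ∑ (λ t → bit (b t) * hit t i))
    ≤⟨ ∑-mono-≤ {N} once ⟩
  ∑ {N} (λ _ → 1)
    ≡⟨ ∑-const N 1 ⟩
  N * 1
    ≡⟨ *-identityʳ N ⟩
  N ∎
  where
  open ≤-Reasoning
  hit : Fin n → Fin N → ℕ
  hit t i = bit (inside (l t) (len t) (suc (toℕ i) * 1))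
  cells : ∀ t → len t ≤ ∑ {N} (hit t)
  cells t = stab 1 N N (len t) (l t) (len t) ≤-refl
    (s≤s (≤-reflexive (sym (*-identityʳ N)))) (≤-reflexive (*-identityʳ (len t))) (fits t)
  once : ∀ i → ∑ (λ t → bit (b t) * hit t i) ≤ 1
  once i = subst (_≤ 1)
    (sum-cong-≗ (λ t → bit-∧ (b t) (inside (l t) (len t) (suc (toℕ i) * 1))))
    (∑-atMostOne (λ t → b t ∧ inside (l t) (len t) (suc (toℕ i) * 1)) λ t t′ t≢t′ h h′ →
      let bt  , it  = ∧-true (b t) _ h
          bt′ , it′ = ∧-true (b t′) _ h′
      in apart⇒exclusive (apart t t′ t≢t′ bt bt′) (suc (toℕ i) * 1) it it′)

∑≡0⇒≡0 : ∀ {n} (f : Fin n → ℕ) → ∑ f ≡ 0 → ∀ i → f i ≡ 0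
∑≡0⇒≡0 f ∑≡0 i = sym (∑-tight {f = λ _ → 0} {g = f} (λ _ → z≤n) (subst (_≤ _) (sym ∑≡0) z≤n) i)

-- This is where the odd number of columns is used.
odd-split : ∀ r u v → suc (2 * r) * u + 2 * v ≡ 2 * suc (2 * r) → v ≡ 0 ⊎ u ≡ 0
odd-split r zero v eq = inj₂ refl
odd-split r (suc zero) v eq = ⊥-elim (even≢odd v r (+-cancelˡ-≡ (suc (2 * r)) _ _
  (trans (cong (_+ 2 * v) (sym (*-identityʳ (suc (2 * r)))))
    (trans eq (cong (λ a → suc (2 * r) + a) (+-identityʳ (suc (2 * r))))))))
odd-split r (suc (suc u)) zero eq = inj₁ refl
odd-split r (suc (suc u)) (suc v) eq = ⊥-elim (<-irrefl (sym eq) (begin-strict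
  2 * suc (2 * r)                                  ≡⟨ *-comm 2 (suc (2 * r)) ⟩
  suc (2 * r) * 2                                  ≤⟨ *-monoʳ-≤ (suc (2 * r)) (s≤s (s≤s z≤n)) ⟩
  suc (2 * r) * suc (suc u)                        <⟨ m<m+n _ z<s ⟩
  suc (2 * r) * suc (suc u) + 2 * suc v            ∎))
  where open ≤-Reasoning

*-tight : ∀ {a b c d} → 0 < a → 0 < b → a ≤ c → b ≤ d → c * d ≡ a * b → c ≡ a × d ≡ b
*-tight {a} {b} {c} {d} 0<a 0<b a≤c b≤d eq =
    ≤-antisym (*-cancelʳ-≤ c a b {{>-nonZero 0<b}} (≤-trans (*-monoʳ-≤ c b≤d) (≤-reflexive eq))) a≤c
  , ≤-antisym (*-cancelˡ-≤ a {{>-nonZero 0<a}} (≤-trans (*-monoˡ-≤ d a≤c) (≤-reflexive eq))) b≤d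

-- If `u` items of length `K` and `v` items of length 2 fill a grid line, then
-- `K * u + 2 * v ≡ 2 * K`, and `odd-split` leaves a single length. The orientation is an arbitrary
-- `ρ`, because columns use `rot` and rows its negation.
pure : ∀ {n} r (x ρ : Fin n → Bool) →
       ∑ (λ t → bit (x t) * (if ρ t then 2 else suc (2 * r))) ≡ 2 * suc (2 * r) →
       (∀ t → x t ≡ true → ρ t ≡ false) ⊎ (∀ t → x t ≡ true → ρ t ≡ true)
pure r x ρ eq with odd-split r (∑ (λ t → bit (x t ∧ not (ρ t)))) (∑ (λ t → bit (x t ∧ ρ t)))
                     (trans split eq)
  where
  pointwise : ∀ t → suc (2 * r) * bit (x t ∧ not (ρ t)) + 2 * bit (x t ∧ ρ t)
                    ≡ bit (x t) * (if ρ t then 2 else suc (2 * r))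
  pointwise t with x t | ρ t
  ... | false | _     = trans (cong (_+ 0) (*-zeroʳ (suc (2 * r)))) refl
  ... | true  | true  = cong (_+ 2) (*-zeroʳ (suc (2 * r)))
  ... | true  | false = trans (+-identityʳ _) (*-comm (suc (2 * r)) 1)
  split : suc (2 * r) * ∑ (λ t → bit (x t ∧ not (ρ t))) + 2 * ∑ (λ t → bit (x t ∧ ρ t))
          ≡ ∑ (λ t → bit (x t) * (if ρ t then 2 else suc (2 * r)))
  split = trans (cong₂ _+_ (*-distribˡ-sum (suc (2 * r)) (λ t → bit (x t ∧ not (ρ t))))
                           (*-distribˡ-sum 2 (λ t → bit (x t ∧ ρ t))))
         (trans (sym (∑-distrib-+ (λ t → suc (2 * r) * bit (x t ∧ not (ρ t))) (λ t → 2 * bit (x t ∧ ρ t))))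
                (sum-cong-≗ pointwise))
... | inj₁ v≡0 = inj₁ λ t xt → lemma (x t) (ρ t) xt (∑≡0⇒≡0 _ v≡0 t)
  where
  lemma : ∀ a b → a ≡ true → bit (a ∧ b) ≡ 0 → b ≡ false
  lemma true false _ _ = refl
... | inj₂ u≡0 = inj₂ λ t xt → lemma (x t) (ρ t) xt (∑≡0⇒≡0 _ u≡0 t)
  where
  lemma : ∀ a b → a ≡ true → bit (a ∧ not b) ≡ 0 → b ≡ true
  lemma true true _ _ = refl

-- Only incidences with the grid matter here: `X t i` and `Y t j` tell whether item `t` meets the
-- vertical line `i` and the horizontal line `j`. Each of the `B` items claims at least `2 * K = B`
-- of the `B * B` grid points and none is claimed twice, so the items partition the grid and all the
-- lower bounds are equalities.
module Tiling (r : ℕ)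
  (X Y : Fin (2 * suc (2 * r)) → Fin (2 * suc (2 * r)) → Bool) (rot : Fin (2 * suc (2 * r)) → Bool)
  (exclusive : ∀ t t′ → t ≢ t′ → ∀ i j → X t i ∧ Y t j ≡ true → X t′ i ∧ Y t′ j ≡ true → ⊥)
  (a≤ : ∀ t → (if rot t then suc (2 * r) else 2) ≤ ∑ (λ i → bit (X t i)))
  (b≤ : ∀ t → (if rot t then 2 else suc (2 * r)) ≤ ∑ (λ j → bit (Y t j)))
  where

  private
    K B : ℕ
    K = suc (2 * r)
    B = 2 * K

    a b : Fin B → ℕ
    a t = if rot t then K else 2
    b t = if rot t then 2 else K

    ξ η : Fin B → Fin B → ℕ
    ξ t i = bit (X t i)
    η t j = bit (Y t j)

    cover : Fin B → Fin B → ℕ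
    cover i j = ∑ (λ t → ξ t i * η t j)

    cover≤1 : ∀ i j → cover i j ≤ 1
    cover≤1 i j = subst (_≤ 1) (sum-cong-≗ (λ t → bit-∧ (X t i) (Y t j)))
      (∑-atMostOne (λ t → X t i ∧ Y t j) (λ t t′ t≢t′ → exclusive t t′ t≢t′ i j))

    column-cover : ∀ i → ∑ (cover i) ≡ ∑ (λ t → ξ t i * ∑ (η t))
    column-cover i = trans (∑-comm (λ j t → ξ t i * η t j))
      (sum-cong-≗ (λ t → sym (*-distribˡ-sum (ξ t i) (η t))))

    row-cover : ∀ j → ∑ (λ i → cover i j) ≡ ∑ (λ t → η t j * ∑ (ξ t))
    row-cover j = trans (∑-comm (λ i t → ξ t i * η t j))
      (sum-cong-≗ (λ t → trans (sym (*-distribʳ-sum (η t j) (ξ t))) (*-comm (∑ (ξ t)) (η t j))))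

    total-cover : ∑ (λ i → ∑ (cover i)) ≡ ∑ (λ t → ∑ (ξ t) * ∑ (η t))
    total-cover = trans (sum-cong-≗ column-cover)
      (trans (∑-comm (λ i t → ξ t i * ∑ (η t)))
             (sum-cong-≗ (λ t → sym (*-distribʳ-sum (∑ (η t)) (ξ t)))))

    ab≡B : ∀ t → a t * b t ≡ B
    ab≡B t with rot t
    ... | true  = *-comm K 2
    ... | false = refl

    0<a : ∀ t → 0 < a t
    0<a t with rot t
    ... | true  = z<s
    ... | false = z<s

    0<b : ∀ t → 0 < b t
    0<b t with rot t
    ... | true  = z<s
    ... | false = z<s

    ∑B : ∑ {B} (λ _ → ∑ {B} (λ _ → 1)) ≡ ∑ {B} (λ _ → B)
    ∑B = sum-cong-≗ {B} (λ _ → trans (∑-const B 1) (*-identityʳ B))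

    cxcy≤ : ∑ (λ t → ∑ (ξ t) * ∑ (η t)) ≤ ∑ (λ t → a t * b t)
    cxcy≤ = begin
      ∑ (λ t → ∑ (ξ t) * ∑ (η t))        ≡⟨ total-cover ⟨
      ∑ (λ i → ∑ (cover i))              ≤⟨ ∑-mono-≤ (λ i → ∑-mono-≤ (cover≤1 i)) ⟩
      ∑ {B} (λ _ → ∑ {B} (λ _ → 1))      ≡⟨ ∑B ⟩
      ∑ {B} (λ _ → B)                    ≡⟨ sum-cong-≗ ab≡B ⟨
      ∑ (λ t → a t * b t)                ∎
      where open ≤-Reasoning

    cxcy≡ : ∀ t → ∑ (ξ t) ≡ a t × ∑ (η t) ≡ b t
    cxcy≡ t = *-tight (0<a t) (0<b t) (a≤ t) (b≤ t)
      (sym (∑-tight (λ t → *-mono-≤ (a≤ t) (b≤ t)) cxcy≤ t))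

    cover≡1 : ∀ i j → cover i j ≡ 1
    cover≡1 i = ∑-tight (cover≤1 i) (≤-reflexive (sym
      (∑-tight (λ i → ∑-mono-≤ (cover≤1 i)) full i)))
      where
      open ≤-Reasoning
      full : ∑ {B} (λ _ → ∑ {B} (λ _ → 1)) ≤ ∑ (λ i → ∑ (cover i))
      full = begin
        ∑ {B} (λ _ → ∑ {B} (λ _ → 1))  ≡⟨ ∑B ⟩
        ∑ {B} (λ _ → B)                ≡⟨ sum-cong-≗ ab≡B ⟨
        ∑ (λ t → a t * b t)            ≤⟨ ∑-mono-≤ (λ t → *-mono-≤ (a≤ t) (b≤ t)) ⟩
        ∑ (λ t → ∑ (ξ t) * ∑ (η t))    ≡⟨ total-cover ⟨
        ∑ (λ i → ∑ (cover i))          ∎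

  x-count : ∀ t → ∑ (λ i → bit (X t i)) ≡ a t
  x-count t = proj₁ (cxcy≡ t)

  y-count : ∀ t → ∑ (λ j → bit (Y t j)) ≡ b t
  y-count t = proj₂ (cxcy≡ t)

  column : ∀ i → ∑ (λ t → bit (X t i) * b t) ≡ B
  column i = begin
    ∑ (λ t → ξ t i * b t)        ≡⟨ sum-cong-≗ (λ t → cong (ξ t i *_) (y-count t)) ⟨
    ∑ (λ t → ξ t i * ∑ (η t))    ≡⟨ column-cover i ⟨
    ∑ (cover i)                  ≡⟨ sum-cong-≗ (cover≡1 i) ⟩
    ∑ {B} (λ _ → 1)              ≡⟨ ∑-const B 1 ⟩
    B * 1                        ≡⟨ *-identityʳ B ⟩
    B                            ∎
    where open ≡-Reasoning

  row : ∀ j → ∑ (λ t → bit (Y t j) * a t) ≡ B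
  row j = begin
    ∑ (λ t → η t j * a t)        ≡⟨ sum-cong-≗ (λ t → cong (η t j *_) (x-count t)) ⟨
    ∑ (λ t → η t j * ∑ (ξ t))    ≡⟨ row-cover j ⟨
    ∑ (λ i → cover i j)          ≡⟨ sum-cong-≗ (λ i → cover≡1 i j) ⟩
    ∑ {B} (λ _ → 1)              ≡⟨ ∑-const B 1 ⟩
    B * 1                        ≡⟨ *-identityʳ B ⟩
    B                            ∎
    where open ≡-Reasoning

  -- A column through an upright item contains upright items only, a row
  -- through a rotated item rotated items only; their crossing is covered.
  uniform : (∀ t → rot t ≡ false) ⊎ (∀ t → rot t ≡ true)
  uniform with Fin.all? (λ t → rot t Bool.≟ false) | Fin.all? (λ t → rot t Bool.≟ true)
  ... | yes all-upright | _ = inj₁ all-upright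
  ... | no _ | yes all-rotated = inj₂ all-rotated
  ... | no ¬f | no ¬t
    with t₀ , rot₀≢true  ← Fin.¬∀⟶∃¬ B (λ t → rot t ≡ true) (λ t → rot t Bool.≟ true) ¬t
    with t₁ , rot₁≢false ← Fin.¬∀⟶∃¬ B (λ t → rot t ≡ false) (λ t → rot t Bool.≟ false) ¬f
    with i , 0<xi ← 0<∑⇒∃ (ξ t₀) (<-≤-trans (0<a t₀) (a≤ t₀))
    with j , 0<yj ← 0<∑⇒∃ (η t₁) (<-≤-trans (0<b t₁) (b≤ t₁))
    with t , 0<xy ← 0<∑⇒∃ (λ t → ξ t i * η t j) (subst (0 <_) (sym (cover≡1 i j)) z<s)
    = ⊥-elim (conflict (pure r (λ t → X t i) rot (column i)) (pure r (λ t → Y t j) (λ t → not (rot t))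
        (trans (sum-cong-≗ (λ t → cong (η t j *_) (flip (rot t)))) (row j))))
    where
    flip : ∀ c → (if not c then 2 else K) ≡ (if c then K else 2)
    flip true  = refl
    flip false = refl
    xy = ∧-true (X t i) (Y t j) (0<bit⇒true _ (subst (0 <_) (sym (bit-∧ (X t i) (Y t j))) 0<xy))
    conflict : (∀ t → X t i ≡ true → rot t ≡ false) ⊎ (∀ t → X t i ≡ true → rot t ≡ true) →
               (∀ t → Y t j ≡ true → not (rot t) ≡ false) ⊎ (∀ t → Y t j ≡ true → not (rot t) ≡ true) → ⊥
    conflict (inj₂ p) _ = rot₀≢true (p t₀ (0<bit⇒true _ 0<xi))
    conflict _ (inj₂ q) = rot₁≢false (trans (sym (Bool.not-involutive _)) (cong not (q t₁ (0<bit⇒true _ 0<yj))))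
    conflict (inj₁ p) (inj₁ q) with rot t | p t (proj₁ xy) | q t (proj₂ xy)
    ... | false | _ | ()
    ... | true  | () | _

-- If every item meets two columns and K rows, the sum of σ over columns is at
-- least, and over rows at most, what the average forces; so all are equal.
row-balance : ∀ {B} K U g → B ≡ 2 * K → .{{_ : NonZero K}} →
  (X Y : Fin B → Fin B → Bool) (W H σ : Fin B → ℕ) →
  (∀ t → ∑ (λ i → bit (X t i)) ≡ 2) → (∀ t → ∑ (λ j → bit (Y t j)) ≡ K) →
  (∀ i → ∑ (λ t → bit (X t i) * K) ≡ B) → (∀ j → ∑ (λ t → bit (Y t j) * 2) ≡ B) →
  (∀ t → W t + g ≡ 2 * U + σ t) → (∀ t → H t + σ t ≡ K * U + g) →
  (∀ i → ∑ (λ t → bit (X t i) * H t) ≤ 2 * K * U) →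
  (∀ j → ∑ (λ t → bit (Y t j) * W t) ≤ 2 * K * U) →
  ∀ j → ∑ (λ t → bit (Y t j)) ≡ K × ∑ (λ t → bit (Y t j) * σ t) ≡ K * g
row-balance {B} K U g B≡ X Y W H σ cx cy col row width height colH rowW j =
  ycount j , ∑-tight row≤ total j
  where
  open ≤-Reasoning
  ξ η : Fin B → Fin B → ℕ
  ξ t i = bit (X t i)
  η t j = bit (Y t j)

  xcount : ∀ i → ∑ (λ t → ξ t i) ≡ 2
  xcount i = *-cancelʳ-≡ _ 2 K (trans (*-distribʳ-sum K (λ t → ξ t i)) (trans (col i) B≡))

  ycount : ∀ j → ∑ (λ t → η t j) ≡ K
  ycount j = *-cancelʳ-≡ _ K 2 (trans (*-distribʳ-sum 2 (λ t → η t j)) (trans (row j) (trans B≡ (*-comm 2 K))))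

  weighted : (b : Fin B → ℕ) (f h : Fin B → ℕ) → ∑ (λ t → b t * f t) + ∑ (λ t → b t * h t) ≡ ∑ (λ t → b t * (f t + h t))
  weighted b f h = trans (sym (∑-distrib-+ (λ t → b t * f t) (λ t → b t * h t)))
    (sum-cong-≗ (λ t → sym (*-distribˡ-+ (b t) (f t) (h t))))

  col≥ : ∀ i → 2 * g ≤ ∑ (λ t → ξ t i * σ t)
  col≥ i = +-cancelˡ-≤ (2 * K * U) _ _ (begin
    2 * K * U + 2 * g                                  ≡⟨ rearrange K U g ⟩
    2 * (K * U + g)                                    ≡⟨ cong (_* (K * U + g)) (xcount i) ⟨
    ∑ (λ t → ξ t i) * (K * U + g)                      ≡⟨ *-distribʳ-sum (K * U + g) (λ t → ξ t i) ⟩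
    ∑ (λ t → ξ t i * (K * U + g))                      ≡⟨ sum-cong-≗ (λ t → cong (ξ t i *_) (height t)) ⟨
    ∑ (λ t → ξ t i * (H t + σ t))                      ≡⟨ weighted (λ t → ξ t i) H σ ⟨
    ∑ (λ t → ξ t i * H t) + ∑ (λ t → ξ t i * σ t)      ≤⟨ +-monoˡ-≤ _ (colH i) ⟩
    2 * K * U + ∑ (λ t → ξ t i * σ t)                  ∎)
    where
    rearrange : ∀ K U g → 2 * K * U + 2 * g ≡ 2 * (K * U + g)
    rearrange = solve-∀

  row≤ : ∀ j → ∑ (λ t → η t j * σ t) ≤ K * g
  row≤ j = +-cancelˡ-≤ (2 * K * U) _ _ (begin
    2 * K * U + ∑ (λ t → η t j * σ t)                     ≡⟨ cong (_+ ∑ (λ t → η t j * σ t)) (rearrange K U) ⟩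
    K * (2 * U) + ∑ (λ t → η t j * σ t)                   ≡⟨ cong (λ c → c * (2 * U) + ∑ (λ t → η t j * σ t)) (ycount j) ⟨
    ∑ (λ t → η t j) * (2 * U) + ∑ (λ t → η t j * σ t)     ≡⟨ cong (_+ ∑ (λ t → η t j * σ t)) (*-distribʳ-sum (2 * U) (λ t → η t j)) ⟩
    ∑ (λ t → η t j * (2 * U)) + ∑ (λ t → η t j * σ t)     ≡⟨ weighted (λ t → η t j) (λ _ → 2 * U) σ ⟩
    ∑ (λ t → η t j * (2 * U + σ t))                       ≡⟨ sum-cong-≗ (λ t → cong (η t j *_) (width t)) ⟨
    ∑ (λ t → η t j * (W t + g))                           ≡⟨ weighted (λ t → η t j) W (λ _ → g) ⟨
    ∑ (λ t → η t j * W t) + ∑ (λ t → η t j * g)           ≡⟨ cong (λ a → ∑ (λ t → η t j * W t) + a) (*-distribʳ-sum g (λ t → η t j)) ⟨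
    ∑ (λ t → η t j * W t) + ∑ (λ t → η t j) * g           ≤⟨ +-mono-≤ (rowW j) (≤-reflexive (cong (_* g) (ycount j))) ⟩
    2 * K * U + K * g                                     ∎)
    where
    rearrange : ∀ K U → 2 * K * U ≡ K * (2 * U)
    rearrange = solve-∀

  transfer : ∀ c (z : Fin B → Fin B → ℕ) → (∀ t → ∑ (z t) ≡ c) →
             ∑ (λ i → ∑ (λ t → z t i * σ t)) ≡ c * ∑ σ
  transfer c z z≡c = begin-equality
    ∑ (λ i → ∑ (λ t → z t i * σ t))   ≡⟨ ∑-comm (λ i t → z t i * σ t) ⟩
    ∑ (λ t → ∑ (λ i → z t i * σ t))   ≡⟨ sum-cong-≗ (λ t → *-distribʳ-sum (σ t) (z t)) ⟨
    ∑ (λ t → ∑ (z t) * σ t)           ≡⟨ sum-cong-≗ (λ t → cong (_* σ t) (z≡c t)) ⟩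
    ∑ (λ t → c * σ t)                 ≡⟨ *-distribˡ-sum c σ ⟨
    c * ∑ σ                           ∎

  ∑σ≥ : B * g ≤ ∑ σ
  ∑σ≥ = *-cancelˡ-≤ 2 (begin
    2 * (B * g)                        ≡⟨ rearrange B g ⟩
    B * (2 * g)                        ≡⟨ ∑-const B (2 * g) ⟨
    ∑ {B} (λ _ → 2 * g)                ≤⟨ ∑-mono-≤ col≥ ⟩
    ∑ (λ i → ∑ (λ t → ξ t i * σ t))    ≡⟨ transfer 2 ξ cx ⟩
    2 * ∑ σ                            ∎)
    where
    rearrange : ∀ B g → 2 * (B * g) ≡ B * (2 * g)
    rearrange = solve-∀

  total : ∑ {B} (λ _ → K * g) ≤ ∑ (λ j → ∑ (λ t → η t j * σ t))
  total = begin
    ∑ {B} (λ _ → K * g)                ≡⟨ ∑-const B (K * g) ⟩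
    B * (K * g)                        ≡⟨ rearrange B K g ⟩
    K * (B * g)                        ≤⟨ *-monoʳ-≤ K ∑σ≥ ⟩
    K * ∑ σ                            ≡⟨ transfer K η cy ⟨
    ∑ (λ j → ∑ (λ t → η t j * σ t))    ∎
    where
    rearrange : ∀ B K g → B * (K * g) ≡ K * (B * g)
    rearrange = solve-∀

-- The spacing is `Q` rather than `U = Q + g`, so that the smallest possible width `2 * U - g` is
-- still at least `2 * Q` and the smallest possible height `K * U - g` at least `K * Q`. Conversely
-- `B * g < Q` gives `N = B * Q + B * g < suc B * Q`, so exactly `B` lines in either direction lie
-- in the knapsack.
module _ (r Q g : ℕ) (B*g<Q : 2 * suc (2 * r) * g < Q)
  (w h σ px py W H : Fin (2 * suc (2 * r)) → ℕ) (rot : Fin (2 * suc (2 * r)) → Bool)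
  (W≡ : ∀ t → W t ≡ (if rot t then h t else w t)) (H≡ : ∀ t → H t ≡ (if rot t then w t else h t))
  (width : ∀ t → w t + g ≡ 2 * (Q + g) + σ t) (height : ∀ t → h t + σ t ≡ suc (2 * r) * (Q + g) + g)
  (σ≤ : ∀ t → σ t ≤ 2 * g)
  (fitX : ∀ t → px t + W t ≤ 2 * suc (2 * r) * (Q + g)) (fitY : ∀ t → py t + H t ≤ 2 * suc (2 * r) * (Q + g))
  (separated : ∀ t t′ → t ≢ t′ →
    Apart (px t) (W t) (px t′) (W t′) ⊎ Apart (py t) (H t) (py t′) (H t′))
  where

  private
    K B U N : ℕ
    K = suc (2 * r)
    B = 2 * K
    U = Q + g
    N = 2 * K * U

    grid : Fin B → ℕ
    grid i = suc (toℕ i) * Q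

    X Y : Fin B → Fin B → Bool
    X t i = inside (px t) (W t) (grid i)
    Y t j = inside (py t) (H t) (grid j)

    0<Q : 0 < Q
    0<Q = ≤-<-trans z≤n B*g<Q

    N< : N < suc B * Q
    N< = begin-strict
      2 * K * (Q + g)   ≡⟨ *-distribˡ-+ B Q g ⟩
      B * Q + B * g     <⟨ +-monoʳ-< (B * Q) B*g<Q ⟩
      B * Q + Q         ≡⟨ +-comm (B * Q) Q ⟩
      Q + B * Q         ∎
      where open ≤-Reasoning

    2Q≤w : ∀ t → 2 * Q ≤ w t
    2Q≤w t = +-cancelʳ-≤ g _ _ (begin
      2 * Q + g         ≤⟨ m≤m+n _ (g + σ t) ⟩
      2 * Q + g + (g + σ t)  ≡⟨ rearrange Q g (σ t) ⟩
      2 * (Q + g) + σ t ≡⟨ width t ⟨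
      w t + g           ∎)
      where
      open ≤-Reasoning
      rearrange : ∀ Q g s → 2 * Q + g + (g + s) ≡ 2 * (Q + g) + s
      rearrange = solve-∀

    KQ≤h : ∀ t → K * Q ≤ h t
    KQ≤h t = +-cancelʳ-≤ (2 * g) _ _ (begin
      K * Q + 2 * g        ≤⟨ m≤m+n _ (2 * r * g) ⟩
      K * Q + 2 * g + 2 * r * g ≡⟨ rearrange r Q g ⟩
      K * (Q + g) + g      ≡⟨ height t ⟨
      h t + σ t            ≤⟨ +-monoʳ-≤ (h t) (σ≤ t) ⟩
      h t + 2 * g          ∎)
      where
      open ≤-Reasoning
      rearrange : ∀ r Q g → suc (2 * r) * Q + 2 * g + 2 * r * g ≡ suc (2 * r) * (Q + g) + g
      rearrange = solve-∀

    a≤ : ∀ t → (if rot t then K else 2) ≤ ∑ (λ i → bit (X t i))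
    a≤ t = stab Q B N _ (px t) (W t) 0<Q N< (≤-trans enough (≤-reflexive (sym (W≡ t)))) (fitX t)
      where
      enough : (if rot t then K else 2) * Q ≤ (if rot t then h t else w t)
      enough with rot t
      ... | true  = KQ≤h t
      ... | false = 2Q≤w t

    b≤ : ∀ t → (if rot t then 2 else K) ≤ ∑ (λ i → bit (Y t i))
    b≤ t = stab Q B N _ (py t) (H t) 0<Q N< (≤-trans enough (≤-reflexive (sym (H≡ t)))) (fitY t)
      where
      enough : (if rot t then 2 else K) * Q ≤ (if rot t then w t else h t)
      enough with rot t
      ... | true  = 2Q≤w t
      ... | false = KQ≤h t

    apartY : ∀ i t t′ → t ≢ t′ → X t i ≡ true → X t′ i ≡ true → Apart (py t) (H t) (py t′) (H t′)
    apartY i t t′ t≢t′ Xt Xt′ with separated t t′ t≢t′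
    ... | inj₁ apart = ⊥-elim (apart⇒exclusive apart (grid i) Xt Xt′)
    ... | inj₂ apart = apart

    apartX : ∀ j t t′ → t ≢ t′ → Y t j ≡ true → Y t′ j ≡ true → Apart (px t) (W t) (px t′) (W t′)
    apartX j t t′ t≢t′ Yt Yt′ with separated t t′ t≢t′
    ... | inj₁ apart = apart
    ... | inj₂ apart = ⊥-elim (apart⇒exclusive apart (grid j) Yt Yt′)

    exclusive : ∀ t t′ → t ≢ t′ → ∀ i j → X t i ∧ Y t j ≡ true → X t′ i ∧ Y t′ j ≡ true → ⊥
    exclusive t t′ t≢t′ i j XY XY′ =
      let Xt , Yt = ∧-true (X t i) _ XY ; Xt′ , Yt′ = ∧-true (X t′ i) _ XY′
      in apart⇒exclusive (apartY i t t′ t≢t′ Xt Xt′) (grid j) Yt Yt′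

    open module Tiles = Tiling r X Y rot exclusive a≤ b≤

    columnH : ∀ i → ∑ (λ t → bit (X t i) * H t) ≤ N
    columnH i = ∑-lengths≤ N (λ t → X t i) py H (apartY i) fitY

    rowW : ∀ j → ∑ (λ t → bit (Y t j) * W t) ≤ N
    rowW j = ∑-lengths≤ N (λ t → Y t j) px W (apartX j) fitX

    bit*-cong : (z : Fin B → Bool) {f f′ : Fin B → ℕ} → (∀ t → f t ≡ f′ t) →
                ∑ (λ t → bit (z t) * f t) ≡ ∑ (λ t → bit (z t) * f′ t)
    bit*-cong z f≡ = sum-cong-≗ (λ t → cong (bit (z t) *_) (f≡ t))

  -- If all items are rotated, the knapsack is reflected at the diagonal: `X` and `Y` change places
  -- and a vertical line plays the row. Every line is balanced; line `zero` is just one of them.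
  packing-row : ∃ λ (b : Fin B → Bool) →
    ∑ (λ t → bit (b t)) ≡ K × ∑ (λ t → bit (b t) * σ t) ≡ K * g
  packing-row with uniform
  ... | inj₁ upright = (λ t → Y t zero) , row-balance K U g refl X Y w h σ
    (λ t → trans (x-count t) (a≡ t)) (λ t → trans (y-count t) (b≡ t))
    (λ i → trans (sym (bit*-cong (λ t → X t i) b≡)) (column i))
    (λ j → trans (sym (bit*-cong (λ t → Y t j) a≡)) (row j))
    width height
    (λ i → subst (_≤ N) (bit*-cong (λ t → X t i) H≡h) (columnH i))
    (λ j → subst (_≤ N) (bit*-cong (λ t → Y t j) W≡w) (rowW j))
    zero
    where
    a≡ : ∀ t → (if rot t then K else 2) ≡ 2
    a≡ t = cong (λ c → if c then K else 2) (upright t)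
    b≡ : ∀ t → (if rot t then 2 else K) ≡ K
    b≡ t = cong (λ c → if c then 2 else K) (upright t)
    W≡w : ∀ t → W t ≡ w t
    W≡w t = trans (W≡ t) (cong (λ c → if c then h t else w t) (upright t))
    H≡h : ∀ t → H t ≡ h t
    H≡h t = trans (H≡ t) (cong (λ c → if c then w t else h t) (upright t))
  ... | inj₂ rotated = (λ t → X t zero) , row-balance K U g refl Y X w h σ
    (λ t → trans (y-count t) (b≡ t)) (λ t → trans (x-count t) (a≡ t))
    (λ j → trans (sym (bit*-cong (λ t → Y t j) a≡)) (row j))
    (λ i → trans (sym (bit*-cong (λ t → X t i) b≡)) (column i))
    width height
    (λ j → subst (_≤ N) (bit*-cong (λ t → Y t j) W≡h) (rowW j))
    (λ i → subst (_≤ N) (bit*-cong (λ t → X t i) H≡w) (columnH i))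
    zero
    where
    a≡ : ∀ t → (if rot t then K else 2) ≡ K
    a≡ t = cong (λ c → if c then K else 2) (rotated t)
    b≡ : ∀ t → (if rot t then 2 else K) ≡ 2
    b≡ t = cong (λ c → if c then 2 else K) (rotated t)
    W≡h : ∀ t → W t ≡ h t
    W≡h t = trans (W≡ t) (cong (λ c → if c then h t else w t) (rotated t))
    H≡w : ∀ t → H t ≡ w t
    H≡w t = trans (H≡ t) (cong (λ c → if c then w t else h t) (rotated t))

-- From rational to integral positions

ℕ→ℚ≡mkℚ : ∀ a → ℕ→ℚ a ≡ mkℚ (+ a) 0 (Coprime.sym (1-coprimeTo a))
ℕ→ℚ≡mkℚ a = ℚ.normalize-coprime {a} {0} (Coprime.sym (1-coprimeTo a))

ℕ→ℚ-+ : ∀ a b → ℕ→ℚ (a + b) ≡ ℕ→ℚ a ℚ.+ ℕ→ℚ b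
ℕ→ℚ-+ a b rewrite ℕ→ℚ≡mkℚ a | ℕ→ℚ≡mkℚ b =
  cong (λ c → c ℚ./ 1) (sym (cong₂ ℤ._+_ (ℤ.*-identityʳ (+ a)) (ℤ.*-identityʳ (+ b))))

ℕ→ℚ-mono-≤ : ∀ {a b} → a ≤ b → ℕ→ℚ a ℚ.≤ ℕ→ℚ b
ℕ→ℚ-mono-≤ {a} {b} a≤b rewrite ℕ→ℚ≡mkℚ a | ℕ→ℚ≡mkℚ b =
  ℚ.*≤* (subst₂ ℤ._≤_ (sym (ℤ.*-identityʳ (+ a))) (sym (ℤ.*-identityʳ (+ b))) (ℤ.+≤+ a≤b))

ℕ→ℚ-nonNeg : ∀ a → 0ℚ ℚ.≤ ℕ→ℚ a
ℕ→ℚ-nonNeg a = ℕ→ℚ-mono-≤ {0} {a} z≤n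

-- A floor for nonnegative arguments only, as it divides the absolute value of the numerator. Left
-- and bottom coordinates inside the knapsack are nonnegative.
floorℕ : ℚ → ℕ
floorℕ (mkℚ p d _) = ℤ.∣ p ∣ ℕ./ suc d

≤⇒≤floorℕ : ∀ {a} q → ℕ→ℚ a ℚ.≤ q → a ≤ floorℕ q
≤⇒≤floorℕ {a} q le rewrite ℕ→ℚ≡mkℚ a with q | ℚ.drop-*≤* le
... | mkℚ (+ p) d _ | le′ = subst (_≤ p ℕ./ suc d) (m*n/n≡m a (suc d)) (/-monoˡ-≤ (suc d)
  (ℤ.drop‿+≤+ (subst₂ ℤ._≤_ (sym (ℤ.pos-* a (suc d))) (ℤ.*-identityʳ (+ p)) le′)))
... | mkℚ -[1+ p ] d _ | le′ with subst (ℤ._≤ _) (sym (ℤ.pos-* a (suc d))) le′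
... | ()

floorℕ≤ : ∀ q → 0ℚ ℚ.≤ q → ℕ→ℚ (floorℕ q) ℚ.≤ q
floorℕ≤ q@(mkℚ (+ p) d _) _ rewrite ℕ→ℚ≡mkℚ (p ℕ./ suc d) = ℚ.*≤* (subst₂ ℤ._≤_
  (ℤ.pos-* (p ℕ./ suc d) (suc d)) (sym (ℤ.*-identityʳ (+ p))) (ℤ.+≤+ (m/n*n≤m p (suc d))))
floorℕ≤ (mkℚ -[1+ p ] d _) (ℚ.*≤* ())

-- Since `a` is an integer, `floorℕ l + a` is an integer below `q`, hence below its floor. So both
-- containment and separation survive rounding all positions down.
floorℕ-+-≤ : ∀ {l q} a → 0ℚ ℚ.≤ l → l ℚ.+ ℕ→ℚ a ℚ.≤ q → floorℕ l + a ≤ floorℕ q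
floorℕ-+-≤ {l} {q} a 0≤l le = ≤⇒≤floorℕ q (begin
  ℕ→ℚ (floorℕ l + a)        ≡⟨ ℕ→ℚ-+ (floorℕ l) a ⟩
  ℕ→ℚ (floorℕ l) ℚ.+ ℕ→ℚ a  ≤⟨ ℚ.+-monoˡ-≤ (ℕ→ℚ a) (floorℕ≤ l 0≤l) ⟩
  l ℚ.+ ℕ→ℚ a               ≤⟨ le ⟩
  q                         ∎)
  where open ℚ.≤-Reasoning

floorℕ-ℕ→ℚ : ∀ a → floorℕ (ℕ→ℚ a) ≡ a
floorℕ-ℕ→ℚ a rewrite ℕ→ℚ≡mkℚ a = n/1≡n a

l<l+ : ∀ l {a} → 0 < a → l ℚ.< l ℚ.+ ℕ→ℚ a
l<l+ l {a} 0<a = subst (ℚ._< l ℚ.+ ℕ→ℚ a) (ℚ.+-identityʳ l)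
  (ℚ.+-monoʳ-< l (ℚ.<-≤-trans {0ℚ} {ℕ→ℚ 1} (0<1 ) (ℕ→ℚ-mono-≤ 0<a)))
  where
  0<1 : 0ℚ ℚ.< ℕ→ℚ 1
  0<1 = ℚ.*<* (ℤ.+<+ (s≤s z≤n))

ℚ-≤⇒≯ : ∀ {p q} → p ℚ.≤ q → ¬ q ℚ.< p
ℚ-≤⇒≯ p≤q q<p = ℚ.<-irrefl refl (ℚ.≤-<-trans p≤q q<p)

apart-or-meet : ∀ {l e l′ e′} → l ℚ.< e → l′ ℚ.< e′ →
          (e ℚ.≤ l′ ⊎ e′ ℚ.≤ l) ⊎ ∃ λ u → (l ℚ.< u × u ℚ.< e) × (l′ ℚ.< u × u ℚ.< e′)
apart-or-meet {l} {e} {l′} {e′} l<e l′<e′ with e ℚ.≤? l′ | e′ ℚ.≤? l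
... | yes e≤l′ | _ = inj₁ (inj₁ e≤l′)
... | no _ | yes e′≤l = inj₁ (inj₂ e′≤l)
... | no e≰l′ | no e′≰l with ℚ.≰⇒> e≰l′ | ℚ.≰⇒> e′≰l | ℚ.≤-total l l′ | ℚ.≤-total e e′
... | l′<e | l<e′ | inj₁ l≤l′ | inj₁ e≤e′ = let u , p , q = ℚ.<-dense l′<e in
  inj₂ (u , (ℚ.≤-<-trans l≤l′ p , q) , (p , ℚ.<-≤-trans q e≤e′))
... | l′<e | l<e′ | inj₁ l≤l′ | inj₂ e′≤e = let u , p , q = ℚ.<-dense l′<e′ in
  inj₂ (u , (ℚ.≤-<-trans l≤l′ p , ℚ.<-≤-trans q e′≤e) , (p , q))
... | l′<e | l<e′ | inj₂ l′≤l | inj₁ e≤e′ = let u , p , q = ℚ.<-dense l<e in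
  inj₂ (u , (p , q) , (ℚ.≤-<-trans l′≤l p , ℚ.<-≤-trans q e≤e′))
... | l′<e | l<e′ | inj₂ l′≤l | inj₂ e′≤e = let u , p , q = ℚ.<-dense l<e′ in
  inj₂ (u , (p , ℚ.<-≤-trans q e′≤e) , (ℚ.≤-<-trans l′≤l p , q))

-- Containment is known for interior points only. Were `l` negative, the open intervals from `l` to
-- `e` and from `l` to 0 would meet in a negative point of the item; the upper end is treated alike
-- with the interval from `N` to `e`.
interval-bounds : ∀ {l e N} → l ℚ.< e → (∀ u → l ℚ.< u → u ℚ.< e → 0ℚ ℚ.≤ u × u ℚ.≤ N) → 0ℚ ℚ.≤ l × e ℚ.≤ N
interval-bounds {l} {e} {N} l<e inN = lower , upper
  where
  lower : 0ℚ ℚ.≤ l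
  lower with 0ℚ ℚ.≤? l
  ... | yes 0≤l = 0≤l
  ... | no 0≰l with l<0 ← ℚ.≰⇒> 0≰l with apart-or-meet l<e l<0
  ... | inj₁ (inj₁ e≤l) = contradiction l<e (ℚ-≤⇒≯ e≤l)
  ... | inj₁ (inj₂ 0≤l) = 0≤l
  ... | inj₂ (u , (p , q) , (_ , u<0)) = contradiction u<0 (ℚ-≤⇒≯ (proj₁ (inN u p q)))
  upper : e ℚ.≤ N
  upper with e ℚ.≤? N
  ... | yes e≤N = e≤N
  ... | no e≰N with N<e ← ℚ.≰⇒> e≰N with apart-or-meet l<e N<e
  ... | inj₁ (inj₁ e≤N) = e≤N
  ... | inj₁ (inj₂ e≤l) = contradiction l<e (ℚ-≤⇒≯ e≤l)
  ... | inj₂ (u , (p , q) , (N<u , _)) = contradiction N<u (ℚ-≤⇒≯ (proj₂ (inN u p q)))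

module _ (I : Instance) (ρ : Rect) (0<sizeX : 0 < Rect.sizeX ρ) (0<sizeY : 0 < Rect.sizeY ρ)
  (inside : ∀ pt → pt ∈ᵒ ρ → InKnapsack I pt) where
  open Instance I using (N)
  open Rect ρ

  boundsX : 0ℚ ℚ.≤ left × left ℚ.+ ℕ→ℚ sizeX ℚ.≤ ℕ→ℚ N
  boundsX = let v , p , q = ℚ.<-dense (l<l+ bottom 0<sizeY) in
    interval-bounds (l<l+ left 0<sizeX) (λ u p′ q′ → proj₁ (inside (u , v) ((p′ , q′) , (p , q))))

  boundsY : 0ℚ ℚ.≤ bottom × bottom ℚ.+ ℕ→ℚ sizeY ℚ.≤ ℕ→ℚ N
  boundsY = let u , p , q = ℚ.<-dense (l<l+ left 0<sizeX) in
    interval-bounds (l<l+ bottom 0<sizeY) (λ v p′ q′ → proj₂ (inside (u , v) ((p , q) , (p′ , q′))))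

module _ (r r′ : Rect) where
  private
    module R = Rect r
    module R′ = Rect r′

  -- If the projections met on both axes, the two common coordinates would form a point of both
  -- rectangles. Positive sizes matter: an empty open rectangle is disjoint from everything,
  -- wherever it lies.
  disjoint⇒apart : 0 < R.sizeX → 0 < R.sizeY → 0 < R′.sizeX → 0 < R′.sizeY →
    0ℚ ℚ.≤ R.left → 0ℚ ℚ.≤ R.bottom → 0ℚ ℚ.≤ R′.left → 0ℚ ℚ.≤ R′.bottom → Disjoint r r′ →
      Apart (floorℕ R.left) R.sizeX (floorℕ R′.left) R′.sizeX
    ⊎ Apart (floorℕ R.bottom) R.sizeY (floorℕ R′.bottom) R′.sizeY
  disjoint⇒apart 0<X 0<Y 0<X′ 0<Y′ 0≤x 0≤y 0≤x′ 0≤y′ disjoint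
    with apart-or-meet (l<l+ R.left 0<X) (l<l+ R′.left 0<X′) | apart-or-meet (l<l+ R.bottom 0<Y) (l<l+ R′.bottom 0<Y′)
  ... | inj₁ x | _ = inj₁ (Sum.map (floorℕ-+-≤ R.sizeX 0≤x) (floorℕ-+-≤ R′.sizeX 0≤x′) x)
  ... | inj₂ _ | inj₁ y = inj₂ (Sum.map (floorℕ-+-≤ R.sizeY 0≤y) (floorℕ-+-≤ R′.sizeY 0≤y′) y)
  ... | inj₂ (u , p , q) | inj₂ (v , p′ , q′) = ⊥-elim (disjoint (u , v) ((p , p′) , (q , q′)))

-- Balanced rows and k-Sum

data Kind (n : ℕ) : Set where
  low high   : Kind n
  plus minus : Fin n → Kind n

pluses minuses : ∀ {n} → List (Kind n) → List (Fin n)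
pluses []             = []
pluses (plus i ∷ ks)  = i ∷ pluses ks
pluses (low ∷ ks)     = pluses ks
pluses (high ∷ ks)    = pluses ks
pluses (minus _ ∷ ks) = pluses ks
minuses []             = []
minuses (minus i ∷ ks) = i ∷ minuses ks
minuses (low ∷ ks)     = minuses ks
minuses (high ∷ ks)    = minuses ks
minuses (plus _ ∷ ks)  = minuses ks

lows highs : ∀ {n} → List (Kind n) → ℕ
lows []             = 0
lows (low ∷ ks)     = suc (lows ks)
lows (high ∷ ks)    = lows ks
lows (plus _ ∷ ks)  = lows ks
lows (minus _ ∷ ks) = lows ks
highs []             = 0
highs (high ∷ ks)    = suc (highs ks)
highs (low ∷ ks)     = highs ks
highs (plus _ ∷ ks)  = highs ks
highs (minus _ ∷ ks) = highs ks

length-split : ∀ {n} (ks : List (Kind n)) →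
  length ks ≡ length (pluses ks) + length (minuses ks) + lows ks + highs ks
length-split [] = refl
length-split (low ∷ ks)     = trans (cong suc (length-split ks))
  (cong (_+ highs ks) (sym (+-suc (length (pluses ks) + length (minuses ks)) (lows ks))))
length-split (high ∷ ks)    = trans (cong suc (length-split ks)) (sym (+-suc _ (highs ks)))
length-split (plus i ∷ ks)  = cong suc (length-split ks)
length-split (minus i ∷ ks) = trans (cong suc (length-split ks))
  (cong (λ a → a + lows ks + highs ks) (sym (+-suc (length (pluses ks)) (length (minuses ks)))))

module _ {n : ℕ} where

  ≢-pluses : ∀ {i : Fin n} {ks} → All (plus i ≢_) ks → All (i ≢_) (pluses ks)
  ≢-pluses {ks = []} [] = []
  ≢-pluses {ks = low ∷ _} (_ ∷ ps) = ≢-pluses ps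
  ≢-pluses {ks = high ∷ _} (_ ∷ ps) = ≢-pluses ps
  ≢-pluses {ks = plus _ ∷ _} (p ∷ ps) = (λ e → p (cong plus e)) ∷ ≢-pluses ps
  ≢-pluses {ks = minus _ ∷ _} (_ ∷ ps) = ≢-pluses ps

  ≢-minuses : ∀ {i : Fin n} {ks} → All (minus i ≢_) ks → All (i ≢_) (minuses ks)
  ≢-minuses {ks = []} [] = []
  ≢-minuses {ks = low ∷ _} (_ ∷ ps) = ≢-minuses ps
  ≢-minuses {ks = high ∷ _} (_ ∷ ps) = ≢-minuses ps
  ≢-minuses {ks = minus _ ∷ _} (p ∷ ps) = (λ e → p (cong minus e)) ∷ ≢-minuses ps
  ≢-minuses {ks = plus _ ∷ _} (_ ∷ ps) = ≢-minuses ps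

  ≢-lows : ∀ {ks : List (Kind n)} → All (low ≢_) ks → lows ks ≡ 0
  ≢-lows {[]} [] = refl
  ≢-lows {low ∷ _} (p ∷ _) = ⊥-elim (p refl)
  ≢-lows {high ∷ _} (_ ∷ ps) = ≢-lows ps
  ≢-lows {plus _ ∷ _} (_ ∷ ps) = ≢-lows ps
  ≢-lows {minus _ ∷ _} (_ ∷ ps) = ≢-lows ps

  ≢-highs : ∀ {ks : List (Kind n)} → All (high ≢_) ks → highs ks ≡ 0
  ≢-highs {[]} [] = refl
  ≢-highs {high ∷ _} (p ∷ _) = ⊥-elim (p refl)
  ≢-highs {low ∷ _} (_ ∷ ps) = ≢-highs ps
  ≢-highs {plus _ ∷ _} (_ ∷ ps) = ≢-highs ps
  ≢-highs {minus _ ∷ _} (_ ∷ ps) = ≢-highs ps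

  Unique-pluses : ∀ {ks : List (Kind n)} → Unique ks → Unique (pluses ks)
  Unique-pluses {[]} [] = []
  Unique-pluses {low ∷ _} (_ ∷ u) = Unique-pluses u
  Unique-pluses {high ∷ _} (_ ∷ u) = Unique-pluses u
  Unique-pluses {plus _ ∷ _} (p ∷ u) = ≢-pluses p ∷ Unique-pluses u
  Unique-pluses {minus _ ∷ _} (_ ∷ u) = Unique-pluses u

  Unique-minuses : ∀ {ks : List (Kind n)} → Unique ks → Unique (minuses ks)
  Unique-minuses {[]} [] = []
  Unique-minuses {low ∷ _} (_ ∷ u) = Unique-minuses u
  Unique-minuses {high ∷ _} (_ ∷ u) = Unique-minuses u
  Unique-minuses {plus _ ∷ _} (_ ∷ u) = Unique-minuses u
  Unique-minuses {minus _ ∷ _} (p ∷ u) = ≢-minuses p ∷ Unique-minuses u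

  lows≤1 : ∀ {ks : List (Kind n)} → Unique ks → lows ks ≤ 1
  lows≤1 {[]} [] = z≤n
  lows≤1 {low ∷ _} (p ∷ u) = s≤s (≤-reflexive (≢-lows p))
  lows≤1 {high ∷ _} (_ ∷ u) = lows≤1 u
  lows≤1 {plus _ ∷ _} (_ ∷ u) = lows≤1 u
  lows≤1 {minus _ ∷ _} (_ ∷ u) = lows≤1 u

  highs≤1 : ∀ {ks : List (Kind n)} → Unique ks → highs ks ≤ 1
  highs≤1 {[]} [] = z≤n
  highs≤1 {high ∷ _} (p ∷ u) = s≤s (≤-reflexive (≢-highs p))
  highs≤1 {low ∷ _} (_ ∷ u) = highs≤1 u
  highs≤1 {plus _ ∷ _} (_ ∷ u) = highs≤1 u
  highs≤1 {minus _ ∷ _} (_ ∷ u) = highs≤1 u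

sumOver : ∀ {n} → (Fin n → ℤ) → List (Fin n) → ℤ
sumOver z []       = + 0
sumOver z (i ∷ is) = z i ℤ.+ sumOver z is

sumOver-bound : ∀ {n} A (z : Fin n → ℤ) → (∀ i → ℤ.∣ z i ∣ ≤ A) → ∀ is → ℤ.∣ sumOver z is ∣ ≤ length is * A
sumOver-bound A z z≤A []       = z≤n
sumOver-bound A z z≤A (i ∷ is) =
  ≤-trans (ℤ.∣i+j∣≤∣i∣+∣j∣ (z i) (sumOver z is)) (+-mono-≤ (z≤A i) (sumOver-bound A z z≤A is))

Unique⇒lookup-injective : ∀ {A : Set} {xs : List A} → Unique xs → ∀ {i j} → lookup xs i ≡ lookup xs j → i ≡ j
Unique⇒lookup-injective (_ ∷ _) {zero}  {zero}  _  = refl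
Unique⇒lookup-injective {xs = _ ∷ xs} (p ∷ _) {zero}  {suc j} eq = ⊥-elim (All.lookup p (∈-lookup j) eq)
Unique⇒lookup-injective {xs = _ ∷ xs} (p ∷ _) {suc i} {zero}  eq = ⊥-elim (All.lookup p (∈-lookup i) (sym eq))
Unique⇒lookup-injective (_ ∷ u) {suc i} {suc j} eq = cong suc (Unique⇒lookup-injective u eq)

sumOver-lookup : ∀ {n} (z : Fin n → ℤ) is → sumℤ (λ j → z (lookup is j)) ≡ sumOver z is
sumOver-lookup z []       = refl
sumOver-lookup z (i ∷ is) = cong (λ s → z i ℤ.+ s) (sumOver-lookup z is)

list⇒HasKSum : ∀ {n k} (z : Fin n → ℤ) is → length is ≡ k → Unique is → sumOver z is ≡ + 0 → HasKSum k z
list⇒HasKSum z is refl u eq = lookup is , Unique⇒lookup-injective u , trans (sumOver-lookup z is) eq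

-- This is `s + g`, where `s` is the signed offset of the item and `g = k * β` the largest absolute
-- value of `s`; the shift makes it a natural number. A row of `K` items has total `s` zero if and
-- only if these values add up to `K * g`.
offset : ∀ {n} → ℕ → (Fin n → ℕ) → Kind n → ℕ
offset g b low       = 0
offset g b high      = g + g
offset g b (plus i)  = g + b i
offset g b (minus i) = g ∸ b i

module _ {n : ℕ} (g : ℕ) (b : Fin n → ℕ) (b≤g : ∀ i → b i ≤ g) where

  -- The negative contributions stand on the left-hand side, so that the sum can be expressed in `ℕ`
  -- without truncated subtraction.
  offset-sum : ∀ ks → sum (map (offset g b) ks) + sum (map b (minuses ks)) + lows ks * g
                    ≡ length ks * g + sum (map b (pluses ks)) + highs ks * g
  offset-sum [] = refl
  offset-sum (low ∷ ks) = trans (lemma (sum (map (offset g b) ks)) (sum (map b (minuses ks))) (lows ks * g) g)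
    (trans (cong (λ a → g + a) (offset-sum ks))
      (lemma′ (length ks * g) (sum (map b (pluses ks))) (highs ks * g) g))
    where
    lemma : ∀ o m l g → o + m + (g + l) ≡ g + (o + m + l)
    lemma = solve-∀
    lemma′ : ∀ o m l g → g + (o + m + l) ≡ g + o + m + l
    lemma′ = solve-∀
  offset-sum (high ∷ ks) = trans (lemma (sum (map (offset g b) ks)) (sum (map b (minuses ks))) (lows ks * g) g)
    (trans (cong (λ a → g + g + a) (offset-sum ks))
      (lemma′ (length ks * g) (sum (map b (pluses ks))) (highs ks * g) g))
    where
    lemma : ∀ o m l g → g + g + o + m + l ≡ g + g + (o + m + l)
    lemma = solve-∀
    lemma′ : ∀ o m l g → g + g + (o + m + l) ≡ g + o + m + (g + l)
    lemma′ = solve-∀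
  offset-sum (plus i ∷ ks) = trans (lemma (sum (map (offset g b) ks)) (sum (map b (minuses ks))) (lows ks * g) g (b i))
    (trans (cong (λ a → g + b i + a) (offset-sum ks))
      (lemma′ (length ks * g) (sum (map b (pluses ks))) (highs ks * g) g (b i)))
    where
    lemma : ∀ o m l g c → g + c + o + m + l ≡ g + c + (o + m + l)
    lemma = solve-∀
    lemma′ : ∀ o m l g c → g + c + (o + m + l) ≡ g + o + (c + m) + l
    lemma′ = solve-∀
  offset-sum (minus i ∷ ks) = trans (lemma (sum (map (offset g b) ks)) (sum (map b (minuses ks))) (lows ks * g) (g ∸ b i) (b i))
    (trans (cong₂ (λ c a → c + a) (m∸n+n≡m (b≤g i)) (offset-sum ks))
      (lemma′ (length ks * g) (sum (map b (pluses ks))) (highs ks * g) g))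
    where
    lemma : ∀ o m l g c → g + o + (c + m) + l ≡ (g + c) + (o + m + l)
    lemma = solve-∀
    lemma′ : ∀ o m l g → g + (o + m + l) ≡ g + o + m + l
    lemma′ = solve-∀

small-multiple : ∀ β x → ℤ.∣ + β ℤ.* x ∣ < β → x ≡ + 0
small-multiple β x small = ℤ.∣i∣≡0⇒i≡0 (lemma ℤ.∣ x ∣ (subst (_< β) (ℤ.abs-* (+ β) x) small))
  where
  lemma : ∀ a → β * a < β → a ≡ 0
  lemma zero    _ = refl
  lemma (suc a) β*a<β = ⊥-elim (<-irrefl refl (≤-<-trans (m≤m*n β (suc a)) β*a<β))

-- Separating the multiples of `β` from the integers turns the balance into `β * (mc - pc) = sumOver
-- z P - sumOver z M`. The right-hand side is at most `K * A < β` in absolute value, so both sides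
-- vanish: the first gives the composition of the row, the second the equation between the integers.
kinds⇒HasKSum : ∀ {n} r β A (z : Fin n → ℤ) (b : Fin n → ℕ) →
  (∀ i → + b i ≡ + β ℤ.+ z i) → (∀ i → b i ≤ 2 * r * β) → (∀ i → ℤ.∣ z i ∣ ≤ A) → suc (2 * r) * A < β →
  ∀ ks → Unique ks → length ks ≡ suc (2 * r) → sum (map (offset (2 * r * β) b) ks) ≡ suc (2 * r) * (2 * r * β) →
  HasKSum (2 * r) z
kinds⇒HasKSum {n} r β A z b b≡ b≤g z≤A KA<β ks unique len≡ sum≡ =
  conclude (lows ks) (highs ks) (lows≤1 unique) (highs≤1 unique) length≡ counts≡
  where
  g = 2 * r * β
  P = pluses ks
  M = minuses ks
  p = length P
  q = length M

  length≡ : p + q + lows ks + highs ks ≡ suc (2 * r)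
  length≡ = trans (sym (length-split ks)) len≡

  balance : sum (map b M) + lows ks * g ≡ sum (map b P) + highs ks * g
  balance = +-cancelˡ-≡ (suc (2 * r) * g) _ _ (begin
    suc (2 * r) * g + (sum (map b M) + lows ks * g)            ≡⟨ +-assoc (suc (2 * r) * g) _ _ ⟨
    suc (2 * r) * g + sum (map b M) + lows ks * g              ≡⟨ cong (λ s → s + sum (map b M) + lows ks * g) sum≡ ⟨
    sum (map (offset g b) ks) + sum (map b M) + lows ks * g    ≡⟨ offset-sum g b b≤g ks ⟩
    length ks * g + sum (map b P) + highs ks * g               ≡⟨ cong (λ l → l * g + sum (map b P) + highs ks * g) len≡ ⟩
    suc (2 * r) * g + sum (map b P) + highs ks * g             ≡⟨ +-assoc (suc (2 * r) * g) _ _ ⟩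
    suc (2 * r) * g + (sum (map b P) + highs ks * g)           ∎)
    where open ≡-Reasoning

  sum-b : ∀ is → + sum (map b is) ≡ + length is ℤ.* + β ℤ.+ sumOver z is
  sum-b [] = refl
  sum-b (i ∷ is) = begin
    + (b i + sum (map b is))                                  ≡⟨ ℤ.pos-+ (b i) _ ⟩
    + b i ℤ.+ + sum (map b is)                                ≡⟨ cong₂ ℤ._+_ (b≡ i) (sum-b is) ⟩
    + β ℤ.+ z i ℤ.+ (+ length is ℤ.* + β ℤ.+ sumOver z is)    ≡⟨ rearrange (+ β) (z i) (+ length is) (sumOver z is) ⟩
    (+ 1 ℤ.+ + length is) ℤ.* + β ℤ.+ (z i ℤ.+ sumOver z is)  ∎
    where
    open ≡-Reasoning
    rearrange : ∀ β z l s → β ℤ.+ z ℤ.+ (l ℤ.* β ℤ.+ s) ≡ (+ 1 ℤ.+ l) ℤ.* β ℤ.+ (z ℤ.+ s)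
    rearrange = ℤ.solve-∀

  expand : ∀ is l → + (sum (map b is) + l * g) ≡ + (length is + l * (2 * r)) ℤ.* + β ℤ.+ sumOver z is
  expand is l = begin
    + (sum (map b is) + l * g)                                         ≡⟨ ℤ.pos-+ _ (l * g) ⟩
    + sum (map b is) ℤ.+ + (l * g)                                     ≡⟨ cong₂ ℤ._+_ (sum-b is) (cong +_ (sym (*-assoc l (2 * r) β))) ⟩
    + length is ℤ.* + β ℤ.+ sumOver z is ℤ.+ + (l * (2 * r) * β)       ≡⟨ cong (λ x → + length is ℤ.* + β ℤ.+ sumOver z is ℤ.+ x) (ℤ.pos-* (l * (2 * r)) β) ⟩
    + length is ℤ.* + β ℤ.+ sumOver z is ℤ.+ + (l * (2 * r)) ℤ.* + β   ≡⟨ rearrange (+ length is) (+ β) (sumOver z is) (+ (l * (2 * r))) ⟩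
    (+ length is ℤ.+ + (l * (2 * r))) ℤ.* + β ℤ.+ sumOver z is         ≡⟨ cong (λ x → x ℤ.* + β ℤ.+ sumOver z is) (sym (ℤ.pos-+ (length is) (l * (2 * r)))) ⟩
    + (length is + l * (2 * r)) ℤ.* + β ℤ.+ sumOver z is               ∎
    where
    open ≡-Reasoning
    rearrange : ∀ x β s y → x ℤ.* β ℤ.+ s ℤ.+ y ℤ.* β ≡ (x ℤ.+ y) ℤ.* β ℤ.+ s
    rearrange = ℤ.solve-∀

  -- The multiplicities of `β` on the two sides of `balance`; an extra item counts `2 * r` times.
  mc pc : ℕ
  mc = q + lows ks * (2 * r)
  pc = p + highs ks * (2 * r)

  difference : + β ℤ.* (+ mc ℤ.- + pc) ≡ sumOver z P ℤ.- sumOver z M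
  difference = begin
    + β ℤ.* (+ mc ℤ.- + pc)                                    ≡⟨ rearrange (+ β) (+ mc) (+ pc) (sumOver z M) ⟩
    (+ mc ℤ.* + β ℤ.+ sumOver z M) ℤ.- + pc ℤ.* + β ℤ.- sumOver z M
      ≡⟨ cong (λ x → x ℤ.- + pc ℤ.* + β ℤ.- sumOver z M) (trans (sym (expand M (lows ks))) (trans (cong +_ balance) (expand P (highs ks)))) ⟩
    (+ pc ℤ.* + β ℤ.+ sumOver z P) ℤ.- + pc ℤ.* + β ℤ.- sumOver z M  ≡⟨ rearrange′ (+ pc ℤ.* + β) (sumOver z P) (sumOver z M) ⟩
    sumOver z P ℤ.- sumOver z M                                ∎
    where
    open ≡-Reasoning
    rearrange : ∀ β m p s → β ℤ.* (m ℤ.- p) ≡ (m ℤ.* β ℤ.+ s) ℤ.- p ℤ.* β ℤ.- s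
    rearrange = ℤ.solve-∀
    rearrange′ : ∀ a s t → (a ℤ.+ s) ℤ.- a ℤ.- t ≡ s ℤ.- t
    rearrange′ = ℤ.solve-∀

  small : ℤ.∣ sumOver z P ℤ.- sumOver z M ∣ < β
  small = begin-strict
    ℤ.∣ sumOver z P ℤ.- sumOver z M ∣             ≤⟨ ℤ.∣i-j∣≤∣i∣+∣j∣ (sumOver z P) (sumOver z M) ⟩
    ℤ.∣ sumOver z P ∣ + ℤ.∣ sumOver z M ∣         ≤⟨ +-mono-≤ (sumOver-bound A z z≤A P) (sumOver-bound A z z≤A M) ⟩
    p * A + q * A                                 ≡⟨ *-distribʳ-+ A p q ⟨
    (p + q) * A                                   ≤⟨ *-monoˡ-≤ A (≤-trans (≤-trans (m≤m+n (p + q) (lows ks)) (m≤m+n _ (highs ks))) (≤-reflexive length≡)) ⟩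
    suc (2 * r) * A                               <⟨ KA<β ⟩
    β                                             ∎
    where open ≤-Reasoning

  x≡0 : + mc ℤ.- + pc ≡ + 0
  x≡0 = small-multiple β _ (subst (λ x → ℤ.∣ x ∣ < β) (sym difference) small)

  counts≡ : mc ≡ pc
  counts≡ = ℤ.+-injective (ℤ.i-j≡0⇒i≡j (+ mc) (+ pc) x≡0)

  sums≡ : sumOver z P ≡ sumOver z M
  sums≡ = ℤ.i-j≡0⇒i≡j _ _ (trans (sym difference) (trans (cong (λ x → + β ℤ.* x) x≡0) (ℤ.*-zeroʳ (+ β))))

  empty : ∀ is → length is ≡ 0 → sumOver z is ≡ + 0
  empty [] _ = refl

  conclude : ∀ c d → c ≤ 1 → d ≤ 1 → p + q + c + d ≡ suc (2 * r) → q + c * (2 * r) ≡ p + d * (2 * r) → HasKSum (2 * r) z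
  -- With no extra item, or with both, `p` and `q` agree and the row has an even number of items,
  -- whereas `K` is odd. With exactly one, the count forces all other items to have the opposite
  -- sign: `low` goes with plus items only, `high` with minus items only.
  conclude 0 0 _ _ len eq = ⊥-elim (even≢odd p r (begin
    p + (p + 0)      ≡⟨ cong (λ a → p + a) (sym eq) ⟩
    p + (q + 0)      ≡⟨ +-assoc p q 0 ⟨
    p + q + 0        ≡⟨ +-identityʳ (p + q + 0) ⟨
    p + q + 0 + 0    ≡⟨ len ⟩
    suc (2 * r)      ∎))
    where open ≡-Reasoning
  conclude 1 1 _ _ len eq =
    ⊥-elim (even≢odd (suc p) r (trans (rearrange p) (trans
      (cong (λ a → p + a + 1 + 1) (sym (+-cancelʳ-≡ (1 * (2 * r)) q p eq))) len)))
    where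
    rearrange : ∀ p → 2 * suc p ≡ p + p + 1 + 1
    rearrange = solve-∀
  conclude 1 0 _ _ len eq = list⇒HasKSum z P (proj₁ pq) (Unique-pluses unique) (trans sums≡ (empty M (proj₂ pq)))
    where
    open ≡-Reasoning
    q+q≡0 : q + q ≡ 0
    q+q≡0 = +-cancelʳ-≡ (suc (2 * r)) (q + q) 0 (begin
      q + q + suc (2 * r)              ≡⟨ rearrange q (2 * r) ⟩
      suc (q + (q + 1 * (2 * r)))      ≡⟨ cong (λ a → suc (q + a)) eq ⟩
      suc (q + (p + 0))                ≡⟨ rearrange′ p q ⟩
      p + q + 1 + 0                    ≡⟨ len ⟩
      suc (2 * r)                      ∎)
      where
      rearrange : ∀ q s → q + q + suc s ≡ suc (q + (q + 1 * s))
      rearrange = solve-∀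
      rearrange′ : ∀ p q → suc (q + (p + 0)) ≡ p + q + 1 + 0
      rearrange′ = solve-∀
    pq : p ≡ 2 * r × q ≡ 0
    pq with q≡0 ← m+n≡0⇒m≡0 q q+q≡0 =
      trans (sym (+-identityʳ p)) (trans (sym eq) (trans (cong (_+ 1 * (2 * r)) q≡0) (+-identityʳ (2 * r)))) , q≡0
  conclude 0 1 _ _ len eq = list⇒HasKSum z M (proj₁ qp) (Unique-minuses unique) (trans (sym sums≡) (empty P (proj₂ qp)))
    where
    open ≡-Reasoning
    p+p≡0 : p + p ≡ 0
    p+p≡0 = +-cancelʳ-≡ (suc (2 * r)) (p + p) 0 (begin
      p + p + suc (2 * r)              ≡⟨ rearrange p (2 * r) ⟩
      suc (p + (p + 1 * (2 * r)))      ≡⟨ cong (λ a → suc (p + a)) (sym eq) ⟩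
      suc (p + (q + 0))                ≡⟨ rearrange′ p q ⟩
      p + q + 0 + 1                    ≡⟨ len ⟩
      suc (2 * r)                      ∎)
      where
      rearrange : ∀ q s → q + q + suc s ≡ suc (q + (q + 1 * s))
      rearrange = solve-∀
      rearrange′ : ∀ p q → suc (p + (q + 0)) ≡ p + q + 0 + 1
      rearrange′ = solve-∀
    qp : q ≡ 2 * r × p ≡ 0
    qp with p≡0 ← m+n≡0⇒m≡0 p p+p≡0 =
      trans (sym (+-identityʳ q)) (trans eq (trans (cong (_+ 1 * (2 * r)) p≡0) (+-identityʳ (2 * r)))) , p≡0
  conclude (suc (suc _)) _ (s≤s ())
  conclude _ (suc (suc _)) _ (s≤s ())

collect : ∀ {A : Set} {m} → (Fin m → Bool) → (Fin m → A) → List A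
collect {m = zero}  b f = []
collect {m = suc m} b f = if b zero then f zero ∷ rest else rest
  where rest = collect (λ i → b (suc i)) (λ i → f (suc i))

sum-collect : ∀ {A : Set} {m} (h : A → ℕ) (b : Fin m → Bool) (f : Fin m → A) →
              sum (map h (collect b f)) ≡ ∑ (λ i → bit (b i) * h (f i))
sum-collect {m = zero}  h b f = refl
sum-collect {m = suc m} h b f with b zero
... | true  = cong₂ _+_ (sym (+-identityʳ (h (f zero)))) (sum-collect h (λ i → b (suc i)) (λ i → f (suc i)))
... | false = sum-collect h (λ i → b (suc i)) (λ i → f (suc i))

length-collect : ∀ {A : Set} {m} (b : Fin m → Bool) (f : Fin m → A) →
                 length (collect b f) ≡ ∑ (λ i → bit (b i))
length-collect {m = zero}  b f = refl
length-collect {m = suc m} b f with b zero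
... | true  = cong suc (length-collect (λ i → b (suc i)) (λ i → f (suc i)))
... | false = length-collect (λ i → b (suc i)) (λ i → f (suc i))

All-collect : ∀ {A : Set} {P : A → Set} {m} (b : Fin m → Bool) (f : Fin m → A) → (∀ i → P (f i)) → All P (collect b f)
All-collect {m = zero}  b f p = []
All-collect {m = suc m} b f p with b zero
... | true  = p zero ∷ All-collect (λ i → b (suc i)) (λ i → f (suc i)) (λ i → p (suc i))
... | false = All-collect (λ i → b (suc i)) (λ i → f (suc i)) (λ i → p (suc i))

Unique-collect : ∀ {A : Set} {m} (b : Fin m → Bool) (f : Fin m → A) → (∀ i j → i ≢ j → f i ≢ f j) → Unique (collect b f)
Unique-collect {m = zero}  b f inj = []
Unique-collect {m = suc m} b f inj with b zero
... | true  = All-collect (λ i → b (suc i)) (λ i → f (suc i)) (λ i → inj zero (suc i) (λ ()))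
            ∷ Unique-collect (λ i → b (suc i)) (λ i → f (suc i)) (λ i j i≢j → inj (suc i) (suc j) (λ e → i≢j (Fin.suc-injective e)))
... | false = Unique-collect (λ i → b (suc i)) (λ i → f (suc i)) (λ i j i≢j → inj (suc i) (suc j) (λ e → i≢j (Fin.suc-injective e)))

-- From a packing to a balanced set of items

AllPairs-lookup : ∀ {A : Set} {R : A → A → Set} {xs : List A} → AllPairs R xs →
                  ∀ i j → i ≢ j → R (lookup xs i) (lookup xs j) ⊎ R (lookup xs j) (lookup xs i)
AllPairs-lookup (p ∷ ps) zero    zero    i≢j = ⊥-elim (i≢j refl)
AllPairs-lookup {xs = _ ∷ xs} (p ∷ ps) zero    (suc j) _ = inj₁ (All.lookup p (∈-lookup {xs = xs} j))
AllPairs-lookup {xs = _ ∷ xs} (p ∷ ps) (suc i) zero    _ = inj₂ (All.lookup p (∈-lookup {xs = xs} i))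
AllPairs-lookup (p ∷ ps) (suc i) (suc j) i≢j = AllPairs-lookup ps i j (λ e → i≢j (cong suc e))

0<if : ∀ b {a c} → 0 < a → 0 < c → 0 < (if b then a else c)
0<if true  0<a _   = 0<a
0<if false _   0<c = 0<c

module _ (I : Instance) (r Q g : ℕ) (σ : Fin (Instance.n I) → ℕ)
  (N≡ : Instance.N I ≡ 2 * suc (2 * r) * (Q + g)) (2K*g<Q : 2 * suc (2 * r) * g < Q)
  (w+g : ∀ i → Instance.width I i + g ≡ 2 * (Q + g) + σ i)
  (h+σ : ∀ i → Instance.height I i + σ i ≡ suc (2 * r) * (Q + g) + g)
  (σ≤2g : ∀ i → σ i ≤ 2 * g) (0<w : ∀ i → 0 < Instance.width I i) (0<h : ∀ i → 0 < Instance.height I i)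
  where

  open Instance I

  private
    K U : ℕ
    K = suc (2 * r)
    U = Q + g

  packing⇒balanced : ∀ v S → Feasible I v S → 2 * K ≤ length S →
    ∃ λ is → Unique is × length is ≡ K × sum (map σ is) ≡ K * g
  packing⇒balanced v S (_ , inside-all , apart-all) 2K≤ =
      collect chosen items
    , Unique-collect chosen items distinct
    , trans (length-collect chosen items) (proj₁ (proj₂ selection))
    , trans (sum-collect σ chosen items) (proj₂ (proj₂ selection))
    where
    -- Only the first `2 * K` placed items are considered: they still form a packing, and this
    -- number makes the grid count tight.
    placed : Fin (2 * K) → PlacedItem I
    placed t = lookup S (inject≤ t 2K≤)

    items : Fin (2 * K) → Fin n
    items t = item (placed t)

    ρ : Fin (2 * K) → Rect
    ρ t = rect I (placed t)

    pairs : ∀ t t′ → t ≢ t′ → items t ≢ items t′ × Disjoint (ρ t) (ρ t′)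
    pairs t t′ t≢t′ = Sum.[ id , flip ]′ (AllPairs-lookup apart-all (inject≤ t 2K≤) (inject≤ t′ 2K≤)
                                          (λ e → t≢t′ (Fin.inject≤-injective 2K≤ 2K≤ t t′ e)))
      where
      flip : items t′ ≢ items t × Disjoint (ρ t′) (ρ t) → items t ≢ items t′ × Disjoint (ρ t) (ρ t′)
      flip (item≢ , disjoint) = (λ e → item≢ (sym e)) , λ pt both → disjoint pt (proj₂ both , proj₁ both)

    distinct : ∀ t t′ → t ≢ t′ → items t ≢ items t′
    distinct t t′ t≢t′ = proj₁ (pairs t t′ t≢t′)

    0<sizeX : ∀ t → 0 < Rect.sizeX (ρ t)
    0<sizeX t = 0<if (rotated (placed t)) (0<h (items t)) (0<w (items t))

    0<sizeY : ∀ t → 0 < Rect.sizeY (ρ t)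
    0<sizeY t = 0<if (rotated (placed t)) (0<w (items t)) (0<h (items t))

    inside-t : ∀ t pt → pt ∈ᵒ ρ t → InKnapsack I pt
    inside-t t = All.lookup inside-all (∈-lookup {xs = S} (inject≤ t 2K≤))

    bX : ∀ t → 0ℚ ℚ.≤ Rect.left (ρ t) × Rect.left (ρ t) ℚ.+ ℕ→ℚ (Rect.sizeX (ρ t)) ℚ.≤ ℕ→ℚ N
    bX t = boundsX I (ρ t) (0<sizeX t) (0<sizeY t) (inside-t t)

    bY : ∀ t → 0ℚ ℚ.≤ Rect.bottom (ρ t) × Rect.bottom (ρ t) ℚ.+ ℕ→ℚ (Rect.sizeY (ρ t)) ℚ.≤ ℕ→ℚ N
    bY t = boundsY I (ρ t) (0<sizeX t) (0<sizeY t) (inside-t t)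

    fit : ∀ {l} a → 0ℚ ℚ.≤ l → l ℚ.+ ℕ→ℚ a ℚ.≤ ℕ→ℚ N → floorℕ l + a ≤ 2 * K * U
    fit a 0≤l l+a≤N = ≤-trans (floorℕ-+-≤ a 0≤l l+a≤N)
      (≤-reflexive (trans (floorℕ-ℕ→ℚ N) N≡))

    selection : ∃ λ (b : Fin (2 * K) → Bool) →
      ∑ (λ t → bit (b t)) ≡ K × ∑ (λ t → bit (b t) * σ (items t)) ≡ K * g
    selection = packing-row r Q g 2K*g<Q
      (λ t → width (items t)) (λ t → height (items t)) (λ t → σ (items t))
      (λ t → floorℕ (Rect.left (ρ t))) (λ t → floorℕ (Rect.bottom (ρ t)))
      (λ t → Rect.sizeX (ρ t)) (λ t → Rect.sizeY (ρ t))
      (λ t → rotated (placed t)) (λ _ → refl) (λ _ → refl)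
      (λ t → w+g (items t)) (λ t → h+σ (items t)) (λ t → σ≤2g (items t))
      (λ t → fit (Rect.sizeX (ρ t)) (proj₁ (bX t)) (proj₂ (bX t)))
      (λ t → fit (Rect.sizeY (ρ t)) (proj₁ (bY t)) (proj₂ (bY t)))
      (λ t t′ t≢t′ → disjoint⇒apart (ρ t) (ρ t′) (0<sizeX t) (0<sizeY t) (0<sizeX t′) (0<sizeY t′)
        (proj₁ (bX t)) (proj₁ (bY t)) (proj₁ (bX t′)) (proj₁ (bY t′)) (proj₂ (pairs t t′ t≢t′)))

    chosen : Fin (2 * K) → Bool
    chosen = proj₁ selection

-- The 2DK instance of a k-Sum instance

splitKind : ∀ {n} → Fin n × Fin 2 → Kind n
splitKind (i , zero)     = plus i
splitKind (i , suc zero) = minus i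

-- The order in the encoding: `low` and `high` first, then `plus i` and `minus i` side by side, so
-- that both are written when the `i`-th integer is read.
kind : ∀ {n} → Fin (2 + n * 2) → Kind n
kind zero          = low
kind (suc zero)    = high
kind {n} (suc (suc i)) = splitKind (remQuot {n} 2 i)

index : ∀ {n} → Kind n → Fin (2 + n * 2)
index low       = zero
index high      = suc zero
index (plus i)  = suc (suc (combine i (zero {1})))
index (minus i) = suc (suc (combine i (suc (zero {0}))))

kind-index : ∀ {n} (κ : Kind n) → kind (index κ) ≡ κ
kind-index low  = refl
kind-index high = refl
kind-index (plus i)  = cong splitKind (Fin.remQuot-combine i (zero {1}))
kind-index (minus i) = cong splitKind (Fin.remQuot-combine i (suc (zero {0})))

index-kind : ∀ {n} (i : Fin (2 + n * 2)) → index {n} (kind i) ≡ i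
index-kind zero = refl
index-kind (suc zero) = refl
index-kind {n} (suc (suc i)) = trans (lemma (remQuot {n} 2 i)) (cong (λ j → suc (suc j)) (Fin.combine-remQuot {n} 2 i))
  where
  lemma : ∀ ij → index (splitKind ij) ≡ suc (suc (uncurry combine ij))
  lemma (i , zero)     = refl
  lemma (i , suc zero) = refl

kind-injective : ∀ {n} {i j : Fin (2 + n * 2)} → kind {n} i ≡ kind j → i ≡ j
kind-injective {n} {i} {j} e = trans (sym (index-kind {n} i)) (trans (cong index e) (index-kind {n} j))

index-injective : ∀ {n} {κ κ′ : Kind n} → index κ ≡ index κ′ → κ ≡ κ′
index-injective {n} {κ} {κ′} e = trans (sym (kind-index κ)) (trans (cong kind e) (kind-index κ′))

-- An item of offset s = σ - g measures (2U + s) × (KU - s) in a knapsack of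
-- side 2KU, K = 2r + 1; s = β + aᵢ for `plus i`, -(β + aᵢ) for `minus i`, and -g, g
-- for `low`, `high`.
module Reduction {n : ℕ} (r β A : ℕ) (z : Fin n → ℤ)
  (0<r : 0 < r) (z≤A : ∀ i → ℤ.∣ z i ∣ ≤ A) (KA<β : suc (2 * r) * A < β) where

  private
    K : ℕ
    K = suc (2 * r)

  g Q U : ℕ
  g = 2 * r * β
  -- The least multiple of `g` that exceeds `2 * K * g`, as the grid argument demands.
  Q = suc (2 * K) * g
  U = Q + g

  shifted : Fin n → ℕ
  shifted i = ℤ.∣ + β ℤ.+ z i ∣

  σ w h : Kind n → ℕ
  σ = offset g shifted
  w low       = 2 * U ∸ g
  w high      = 2 * U + g
  w (plus i)  = 2 * U + shifted i
  w (minus i) = 2 * U ∸ shifted i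
  h low       = K * U + g
  h high      = K * U ∸ g
  h (plus i)  = K * U ∸ shifted i
  h (minus i) = K * U + shifted i

  A<β : A < β
  A<β = ≤-<-trans (m≤n*m A K) KA<β

  0<β : 0 < β
  0<β = ≤-<-trans z≤n A<β

  private instance
    nonZero-r : NonZero r
    nonZero-r = >-nonZero 0<r

  2β≤g : β + β ≤ g
  2β≤g = subst (_≤ g) (cong (λ a → β + a) (+-identityʳ β)) (*-monoˡ-≤ β (m≤m*n 2 r))

  shifted≡ : ∀ i → + shifted i ≡ + β ℤ.+ z i
  shifted≡ i = ℤ.0≤i⇒+∣i∣≡i (ℤ.≤-trans (ℤ.i≤j⇒0≤j-i -z≤β) (ℤ.≤-reflexive (cong (λ x → + β ℤ.+ x) (ℤ.neg-involutive (z i)))))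
    where
    -z≤β : ℤ.- z i ℤ.≤ + β
    -z≤β = ℤ.≤-trans (i≤∣i∣ (ℤ.- z i)) (ℤ.+≤+ (≤-trans (≤-reflexive (ℤ.∣-i∣≡∣i∣ (z i))) (≤-trans (z≤A i) (<⇒≤ A<β))))
      where
      i≤∣i∣ : ∀ i → i ℤ.≤ + ℤ.∣ i ∣
      i≤∣i∣ (+ _)    = ℤ.≤-refl
      i≤∣i∣ -[1+ _ ] = ℤ.-≤+

  shifted≤2β : ∀ i → shifted i ≤ β + β
  shifted≤2β i = ≤-trans (ℤ.∣i+j∣≤∣i∣+∣j∣ (+ β) (z i)) (+-monoʳ-≤ β (≤-trans (z≤A i) (<⇒≤ A<β)))

  shifted≤g : ∀ i → shifted i ≤ g
  shifted≤g i = ≤-trans (shifted≤2β i) 2β≤g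

  0<g : 0 < g
  0<g = <-≤-trans 0<β (≤-trans (m≤m+n β β) 2β≤g)

  g≤U : g ≤ U
  g≤U = m≤n+m g Q

  U≤KU : U ≤ K * U
  U≤KU = m≤n*m U K

  0<U : 0 < U
  0<U = <-≤-trans 0<g g≤U

  g≤2U : g ≤ 2 * U
  g≤2U = ≤-trans g≤U (m≤n*m U 2)

  g≤KU : g ≤ K * U
  g≤KU = ≤-trans g≤U U≤KU

  reduction : Instance
  reduction = record
    { N      = 2 * K * U
    ; 1≤N    = <-≤-trans 0<U (m≤n*m U (2 * K))
    ; n      = 2 + n * 2
    ; width  = λ i → w (kind i)
    ; height = λ i → h (kind i)
    ; profit = λ _ → 1
    }

  w+g : ∀ κ → w κ + g ≡ 2 * U + σ κ
  w+g low       = trans (m∸n+n≡m g≤2U) (sym (+-identityʳ (2 * U)))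
  w+g high      = +-assoc (2 * U) g g
  w+g (plus i)  = trans (+-assoc (2 * U) (shifted i) g) (cong (λ a → 2 * U + a) (+-comm (shifted i) g))
  w+g (minus i) = begin
    2 * U ∸ shifted i + g                            ≡⟨ cong (λ a → 2 * U ∸ shifted i + a) (m+[n∸m]≡n (shifted≤g i)) ⟨
    2 * U ∸ shifted i + (shifted i + (g ∸ shifted i)) ≡⟨ +-assoc (2 * U ∸ shifted i) _ _ ⟨
    2 * U ∸ shifted i + shifted i + (g ∸ shifted i)  ≡⟨ cong (_+ (g ∸ shifted i)) (m∸n+n≡m (≤-trans (shifted≤g i) g≤2U)) ⟩
    2 * U + (g ∸ shifted i)                          ∎
    where open ≡-Reasoning

  h+σ : ∀ κ → h κ + σ κ ≡ K * U + g
  h+σ low       = +-identityʳ (K * U + g)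
  h+σ high      = trans (sym (+-assoc (K * U ∸ g) g g)) (cong (_+ g) (m∸n+n≡m g≤KU))
  h+σ (plus i)  = begin
    K * U ∸ shifted i + (g + shifted i)  ≡⟨ cong (λ a → K * U ∸ shifted i + a) (+-comm g (shifted i)) ⟩
    K * U ∸ shifted i + (shifted i + g)  ≡⟨ +-assoc (K * U ∸ shifted i) _ _ ⟨
    K * U ∸ shifted i + shifted i + g    ≡⟨ cong (_+ g) (m∸n+n≡m (≤-trans (shifted≤g i) g≤KU)) ⟩
    K * U + g                            ∎
    where open ≡-Reasoning
  h+σ (minus i) = trans (+-assoc (K * U) (shifted i) _) (cong (λ a → K * U + a) (m+[n∸m]≡n (shifted≤g i)))

  σ≤2g : ∀ κ → σ κ ≤ 2 * g
  σ≤2g κ = subst (σ κ ≤_) (cong (λ a → g + a) (sym (+-identityʳ g))) (bound κ)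
    where
    bound : ∀ κ → σ κ ≤ g + g
    bound low       = z≤n
    bound high      = ≤-refl
    bound (plus i)  = +-monoʳ-≤ g (shifted≤g i)
    bound (minus i) = ≤-trans (m∸n≤m g (shifted i)) (m≤m+n g g)

  2U+g≤N : 2 * U + g ≤ 2 * K * U
  2U+g≤N = begin
    2 * U + g      ≤⟨ +-monoʳ-≤ (2 * U) g≤U ⟩
    2 * U + U      ≡⟨ +-comm (2 * U) U ⟩
    3 * U          ≤⟨ *-monoˡ-≤ U (≤-trans (s≤s (s≤s (s≤s z≤n))) (*-monoʳ-≤ 2 (s≤s (*-monoʳ-≤ 2 0<r)))) ⟩
    2 * K * U      ∎
    where open ≤-Reasoning

  KU+g≤N : K * U + g ≤ 2 * K * U
  KU+g≤N = begin
    K * U + g      ≤⟨ +-monoʳ-≤ (K * U) (≤-trans g≤U U≤KU) ⟩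
    K * U + K * U  ≡⟨ rearrange K U ⟩
    2 * K * U      ∎
    where
    open ≤-Reasoning
    rearrange : ∀ K U → K * U + K * U ≡ 2 * K * U
    rearrange = solve-∀

  2U≤N : 2 * U ≤ 2 * K * U
  2U≤N = ≤-trans (m≤m+n (2 * U) g) 2U+g≤N

  KU≤N : K * U ≤ 2 * K * U
  KU≤N = ≤-trans (m≤m+n (K * U) g) KU+g≤N

  g≤N : g ≤ 2 * K * U
  g≤N = ≤-trans g≤KU KU≤N

  2β≤N : β + β ≤ 2 * K * U
  2β≤N = ≤-trans 2β≤g g≤N

  β≤N : β ≤ 2 * K * U
  β≤N = ≤-trans (m≤m+n β β) 2β≤N

  h≤N : ∀ κ → h κ ≤ 2 * K * U
  h≤N κ = +-cancelʳ-≤ (σ κ) _ _ (begin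
    h κ + σ κ            ≡⟨ h+σ κ ⟩
    K * U + g            ≤⟨ KU+g≤N ⟩
    2 * K * U            ≤⟨ m≤m+n (2 * K * U) (σ κ) ⟩
    2 * K * U + σ κ      ∎)
    where open ≤-Reasoning

  w≤N : ∀ κ → w κ ≤ 2 * K * U
  w≤N κ = ≤-trans (+-cancelʳ-≤ g _ _ (begin
    w κ + g              ≡⟨ w+g κ ⟩
    2 * U + σ κ          ≤⟨ +-monoʳ-≤ (2 * U) (σ≤2g κ) ⟩
    2 * U + 2 * g        ≡⟨ rearrange (2 * U) g ⟩
    2 * U + g + g        ∎)) 2U+g≤N
    where
    open ≤-Reasoning
    rearrange : ∀ a g → a + 2 * g ≡ a + g + g
    rearrange = solve-∀

  0<w : ∀ κ → 0 < w κ
  0<w κ = <-≤-trans 0<U (+-cancelʳ-≤ g U (w κ) (begin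
    U + g        ≤⟨ +-monoʳ-≤ U (≤-trans g≤U (m≤m+n U 0)) ⟩
    2 * U        ≤⟨ m≤m+n (2 * U) (σ κ) ⟩
    2 * U + σ κ  ≡⟨ w+g κ ⟨
    w κ + g      ∎))
    where open ≤-Reasoning

  0<h : ∀ κ → 0 < h κ
  0<h κ = +-cancelʳ-< (2 * g) 0 (h κ) (begin-strict
    2 * g        ≡⟨ cong (λ a → g + a) (+-identityʳ g) ⟩
    g + g        <⟨ +-monoˡ-< g g<KU ⟩
    K * U + g    ≡⟨ h+σ κ ⟨
    h κ + σ κ    ≤⟨ +-monoʳ-≤ (h κ) (σ≤2g κ) ⟩
    h κ + 2 * g  ∎)
    where
    open ≤-Reasoning
    g<KU : g < K * U
    g<KU = <-≤-trans (m<n+m g (<-≤-trans 0<g (m≤n*m g (suc (2 * K))))) U≤KU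

  packing⇒HasKSum : ∀ v S → Feasible reduction v S → 2 * K ≤ length S → HasKSum (2 * r) z
  packing⇒HasKSum v S feasible 2K≤ = balanced⇒HasKSum
    (packing⇒balanced reduction r Q g (λ i → σ (kind i)) refl
      (*-monoˡ-< g {{>-nonZero 0<g}} (n<1+n (2 * K)))
      (λ i → w+g (kind i)) (λ i → h+σ (kind i)) (λ i → σ≤2g (kind i))
      (λ i → 0<w (kind i)) (λ i → 0<h (kind i)) v S feasible 2K≤)
    where
    balanced⇒HasKSum : (∃ λ is → Unique is × length is ≡ K × sum (map (λ i → σ (kind i)) is) ≡ K * g) →
                       HasKSum (2 * r) z
    balanced⇒HasKSum (is , unique , length≡ , sum≡) =
      kinds⇒HasKSum r β A z shifted shifted≡ shifted≤g z≤A KA<β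
        (map (kind {n}) is) (Unique.map⁺ (kind-injective {n}) unique)
        (trans (length-map (kind {n}) is) length≡)
        (trans (cong sum (sym (map-∘ is))) sum≡)

-- From a k-Sum solution to a packing

Unique-resp-↭ : ∀ {A : Set} {xs ys : List A} → xs ↭ ys → Unique xs → Unique ys
Unique-resp-↭ ↭.refl u = u
Unique-resp-↭ (↭.prep x p) (px ∷ u) = Perm.All-resp-↭ p px ∷ Unique-resp-↭ p u
Unique-resp-↭ (↭.swap x y p) ((x≢y ∷ px) ∷ py ∷ u) =
  ((λ e → x≢y (sym e)) ∷ Perm.All-resp-↭ p py) ∷ Perm.All-resp-↭ p px ∷ Unique-resp-↭ p u
Unique-resp-↭ (↭.trans p q) u = Unique-resp-↭ q (Unique-resp-↭ p u)

sumOver-tabulate : ∀ {n k} (z : Fin n → ℤ) (ι : Fin k → Fin n) → sumOver z (tabulate ι) ≡ sumℤ (λ j → z (ι j))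
sumOver-tabulate {k = zero}  z ι = refl
sumOver-tabulate {k = suc k} z ι = cong (λ s → z (ι zero) ℤ.+ s) (sumOver-tabulate z (λ j → ι (suc j)))

descending : ∀ {n} (f : Fin n → ℕ) is → ∃ λ js → js ↭ is × AllPairs (λ i j → f j ≤ f i) js
descending f is = sort is , sort-↭ is , Linked⇒AllPairs (λ p q → ≤-trans q p) (sort-↗ is)
  where
  open Data.List.Sort (Flip.decTotalOrder (On.decTotalOrder ≤-decTotalOrder f))

left-of⇒Disjoint : ∀ r r′ → Rect.left r ℚ.+ ℕ→ℚ (Rect.sizeX r) ℚ.≤ Rect.left r′ → Disjoint r r′
left-of⇒Disjoint r r′ le pt (((_ , u<) , _) , ((<u , _) , _)) = ℚ.<-irrefl refl (ℚ.<-≤-trans u< (ℚ.≤-trans le (ℚ.<⇒≤ <u)))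

below⇒Disjoint : ∀ r r′ → Rect.bottom r ℚ.+ ℕ→ℚ (Rect.sizeY r) ℚ.≤ Rect.bottom r′ → Disjoint r r′
below⇒Disjoint r r′ le pt ((_ , (_ , u<)) , (_ , (<u , _))) = ℚ.<-irrefl refl (ℚ.<-≤-trans u< (ℚ.≤-trans le (ℚ.<⇒≤ <u)))

ℕ→ℚ-+-≤ : ∀ {a b c} → a + b ≤ c → ℕ→ℚ a ℚ.+ ℕ→ℚ b ℚ.≤ ℕ→ℚ c
ℕ→ℚ-+-≤ {a} {b} {c} le = subst (ℚ._≤ ℕ→ℚ c) (ℕ→ℚ-+ a b) (ℕ→ℚ-mono-≤ le)

interval⇒bounds : ∀ {a b N u} → a + b ≤ N → ℕ→ℚ a ℚ.< u → u ℚ.< ℕ→ℚ a ℚ.+ ℕ→ℚ b → 0ℚ ℚ.≤ u × u ℚ.≤ ℕ→ℚ N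
interval⇒bounds {a} {b} a+b≤N a<u u<a+b =
  ℚ.≤-trans (ℕ→ℚ-nonNeg a) (ℚ.<⇒≤ a<u) , ℚ.≤-trans (ℚ.<⇒≤ u<a+b) (ℕ→ℚ-+-≤ {a} {b} a+b≤N)

-- The plus items, sorted by decreasing width and followed by `low`, stand on the
-- floor; below the ceiling hang the corresponding minus items and `high`.
module Packing {n : ℕ} (r β A : ℕ) (z : Fin n → ℤ)
  (0<r : 0 < r) (z≤A : ∀ i → ℤ.∣ z i ∣ ≤ A) (KA<β : suc (2 * r) * A < β) where

  open Reduction r β A z 0<r z≤A KA<β

  private
    I : Instance
    I = reduction

    K N : ℕ
    K = suc (2 * r)
    N = 2 * K * U

    place : Kind n → ℕ → ℕ → PlacedItem I
    place κ a b = record { item = index κ ; x = ℕ→ℚ a ; y = ℕ→ℚ b ; rotated = false }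

    stand hang : Kind n → ℕ → PlacedItem I
    stand κ a = place κ a 0
    hang  κ a = place κ a (N ∸ h κ)

    Compatible : PlacedItem I → PlacedItem I → Set
    Compatible p q = item p ≢ item q × Disjoint (rect I p) (rect I q)

    beside : ∀ κ a b κ′ a′ b′ → κ ≢ κ′ → a + w κ ≤ a′ → Compatible (place κ a b) (place κ′ a′ b′)
    beside κ a b κ′ a′ b′ κ≢κ′ le = (λ e → κ≢κ′ (index-injective e)) ,
      left-of⇒Disjoint (rect I (place κ a b)) (rect I (place κ′ a′ b′))
        (ℕ→ℚ-+-≤ {a} (subst (λ κ → a + w κ ≤ a′) (sym (kind-index κ)) le))

    below : ∀ κ a κ′ a′ → κ ≢ κ′ → h κ + h κ′ ≤ N → Compatible (stand κ a) (hang κ′ a′)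
    below κ a κ′ a′ κ≢κ′ le = (λ e → κ≢κ′ (index-injective e)) ,
      below⇒Disjoint (rect I (stand κ a)) (rect I (hang κ′ a′))
        (ℕ→ℚ-+-≤ {0} (subst (λ κ → h κ ≤ N ∸ h κ′) (sym (kind-index κ)) (m+n≤o⇒m≤o∸n (h κ) le)))

    Inside : PlacedItem I → Set
    Inside p = ∀ pt → pt ∈ᵒ rect I p → InKnapsack I pt

    inside-knapsack : ∀ κ a b → a + w κ ≤ N → b + h κ ≤ N → Inside (place κ a b)
    inside-knapsack κ a b a+w≤N b+h≤N (u , v) ((a<u , u<) , (b<v , v<)) =
      interval⇒bounds {a} {w (kind {n} (index κ))} (subst (λ κ → a + w κ ≤ N) (sym (kind-index κ)) a+w≤N) a<u u< ,
      interval⇒bounds {b} {h (kind {n} (index κ))} (subst (λ κ → b + h κ ≤ N) (sym (kind-index κ)) b+h≤N) b<v v<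

    -- `a` and `b` are the abscissas reached on the floor and below the ceiling. They drift apart,
    -- with `b ≤ a`, because `plus i` is at least as wide as `minus i`.
    columns : ℕ → ℕ → List (Fin n) → Solution I
    columns a b []       = stand low a ∷ hang high b ∷ []
    columns a b (i ∷ is) = stand (plus i) a ∷ hang (minus i) b ∷ columns (a + w (plus i)) (b + w (minus i)) is

    length-columns : ∀ a b is → length (columns a b is) ≡ 2 * suc (length is)
    length-columns a b []       = refl
    length-columns a b (i ∷ is) = trans (cong (λ l → suc (suc l)) (length-columns _ _ is)) (rearrange (length is))
      where
      rearrange : ∀ l → suc (suc (2 * suc l)) ≡ 2 * suc (suc l)
      rearrange = solve-∀

    data Floor (is : List (Fin n)) : Kind n → Set where
      low  : Floor is low
      plus : ∀ {i} → i ∈ is → Floor is (plus i)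

    data Ceiling (is : List (Fin n)) : Kind n → Set where
      high  : Ceiling is high
      minus : ∀ {i} → i ∈ is → Ceiling is (minus i)

    -- What a new item has to know about the pieces after it: how far left they can start and which
    -- integers they come from, not their exact positions.
    data Piece (a b : ℕ) (is : List (Fin n)) : PlacedItem I → Set where
      floor   : ∀ {κ a′} → Floor is κ → a ≤ a′ → a′ + w κ ≤ N → Piece a b is (stand κ a′)
      ceiling : ∀ {κ b′} → Ceiling is κ → b ≤ b′ → b′ + w κ ≤ N → Piece a b is (hang κ b′)

    Floor-∷ : ∀ {i is κ} → Floor is κ → Floor (i ∷ is) κ
    Floor-∷ low      = low
    Floor-∷ (plus j) = plus (there j)

    Ceiling-∷ : ∀ {i is κ} → Ceiling is κ → Ceiling (i ∷ is) κ
    Ceiling-∷ high      = high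
    Ceiling-∷ (minus j) = minus (there j)

    Piece-∷ : ∀ {a b a′ b′ i is p} → a ≤ a′ → b ≤ b′ → Piece a′ b′ is p → Piece a b (i ∷ is) p
    Piece-∷ a≤ b≤ (floor κ le fit)   = floor (Floor-∷ κ) (≤-trans a≤ le) fit
    Piece-∷ a≤ b≤ (ceiling κ le fit) = ceiling (Ceiling-∷ κ) (≤-trans b≤ le) fit

    floorWidth ceilingWidth : List (Fin n) → ℕ
    floorWidth   []       = w low
    floorWidth   (i ∷ is) = w (plus i) + floorWidth is
    ceilingWidth []       = w high
    ceilingWidth (i ∷ is) = w (minus i) + ceilingWidth is

    pieces : ∀ a b is → a + floorWidth is ≤ N → b + ceilingWidth is ≤ N → All (Piece a b is) (columns a b is)
    pieces a b [] fa fb = floor low ≤-refl fa ∷ ceiling high ≤-refl fb ∷ []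
    pieces a b (i ∷ is) fa fb =
        floor (plus (here refl)) ≤-refl (≤-trans (m≤m+n (a + w (plus i)) _) fa′)
      ∷ ceiling (minus (here refl)) ≤-refl (≤-trans (m≤m+n (b + w (minus i)) _) fb′)
      ∷ All.map (Piece-∷ (m≤m+n a _) (m≤m+n b _)) (pieces _ _ is fa′ fb′)
      where
      fa′ : a + w (plus i) + floorWidth is ≤ N
      fa′ = subst (_≤ N) (sym (+-assoc a (w (plus i)) (floorWidth is))) fa
      fb′ : b + w (minus i) + ceilingWidth is ≤ N
      fb′ = subst (_≤ N) (sym (+-assoc b (w (minus i)) (ceilingWidth is))) fb

    -- As `h κ + σ κ` is the constant `K * U + g`, stacking two items is a condition on their
    -- offsets alone.
    h-sum : ∀ κ κ′ → 2 * g ≤ σ κ + σ κ′ → h κ + h κ′ ≤ N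
    h-sum κ κ′ le = +-cancelʳ-≤ (2 * g) _ _ (begin
      h κ + h κ′ + 2 * g            ≤⟨ +-monoʳ-≤ (h κ + h κ′) le ⟩
      h κ + h κ′ + (σ κ + σ κ′)     ≡⟨ rearrange (h κ) (h κ′) (σ κ) (σ κ′) ⟩
      (h κ + σ κ) + (h κ′ + σ κ′)   ≡⟨ cong₂ _+_ (h+σ κ) (h+σ κ′) ⟩
      (K * U + g) + (K * U + g)     ≡⟨ rearrange′ K U g ⟩
      2 * K * U + 2 * g             ∎)
      where
      open ≤-Reasoning
      rearrange : ∀ a b c d → a + b + (c + d) ≡ (a + c) + (b + d)
      rearrange = solve-∀
      rearrange′ : ∀ K U g → (K * U + g) + (K * U + g) ≡ 2 * K * U + 2 * g
      rearrange′ = solve-∀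

    2g≡ : 2 * g ≡ g + g
    2g≡ = cong (λ a → g + a) (+-identityʳ g)

    σ-plus-minus : ∀ i j → shifted j ≤ shifted i → 2 * g ≤ σ (plus i) + σ (minus j)
    σ-plus-minus i j le = begin
      2 * g                                    ≡⟨ 2g≡ ⟩
      g + g                                    ≡⟨ cong (λ a → g + a) (m+[n∸m]≡n (shifted≤g j)) ⟨
      g + (shifted j + (g ∸ shifted j))        ≤⟨ +-monoʳ-≤ g (+-monoˡ-≤ _ le) ⟩
      g + (shifted i + (g ∸ shifted j))        ≡⟨ +-assoc g _ _ ⟨
      g + shifted i + (g ∸ shifted j)          ∎
      where open ≤-Reasoning

    σ-plus-high : ∀ i → 2 * g ≤ σ (plus i) + σ high
    σ-plus-high i = ≤-trans (≤-reflexive 2g≡) (m≤n+m (g + g) (g + shifted i))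

    b+w≤a+w : ∀ {a b} i → b ≤ a → b + w (minus i) ≤ a + w (plus i)
    b+w≤a+w i b≤a = +-mono-≤ b≤a (≤-trans (m∸n≤m (2 * U) (shifted i)) (m≤m+n (2 * U) (shifted i)))

    -- The ceiling lags behind the floor, so later minus items may hang over `plus i`. The
    -- decreasing order makes this harmless: such a `minus j` has `shifted j ≤ shifted i`, hence the
    -- two heights add up to at most `N`.
    plus-clear : ∀ a b i {is p} → All (i ≢_) is → All (λ j → shifted j ≤ shifted i) is →
                 Piece (a + w (plus i)) b is p → Compatible (stand (plus i) a) p
    plus-clear a b i i∉ sorted (floor {κ} {a′} κ∈ le _) = beside (plus i) a 0 κ a′ 0 (distinct κ∈) le
      where
      distinct : ∀ {κ} → Floor _ κ → plus i ≢ κ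
      distinct (plus j) refl = All.lookup i∉ j refl
    plus-clear a b i i∉ sorted (ceiling {κ} {b′} κ∈ _ _) = below (plus i) a κ b′ (distinct κ∈) (h-sum (plus i) κ (room κ∈))
      where
      distinct : ∀ {κ} → Ceiling _ κ → plus i ≢ κ
      distinct (minus j) ()
      room : ∀ {κ} → Ceiling _ κ → 2 * g ≤ σ (plus i) + σ κ
      room high           = σ-plus-high i
      room (minus {j} j∈) = σ-plus-minus i j (All.lookup sorted j∈)

    -- Against later plus items, which may be too high to stand below `minus i`, the heights do not
    -- help. But since the ceiling lags behind, `minus i` ends before any of them begins.
    minus-clear : ∀ a b i {is p} → b + w (minus i) ≤ a → All (i ≢_) is →
                  Piece a (b + w (minus i)) is p → Compatible (hang (minus i) b) p
    minus-clear a b i le i∉ (floor {κ} {a′} κ∈ le′ _) =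
      beside (minus i) b (N ∸ h (minus i)) κ a′ 0 (distinct κ∈) (≤-trans le le′)
      where
      distinct : ∀ {κ} → Floor _ κ → minus i ≢ κ
      distinct (plus j) ()
    minus-clear a b i le i∉ (ceiling {κ} {b′} κ∈ le′ _) =
      beside (minus i) b (N ∸ h (minus i)) κ b′ (N ∸ h κ) (distinct κ∈) le′
      where
      distinct : ∀ {κ} → Ceiling _ κ → minus i ≢ κ
      distinct (minus j) refl = All.lookup i∉ j refl

    compatible : ∀ a b is → b ≤ a → Unique is → AllPairs (λ i j → shifted j ≤ shifted i) is →
                 a + floorWidth is ≤ N → b + ceilingWidth is ≤ N → AllPairs Compatible (columns a b is)
    compatible a b [] _ _ _ _ _ =
      (below low a high b (λ ()) (h-sum low high (≤-reflexive 2g≡)) ∷ []) ∷ [] ∷ []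
    compatible a b (i ∷ is) b≤a (i∉ ∷ unique) (i≥ ∷ sorted) fa fb =
        (below (plus i) a (minus i) b (λ ()) (h-sum (plus i) (minus i) (σ-plus-minus i i ≤-refl)) ∷ All.map (plus-clear a _ i i∉ i≥) rest)
      ∷ All.map (minus-clear _ b i (b+w≤a+w i b≤a) i∉) rest
      ∷ compatible (a + w (plus i)) (b + w (minus i)) is (b+w≤a+w i b≤a) unique sorted fa′ fb′
      where
      fa′ : a + w (plus i) + floorWidth is ≤ N
      fa′ = subst (_≤ N) (sym (+-assoc a (w (plus i)) (floorWidth is))) fa
      fb′ : b + w (minus i) + ceilingWidth is ≤ N
      fb′ = subst (_≤ N) (sym (+-assoc b (w (minus i)) (ceilingWidth is))) fb
      rest = pieces (a + w (plus i)) (b + w (minus i)) is fa′ fb′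

    piece-inside : ∀ {a b is p} → Piece a b is p → Inside p
    piece-inside (floor {κ} {a′} _ _ fit)   = inside-knapsack κ a′ 0 fit (h≤N κ)
    piece-inside (ceiling {κ} {b′} _ _ fit) = inside-knapsack κ b′ (N ∸ h κ) fit (≤-reflexive (m∸n+n≡m (h≤N κ)))

    piece-rotation : ∀ v {a b is p} → Piece a b is p → RotationAllowed I v p
    piece-rotation 2DK  (floor _ _ _)   = refl
    piece-rotation 2DK  (ceiling _ _ _) = refl
    piece-rotation 2DKR _               = tt

    floorWidth≡ : ∀ is → floorWidth is + g ≡ suc (length is) * (2 * U) + sum (map shifted is)
    floorWidth≡ []       = trans (m∸n+n≡m g≤2U) (rearrange U)
      where
      rearrange : ∀ U → 2 * U ≡ 1 * (2 * U) + 0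
      rearrange = solve-∀
    floorWidth≡ (i ∷ is) = trans (+-assoc (w (plus i)) _ g) (trans (cong (λ a → w (plus i) + a) (floorWidth≡ is))
      (rearrange (2 * U) (shifted i) (length is) (sum (map shifted is))))
      where
      rearrange : ∀ u s l t → u + s + (suc l * u + t) ≡ suc (suc l) * u + (s + t)
      rearrange = solve-∀

    ceilingWidth≡ : ∀ is → ceilingWidth is + sum (map shifted is) ≡ suc (length is) * (2 * U) + g
    ceilingWidth≡ []       = rearrange U g
      where
      rearrange : ∀ U g → 2 * U + g + 0 ≡ 1 * (2 * U) + g
      rearrange = solve-∀
    ceilingWidth≡ (i ∷ is) = begin
      w (minus i) + ceilingWidth is + (shifted i + sum (map shifted is))    ≡⟨ rearrange (w (minus i)) (ceilingWidth is) (shifted i) (sum (map shifted is)) ⟩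
      (w (minus i) + shifted i) + (ceilingWidth is + sum (map shifted is))  ≡⟨ cong₂ _+_ (m∸n+n≡m (≤-trans (shifted≤g i) g≤2U)) (ceilingWidth≡ is) ⟩
      2 * U + (suc (length is) * (2 * U) + g)                               ≡⟨ +-assoc (2 * U) _ g ⟨
      suc (suc (length is)) * (2 * U) + g                                   ∎
      where
      open ≡-Reasoning
      rearrange : ∀ a b c d → a + b + (c + d) ≡ (a + c) + (b + d)
      rearrange = solve-∀

    sum-shifted : ∀ is → + sum (map shifted is) ≡ + (length is * β) ℤ.+ sumOver z is
    sum-shifted []       = refl
    sum-shifted (i ∷ is) = begin
      + (shifted i + sum (map shifted is))                      ≡⟨ ℤ.pos-+ (shifted i) _ ⟩
      + shifted i ℤ.+ + sum (map shifted is)                    ≡⟨ cong₂ ℤ._+_ (shifted≡ i) (sum-shifted is) ⟩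
      + β ℤ.+ z i ℤ.+ (+ (length is * β) ℤ.+ sumOver z is)      ≡⟨ rearrange (+ β) (z i) (+ (length is * β)) (sumOver z is) ⟩
      + β ℤ.+ + (length is * β) ℤ.+ (z i ℤ.+ sumOver z is)      ≡⟨ cong (λ a → a ℤ.+ (z i ℤ.+ sumOver z is)) (ℤ.pos-+ β (length is * β)) ⟨
      + (β + length is * β) ℤ.+ (z i ℤ.+ sumOver z is)          ∎
      where
      open ≡-Reasoning
      rearrange : ∀ β z l s → β ℤ.+ z ℤ.+ (l ℤ.+ s) ≡ β ℤ.+ l ℤ.+ (z ℤ.+ s)
      rearrange = ℤ.solve-∀

  HasKSum⇒packing : ∀ v → HasKSum (2 * r) z → ∃ λ S → Feasible I v S × length S ≡ 2 * K
  HasKSum⇒packing v (ι , ι-injective , sum≡0) = packed (descending shifted (tabulate ι))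
    where
    packed : (∃ λ is → is ↭ tabulate ι × AllPairs (λ i j → shifted j ≤ shifted i) is) →
             ∃ λ S → Feasible I v S × length S ≡ 2 * K
    packed (is , is↭ , sorted) = columns 0 0 is ,
      ( All.map (piece-rotation v) (pieces 0 0 is floorFit ceilingFit)
      , All.map piece-inside (pieces 0 0 is floorFit ceilingFit)
      , compatible 0 0 is z≤n (Unique-resp-↭ (↭-sym is↭) (Unique.tabulate⁺ ι-injective)) sorted floorFit ceilingFit ) ,
      trans (length-columns 0 0 is) (cong (λ l → 2 * suc l) length≡)
      where
      length≡ : length is ≡ 2 * r
      length≡ = trans (Perm.↭-length is↭) (length-tabulate ι)

      -- The vanishing sum enters here: the shifted integers add up to `k * β = g`, by which `low`
      -- is narrower and `high` wider than `2 * U`. So floor and ceiling are both filled exactly.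
      sum≡g : sum (map shifted is) ≡ g
      sum≡g = trans (sum-↭ (Perm.map⁺ shifted is↭)) (ℤ.+-injective (begin
        + sum (map shifted (tabulate ι))                                ≡⟨ sum-shifted (tabulate ι) ⟩
        + (length (tabulate ι) * β) ℤ.+ sumOver z (tabulate ι)          ≡⟨ cong₂ (λ l s → + (l * β) ℤ.+ s) (length-tabulate ι) (trans (sumOver-tabulate z ι) sum≡0) ⟩
        + g ℤ.+ + 0                                                     ≡⟨ ℤ.+-identityʳ (+ g) ⟩
        + g                                                             ∎))
        where open ≡-Reasoning

      K2U≡N : suc (length is) * (2 * U) ≡ N
      K2U≡N = trans (cong (λ l → suc l * (2 * U)) length≡) (rearrange K U)
        where
        rearrange : ∀ K U → K * (2 * U) ≡ 2 * K * U
        rearrange = solve-∀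

      floorFit : floorWidth is ≤ N
      floorFit = ≤-reflexive (+-cancelʳ-≡ g _ _ (trans (floorWidth≡ is) (cong₂ _+_ K2U≡N sum≡g)))

      ceilingFit : ceilingWidth is ≤ N
      ceilingFit = ≤-reflexive (+-cancelʳ-≡ g _ _
        (trans (cong (λ a → ceilingWidth is + a) (sym sum≡g)) (trans (ceilingWidth≡ is) (cong (λ a → a + g) K2U≡N))))

-- Approximation, word size and running time

-- Built with `mkℚ`, so that the numerator 1 and the denominator compute and the encoding of ε
-- starts with two literal numbers.
reciprocal : ℕ → ℚ
reciprocal e-1 = mkℚ (+ 1) e-1 (1-coprimeTo (suc e-1))

÷-≤⇒≤-* : ∀ p q s .{{_ : ℚ.NonZero q}} → 0ℚ ℚ.≤ q → (p ℚ.÷ q) ℚ.≤ s → p ℚ.≤ s ℚ.* q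
÷-≤⇒≤-* p q s 0≤q p÷q≤s = subst (ℚ._≤ s ℚ.* q)
  (trans (ℚ.*-assoc p (ℚ.1/ q) q) (trans (cong (λ x → p ℚ.* x) (ℚ.*-inverseˡ q)) (ℚ.*-identityʳ p)))
  (ℚ.*-monoʳ-≤-nonNeg q {{ℚ.nonNegative 0≤q}} p÷q≤s)

toℚᵘ-ℕ→ℚ : ∀ a → toℚᵘ (ℕ→ℚ a) ≡ ℚᵘ.mkℚᵘ (+ a) 0
toℚᵘ-ℕ→ℚ a = cong toℚᵘ (ℕ→ℚ≡mkℚ a)

approximate-count : ∀ o s e-1 → ℕ→ℚ o ℚ.≤ ℕ→ℚ s ℚ.* (1ℚ ℚ.+ reciprocal e-1) → o * suc e-1 ≤ s * suc (suc e-1)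
approximate-count o s e-1 le = ℤ.drop‿+≤+ (subst₂ ℤ._≤_ left right (ℚᵘ.drop-*≤* unnormalised))
  where
  e = suc e-1
  unnormalised : ℚᵘ.mkℚᵘ (+ o) 0 ℚᵘ.≤ ℚᵘ.mkℚᵘ (+ s) 0 ℚᵘ.* (ℚᵘ.mkℚᵘ (+ 1) 0 ℚᵘ.+ ℚᵘ.mkℚᵘ (+ 1) e-1)
  unnormalised = begin
    ℚᵘ.mkℚᵘ (+ o) 0                                             ≡⟨ toℚᵘ-ℕ→ℚ o ⟨
    toℚᵘ (ℕ→ℚ o)                                                ≤⟨ ℚ.toℚᵘ-mono-≤ le ⟩
    toℚᵘ (ℕ→ℚ s ℚ.* (1ℚ ℚ.+ reciprocal e-1))                    ≃⟨ ℚ.toℚᵘ-homo-* (ℕ→ℚ s) (1ℚ ℚ.+ reciprocal e-1) ⟩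
    toℚᵘ (ℕ→ℚ s) ℚᵘ.* toℚᵘ (1ℚ ℚ.+ reciprocal e-1)              ≃⟨ ℚᵘ.*-congˡ {toℚᵘ (ℕ→ℚ s)} (ℚ.toℚᵘ-homo-+ 1ℚ (reciprocal e-1)) ⟩
    toℚᵘ (ℕ→ℚ s) ℚᵘ.* (ℚᵘ.mkℚᵘ (+ 1) 0 ℚᵘ.+ ℚᵘ.mkℚᵘ (+ 1) e-1)  ≡⟨ cong (ℚᵘ._* (ℚᵘ.mkℚᵘ (+ 1) 0 ℚᵘ.+ ℚᵘ.mkℚᵘ (+ 1) e-1)) (toℚᵘ-ℕ→ℚ s) ⟩
    ℚᵘ.mkℚᵘ (+ s) 0 ℚᵘ.* (ℚᵘ.mkℚᵘ (+ 1) 0 ℚᵘ.+ ℚᵘ.mkℚᵘ (+ 1) e-1) ∎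
    where open ℚᵘ.≤-Reasoning
  left : + o ℤ.* + (1 * (1 * e)) ≡ + (o * e)
  left = trans (sym (ℤ.pos-* o (1 * (1 * e)))) (cong (λ a → + (o * a)) (trans (*-identityˡ (1 * e)) (*-identityˡ e)))
  right : (+ s ℤ.* (+ 1 ℤ.* + e ℤ.+ + 1 ℤ.* + 1)) ℤ.* + 1 ≡ + (s * suc e)
  right = trans (ℤ.*-identityʳ _) (trans (cong (λ a → + s ℤ.* (a ℤ.+ + 1)) (ℤ.*-identityˡ (+ e)))
    (trans (sym (ℤ.pos-* s (e + 1))) (cong (λ a → + (s * a)) (+-comm e 1))))

-- For `s < B ≤ e` the factor `1 + 1/e` adds less than one item: `s + s/e < s + 1 ≤ B ≤ o`.
approximation-gap : ∀ {B o s e} → B ≤ e → B ≤ o → o * e ≤ s * suc e → B ≤ s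
approximation-gap {B} {o} {s} {e} B≤e B≤o le = ≮⇒≥ λ s<B → <-irrefl refl (begin-strict
  s * e + s        <⟨ +-monoʳ-< (s * e) (<-≤-trans s<B B≤e) ⟩
  s * e + e        ≡⟨ +-comm (s * e) e ⟩
  suc s * e        ≤⟨ *-monoˡ-≤ e (≤-trans s<B B≤o) ⟩
  o * e            ≤⟨ le ⟩
  s * suc e        ≡⟨ *-suc s e ⟩
  s + s * e        ≡⟨ +-comm s (s * e) ⟩
  s * e + s        ∎)
  where open ≤-Reasoning

module _ (I : Instance) (cardinality : Cardinality I) where

  totalProfit≡length : ∀ S → totalProfit I S ≡ length S
  totalProfit≡length []      = refl
  totalProfit≡length (a ∷ S) = cong₂ _+_ (cardinality (item a)) (totalProfit≡length S)

  approximate⇒≤length : ∀ v e-1 {B} S S′ → B ≤ suc e-1 → Feasible I v S′ → length S′ ≡ B →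
    Approximate I v (reciprocal e-1) S → B ≤ length S
  approximate⇒≤length v e-1 {B} S S′ B≤e feasible length≡ (_ , OPT , (_ , optimal) , le) =
    approximation-gap {o = totalProfit I OPT} {length S} B≤e
      (subst (_≤ totalProfit I OPT) (trans (totalProfit≡length S′) length≡) (optimal S′ feasible))
      (subst (λ s → totalProfit I OPT * suc e-1 ≤ s * suc (suc e-1)) (totalProfit≡length S)
        (approximate-count (totalProfit I OPT) (totalProfit I S) e-1
          (÷-≤⇒≤-* (ℕ→ℚ (totalProfit I OPT)) (1ℚ ℚ.+ reciprocal e-1) (ℕ→ℚ (totalProfit I S))
            {{ℚ.pos⇒nonZero (1ℚ ℚ.+ reciprocal e-1) {{ℚ.pos+pos⇒pos 1ℚ (reciprocal e-1)}}}}
            (ℚ.<⇒≤ (ℚ.positive⁻¹ (1ℚ ℚ.+ reciprocal e-1) {{ℚ.pos+pos⇒pos 1ℚ (reciprocal e-1)}})) le)))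

cell≤max : ∀ xs a → cell xs a ≤ foldr _⊔_ 0 xs
cell≤max []       a       = z≤n
cell≤max (x ∷ xs) zero    = m≤m⊔n x _
cell≤max (x ∷ xs) (suc a) = ≤-trans (cell≤max xs a) (m≤n⊔m x _)

max-++ : ∀ xs ys {M} → foldr _⊔_ 0 xs ≤ M → foldr _⊔_ 0 ys ≤ M → foldr _⊔_ 0 (xs ++ ys) ≤ M
max-++ []       ys _   le′ = le′
max-++ (x ∷ xs) ys le le′ = ⊔-lub (≤-trans (m≤m⊔n x _) le) (max-++ xs ys (≤-trans (m≤n⊔m x _) le) le′)

max-concatMap : ∀ {A : Set} {M} (f : A → List ℕ) → (∀ x → foldr _⊔_ 0 (f x) ≤ M) → ∀ xs → foldr _⊔_ 0 (concatMap f xs) ≤ M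
max-concatMap f le []       = z≤n
max-concatMap f le (x ∷ xs) = max-++ (f x) _ (le x) (max-concatMap f le xs)

m<2^m : ∀ m → m < 2 ^ m
m<2^m zero    = s≤s z≤n
m<2^m (suc m) = begin
  suc (suc m)      ≤⟨ s≤s (m<2^m m) ⟩
  suc (2 ^ m)      ≤⟨ +-monoˡ-≤ (2 ^ m) (m^n>0 2 m) ⟩
  2 ^ m + 2 ^ m    ≡⟨ cong (λ a → 2 ^ m + a) (+-identityʳ (2 ^ m)) ⟨
  2 ^ suc m        ∎
  where open ≤-Reasoning

-- Rounding w down to a multiple of E costs a factor 2, absorbed together with D
-- by D + 1 surplus factors b ≥ 2.
≤2^[w/E] : ∀ b D E w → 2 ≤ b → b ^ (suc (suc D) * suc E) ≤ 2 ^ w → D * b ≤ 2 ^ (w ℕ./ suc E)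
≤2^[w/E] b D E w 2≤b le = ≤-trans (begin
  D * b            ≤⟨ *-monoˡ-≤ b (<⇒≤ (m<2^m D)) ⟩
  2 ^ D * b        ≤⟨ *-monoˡ-≤ b (^-monoˡ-≤ D 2≤b) ⟩
  b ^ D * b        ≡⟨ *-comm (b ^ D) b ⟩
  b ^ suc D        ∎) (<⇒≤ (*-cancelˡ-< 2 _ _ (≤-<-trans (*-monoˡ-≤ (b ^ suc D) 2≤b) below)))
  where
  open ≤-Reasoning
  q = w ℕ./ suc E
  below : b ^ suc (suc D) < 2 ^ suc q
  below = ≰⇒> λ above → <-irrefl refl (begin-strict
    2 ^ w                        <⟨ ^-monoʳ-< 2 ≤-refl (subst (_< suc q * suc E) (sym (m≡m%n+[m/n]*n w (suc E))) (+-monoˡ-< (q * suc E) (m%n<n w (suc E)))) ⟩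
    2 ^ (suc q * suc E)          ≡⟨ ^-*-assoc 2 (suc q) (suc E) ⟨
    (2 ^ suc q) ^ suc E          ≤⟨ ^-monoˡ-≤ (suc E) above ⟩
    (b ^ suc (suc D)) ^ suc E    ≡⟨ ^-*-assoc b (suc (suc D)) (suc E) ⟩
    b ^ (suc (suc D) * suc E)    ≤⟨ le ⟩
    2 ^ w                        ∎)

2^[w/E]^E≤ : ∀ E w → (2 ^ (w ℕ./ suc E)) ^ suc E ≤ 2 ^ w
2^[w/E]^E≤ E w = ≤-trans (≤-reflexive (^-*-assoc 2 (w ℕ./ suc E) (suc E))) (^-monoʳ-≤ 2 (m/n*n≤m w (suc E)))

always⇒WithHighProbability : ∀ n w t (E : Tape w t → Bool) → (∀ ω → E ω ≡ true) → WithHighProbability n w t E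
always⇒WithHighProbability n w t E always = *-mono-≤ (m∸n≤m n 1) (≤-reflexive (cong length (sym
  (filter-all (T? ∘ E) (All.universal (λ ω → subst T (sym (always ω)) _) (tapes w t))))))

-- `m + 8 * suc m` is `9 * suc m` minus one, the form in which `mkℚ` stores a denominator.
ninth÷reciprocal : ∀ m → (+ 1 ℚ./ 9) ℚ.÷ reciprocal (m + 8 * suc m) ≡ ℕ→ℚ (suc m)
ninth÷reciprocal m = ℚ.fromℚᵘ-cong {ℚᵘ.mkℚᵘ (+ 1 ℤ.* + suc (m + 8 * suc m)) 8} {ℚᵘ.mkℚᵘ (+ suc m) 0}
  (ℚᵘ.*≡* (trans (ℤ.*-identityʳ _) (trans (ℤ.*-identityˡ _) (trans (cong +_ (*-comm 9 (suc m))) (ℤ.pos-* (suc m) 9)))))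

exponent : ∀ m → (+ ⌈ 2 * suc m /2⌉ ℚ./ 1) ℚ.- 1ℚ ≡ ℕ→ℚ m
exponent m = begin
  ℕ→ℚ ⌈ 2 * suc m /2⌉ ℚ.- 1ℚ        ≡⟨ cong (λ a → ℕ→ℚ a ℚ.- 1ℚ) half ⟩
  ℕ→ℚ (m + 1) ℚ.- 1ℚ                ≡⟨ cong (ℚ._- 1ℚ) (ℕ→ℚ-+ m 1) ⟩
  ℕ→ℚ m ℚ.+ 1ℚ ℚ.- 1ℚ               ≡⟨ ℚ.+-assoc (ℕ→ℚ m) 1ℚ (ℚ.- 1ℚ) ⟩
  ℕ→ℚ m ℚ.+ 0ℚ                      ≡⟨ ℚ.+-identityʳ (ℕ→ℚ m) ⟩
  ℕ→ℚ m                             ∎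
  where
  open ≡-Reasoning
  half : ⌈ 2 * suc m /2⌉ ≡ m + 1
  half = trans (cong ⌈_/2⌉ (cong (λ a → suc m + a) (+-identityʳ (suc m)))) (trans (sym (n≡⌈n+n/2⌉ (suc m))) (+-comm 1 m))

TimeBound⇒≤ : ∀ {T C n} m → TimeBound T C n (ℕ→ℚ m) → T ≤ C * n ^ m
TimeBound⇒≤ {T} {C} {n} m bound = subst₂ (λ a b → a ≤ b * n ^ m) (*-identityʳ T) (*-identityʳ C)
  (subst (TimeBound T C n) (ℕ→ℚ≡mkℚ m) bound)

≤⇒TimeBound : ∀ {T C n} m → T ≤ C * n ^ m → TimeBound T C n (ℕ→ℚ m)
≤⇒TimeBound {T} {C} {n} m le = subst (TimeBound T C n) (sym (ℕ→ℚ≡mkℚ m))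
  (subst₂ (λ a b → a ≤ b * n ^ m) (sym (*-identityʳ T)) (sym (*-identityʳ C)) le)

reciprocal≤ : ∀ ε₀ .{{_ : Positive ε₀}} d → ℚ.↧ₙ ε₀ ≤ suc d → reciprocal d ℚ.≤ ε₀
reciprocal≤ (mkℚ (+ suc p) q _) d le = ℚ.*≤* (subst₂ ℤ._≤_ (sym (ℤ.*-identityˡ (+ suc q))) (ℤ.pos-* (suc p) (suc d))
  (ℤ.+≤+ (≤-trans le (m≤n*m (suc d) (suc p)))))

-- Execution on the word RAM

update-same : ∀ f i v → update f i v i ≡ v
update-same f i v with i ≡ᵇ i | ≡⇒≡ᵇ i i refl
... | true | _ = refl

update-other : ∀ f {i j} v → i ≢ j → update f i v j ≡ f j
update-other f {i} {j} v i≢j with i ≡ᵇ j in e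
... | false = refl
... | true  = contradiction (≡ᵇ⇒≡ i j (subst (λ b → T b) (sym e) _)) i≢j

infix 4 _≈_

-- States consist of functions, and preprocessing reaches the initial state of the scheme only
-- pointwise; `run-cong` carries the guarantee of the scheme over.
_≈_ : State → State → Set
s ≈ s′ = (∀ i → regs s i ≡ regs s′ i) × (∀ a → mem s a ≡ mem s′ a)

update-cong : ∀ {f f′ : ℕ → ℕ} i {v v′} → (∀ j → f j ≡ f′ j) → v ≡ v′ → ∀ j → update f i v j ≡ update f′ i v′ j
update-cong i f≡ v≡ j with i ≡ᵇ j
... | true  = v≡
... | false = f≡ j

eval-cong : ∀ w {s s′} → s ≈ s′ → ∀ e → eval w s e ≡ eval w s′ e
eval-cong w s≈ (lit a)     = refl
eval-cong w s≈ (reg x)     = proj₁ s≈ x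
eval-cong w {s} s≈ (load e) = trans (cong (mem s) (eval-cong w s≈ e)) (proj₂ s≈ _)
eval-cong w s≈ wordSize    = refl
eval-cong w s≈ (op o e e′) = cong₂ (λ a b → wrap w (evalOp w o a b)) (eval-cong w s≈ e) (eval-cong w s≈ e′)

step-cong : ∀ w r k {s s′} → s ≈ s′ →
  proj₁ (step w r (k , s)) ≡ proj₁ (step w r (k , s′)) × proj₂ (step w r (k , s)) ≈ proj₂ (step w r (k , s′))
step-cong w r [] s≈ = refl , s≈
step-cong w r ((x ≔ e) ∷ k) s≈ = refl , update-cong x (proj₁ s≈) (eval-cong w s≈ e) , proj₂ s≈
step-cong w r (([ a ]≔ e) ∷ k) {s} {s′} s≈ = refl , proj₁ s≈ ,
  subst (λ i → ∀ j → update (mem s) (eval w s a) (eval w s e) j ≡ update (mem s′) i (eval w s′ e) j) (eval-cong w s≈ a)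
    (update-cong (eval w s a) (proj₂ s≈) (eval-cong w s≈ e))
step-cong w r (random x ∷ k) s≈ = refl , update-cong x (proj₁ s≈) refl , proj₂ s≈
step-cong w r (branch e p q ∷ k) s≈ = cong (λ v → (if v ≡ᵇ 0 then q else p) ++ k) (eval-cong w s≈ e) , s≈
step-cong w r (while e p ∷ k) s≈ = cong (λ v → if v ≡ᵇ 0 then k else p ++ while e p ∷ k) (eval-cong w s≈ e) , s≈

run-cong : ∀ {t} w (ω : Tape w t) k {s s′} → s ≈ s′ →
  proj₁ (run w ω (k , s)) ≡ proj₁ (run w ω (k , s′)) × proj₂ (run w ω (k , s)) ≈ proj₂ (run w ω (k , s′))
run-cong w []      k s≈ = refl , s≈
run-cong w (r ∷ ω) k {s} {s′} s≈ with step w r (k , s) | step w r (k , s′) | step-cong w r k s≈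
... | k₁ , s₁ | .k₁ , s₁′ | refl , s₁≈ = run-cong w ω k₁ s₁≈

step-++ : ∀ w r a k q s → step w r ((a ∷ k) ++ q , s) ≡ (proj₁ (step w r (a ∷ k , s)) ++ q , proj₂ (step w r (a ∷ k , s)))
step-++ w r (x ≔ e) k q s = refl
step-++ w r ([ a ]≔ e) k q s = refl
step-++ w r (random x) k q s = refl
step-++ w r (branch e p p′) k q s = cong (_, s) (sym (++-assoc (if eval w s e ≡ᵇ 0 then p′ else p) k q))
step-++ w r (while e p) k q s with eval w s e ≡ᵇ 0
... | true  = refl
... | false = cong (_, s) (sym (++-assoc p (while e p ∷ k) q))

-- `P` holds after exactly `t` steps, whatever the random words. Unlike a statement about all tapes,
-- this unfolds step by step, so a program is verified by following its execution.
data After (w : ℕ) (P : Config → Set) : ℕ → Config → Set where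
  now  : ∀ {c} → P c → After w P zero c
  next : ∀ {t c} → (∀ r → After w P t (step w r c)) → After w P (suc t) c

After-cast : ∀ {w P t t′ c} → t ≡ t′ → After w P t c → After w P t′ c
After-cast refl h = h

run⇒After : ∀ {w P} t c → (∀ (ω : Tape w t) → P (run w ω c)) → After w P t c
run⇒After zero    c h = now (h [])
run⇒After (suc t) c h = next λ r → run⇒After t _ (λ ω → h (r ∷ ω))

After⇒run : ∀ {w P t c} → After w P t c → ∀ (ω : Tape w t) → P (run w ω c)
After⇒run (now h)  []      = h
After⇒run (next h) (r ∷ ω) = After⇒run (h r) ω

After-halted : ∀ {w P} t {s} → P ([] , s) → After w P t ([] , s)
After-halted zero    h = now h
After-halted (suc t) h = next λ _ → After-halted t h

halted-After : ∀ {w P t s} → Fin (2 ^ w) → After w P t ([] , s) → P ([] , s)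
halted-After r (now h)  = h
halted-After r (next h) = halted-After r (h r)

-- The first program may halt before its `t` steps are over, and at different times on different
-- tapes. The idle steps are then spent after the appended assignment, so `suc t` steps are right in
-- all cases.
After-assign-last : ∀ {w t} {P : Config → Set} k s x e → After w (λ c → proj₁ c ≡ [] × P c) t (k , s) →
  After w (λ c → ∃ λ s′ → P ([] , s′) × c ≡ ([] , state (update (regs s′) x (eval w s′ e)) (mem s′)))
    (suc t) (k ++ (x ≔ e) ∷ [] , s)
After-assign-last [] s x e (now (_ , Ps)) = next λ _ → now (s , Ps , refl)
After-assign-last {t = suc t} [] s x e (next h) =
  next λ r → After-halted (suc t) (s , proj₂ (halted-After r (h r)) , refl)
After-assign-last {w} (a ∷ k) s x e (next h) = next λ r →
  subst (After _ _ _) (sym (step-++ w r a k ((x ≔ e) ∷ []) s)) (After-assign-last _ _ x e (h r))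

-- A record, so that unification can read off the state and the expression.
record Evaluates (w : ℕ) (s : State) (e : Expr) (v : ℕ) : Set where
  constructor evaluates
  field value : eval w s e ≡ v

wrap-small : ∀ w {a} → a < 2 ^ w → wrap w a ≡ a
wrap-small w = m<n⇒m%n≡m {{m^n≢0 2 w}}

module _ {w : ℕ} where

  assign : ∀ {P t k s x e v} → Evaluates w s e v →
           After w P t (k , state (update (regs s) x v) (mem s)) → After w P (suc t) ((x ≔ e) ∷ k , s)
  assign (evaluates refl) h = next λ _ → h

  store : ∀ {P t k s a e b v} → Evaluates w s a b → Evaluates w s e v →
          After w P t (k , state (regs s) (update (mem s) b v)) → After w P (suc t) (([ a ]≔ e) ∷ k , s)
  store (evaluates refl) (evaluates refl) h = next λ _ → h

  while-stop : ∀ {P t k s e p} → Evaluates w s e 0 → After w P t (k , s) → After w P (suc t) (while e p ∷ k , s)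
  while-stop {k = k} {s} {e} {p} (evaluates e≡) h = next λ _ →
    subst (λ v → After w _ _ ((if v ≡ᵇ 0 then k else p ++ while e p ∷ k) , s)) (sym e≡) h

  while-continue : ∀ {P t k s e p v} → Evaluates w s e (suc v) →
                   After w P t (p ++ while e p ∷ k , s) → After w P (suc t) (while e p ∷ k , s)
  while-continue {k = k} {s} {e} {p} (evaluates e≡) h = next λ _ →
    subst (λ v → After w _ _ ((if v ≡ᵇ 0 then k else p ++ while e p ∷ k) , s)) (sym e≡) h

module _ {w : ℕ} {s : State} where

  ev-lit : ∀ {a} → a < 2 ^ w → Evaluates w s (lit a) a
  ev-lit a< = evaluates (wrap-small w a<)

  ev-reg : ∀ {x v} → regs s x ≡ v → Evaluates w s (reg x) v
  ev-reg = evaluates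

  ev-load : ∀ {e a v} → Evaluates w s e a → mem s a ≡ v → Evaluates w s (load e) v
  ev-load (evaluates refl) = evaluates

  ev-wordSize : w < 2 ^ w → Evaluates w s wordSize w
  ev-wordSize w< = evaluates (wrap-small w w<)

  ev-op : ∀ o {e e′ a b} → Evaluates w s e a → Evaluates w s e′ b → evalOp w o a b < 2 ^ w →
          Evaluates w s (op o e e′) (evalOp w o a b)
  ev-op o (evaluates refl) (evaluates refl) small = evaluates (wrap-small w small)

  ev-≡ : ∀ {e a b} → Evaluates w s e a → a ≡ b → Evaluates w s e b
  ev-≡ e⇓ refl = e⇓

  ev-sub : ∀ {e e′ a b} → Evaluates w s e a → Evaluates w s e′ b → b ≤ a → a < 2 ^ w →
           Evaluates w s (op sub e e′) (a ∸ b)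
  ev-sub {a = a} {b} (evaluates refl) (evaluates refl) b≤a a< = evaluates (begin
    wrap w (a + (2 ^ w ∸ b))              ≡⟨ cong (λ c → wrap w (c + (2 ^ w ∸ b))) (m∸n+n≡m b≤a) ⟨
    wrap w ((a ∸ b) + b + (2 ^ w ∸ b))    ≡⟨ cong (wrap w) (+-assoc (a ∸ b) b _) ⟩
    wrap w ((a ∸ b) + (b + (2 ^ w ∸ b)))  ≡⟨ cong (λ c → wrap w ((a ∸ b) + c)) (m+[n∸m]≡n (<⇒≤ (≤-<-trans b≤a a<))) ⟩
    wrap w ((a ∸ b) + 2 ^ w)              ≡⟨ [m+n]%n≡m%n (a ∸ b) (2 ^ w) {{m^n≢0 2 w}} ⟩
    wrap w (a ∸ b)                        ≡⟨ wrap-small w (≤-<-trans (m∸n≤m a b) a<) ⟩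
    a ∸ b                                 ∎)
    where open ≡-Reasoning

-- The program that rewrites the k-Sum input as a 2DK instance

cell-beyond : ∀ xs {a} → length xs ≤ a → cell xs a ≡ 0
cell-beyond []       _ = refl
cell-beyond (x ∷ xs) (s≤s le) = cell-beyond xs le

cell-++ˡ : ∀ xs ys {a} → a < length xs → cell (xs ++ ys) a ≡ cell xs a
cell-++ˡ (x ∷ xs) ys {zero}  _ = refl
cell-++ˡ (x ∷ xs) ys {suc a} (s≤s a<) = cell-++ˡ xs ys a<

cell-++ʳ : ∀ xs ys a → cell (xs ++ ys) (length xs + a) ≡ cell ys a
cell-++ʳ []       ys a = refl
cell-++ʳ (x ∷ xs) ys a = cell-++ʳ xs ys a

module _ {A : Set} (f : A → List ℕ) (b : ℕ) (length≡ : ∀ x → length (f x) ≡ b) where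

  length-blocks : ∀ {m} (g : Fin m → A) → length (concatMap f (tabulate g)) ≡ m * b
  length-blocks {zero}  g = refl
  length-blocks {suc m} g = trans (length-++ (f (g zero)))
    (cong₂ _+_ (length≡ (g zero)) (length-blocks (λ i → g (suc i))))

  cell-blocks : ∀ {m} (g : Fin m → A) i {c} → c < b → cell (concatMap f (tabulate g)) (toℕ i * b + c) ≡ cell (f (g i)) c
  cell-blocks g zero {c} c<b = cell-++ˡ (f (g zero)) _ (subst (c <_) (sym (length≡ (g zero))) c<b)
  cell-blocks g (suc i) {c} c<b = begin
    cell (f (g zero) ++ rest) (b + toℕ i * b + c)                     ≡⟨ cong (cell (f (g zero) ++ rest)) (+-assoc b (toℕ i * b) c) ⟩
    cell (f (g zero) ++ rest) (b + (toℕ i * b + c))                   ≡⟨ cong (λ l → cell (f (g zero) ++ rest) (l + (toℕ i * b + c))) (length≡ (g zero)) ⟨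
    cell (f (g zero) ++ rest) (length (f (g zero)) + (toℕ i * b + c)) ≡⟨ cell-++ʳ (f (g zero)) rest _ ⟩
    cell rest (toℕ i * b + c)                                         ≡⟨ cell-blocks (λ i → g (suc i)) i c<b ⟩
    cell (f (g (suc i))) c                                            ∎
    where
    open ≡-Reasoning
    rest = concatMap f (tabulate (λ i → g (suc i)))

length-encodeℤ : ∀ a → length (encodeℤ a) ≡ 2
length-encodeℤ (+ _)    = refl
length-encodeℤ -[1+ _ ] = refl

-- Registers: 1 = β, 2 = 2U, 3 = KU, 7 = g, 4 = number of integers still to
-- be converted, 5 = address of the last cell written, 6 = β + aᵢ.
push : Expr → List Stmt
push e = (5 ≔ op sub (reg 5) (lit 1)) ∷ ([ reg 5 ]≔ e) ∷ []

-- The quotient `U / β`. It depends on `r` only, so the constants of the instance are literals times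
-- register 1.
unitU : ℕ → ℕ
unitU r = suc (2 * suc (2 * r)) * (2 * r) + 2 * r

setup : ℕ → ℕ → List Stmt
setup r E =
    -- `β` is a power of two given by the word size alone; no pass over the integers for their
    -- maximum is made.
    (1 ≔ op shl (lit 1) (op div wordSize (lit (suc E))))
  ∷ (2 ≔ op mul (lit (2 * unitU r)) (reg 1))
  ∷ (3 ≔ op mul (lit (suc (2 * r) * unitU r)) (reg 1))
  ∷ (7 ≔ op mul (lit (2 * r)) (reg 1))
  ∷ (4 ≔ load (lit 0))
  -- `6 * n + 10 = 4 + 3 * (2 + 2 * n)` is the length of the new encoding, one past its last cell;
  -- writing proceeds downwards.
  ∷ (5 ≔ op add (op mul (reg 4) (lit 6)) (lit 10))
  ∷ []

-- Both encodings share the memory: going down, the six cells of the items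
-- of aᵢ only overwrite integers that have been converted already.
body : List Stmt
body =
    (8 ≔ op mul (reg 4) (lit 2))
  ∷ (9 ≔ load (reg 8))
  ∷ (8 ≔ load (op sub (reg 8) (lit 1)))
  -- With sign bit `s` and absolute value `v`, the integer plus `β` is `β + v - 2 * s * v`, which
  -- avoids a branch; adding first keeps the subtraction from wrapping around.
  ∷ (6 ≔ op sub (op add (reg 1) (reg 9)) (op mul (lit 2) (op mul (reg 8) (reg 9))))
  -- Addresses descend, hence profit, height, width, and `minus i` before `plus i`.
  ∷ push (lit 1) ++ push (op add (reg 3) (reg 6)) ++ push (op sub (reg 2) (reg 6))
    ++ push (lit 1) ++ push (op sub (reg 3) (reg 6)) ++ push (op add (reg 2) (reg 6))
    ++ (4 ≔ op sub (reg 4) (lit 1)) ∷ []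

header : ℕ → ℕ → List Stmt
header r e =
    -- Register 4 has been counted down to 0, but cell 0 still holds `n`: the loop writes no address
    -- below 10.
    (8 ≔ load (lit 0))
  ∷ push (lit 1) ++ push (op sub (reg 3) (reg 7)) ++ push (op add (reg 2) (reg 7))
    ++ push (lit 1) ++ push (op add (reg 3) (reg 7)) ++ push (op sub (reg 2) (reg 7))
    ++ push (op add (lit 2) (op mul (reg 8) (lit 2)))
    ++ push (op mul (lit (2 * suc (2 * r) * unitU r)) (reg 1))
    ++ push (lit e) ++ push (lit 1)

-- The scheme expects all registers to be 0, and preprocessing uses exactly the registers 1 to 9.
clear : List Stmt
clear = (1 ≔ lit 0) ∷ (2 ≔ lit 0) ∷ (3 ≔ lit 0) ∷ (4 ≔ lit 0) ∷ (5 ≔ lit 0)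
      ∷ (6 ≔ lit 0) ∷ (7 ≔ lit 0) ∷ (8 ≔ lit 0) ∷ (9 ≔ lit 0) ∷ []

preprocess : (r E e : ℕ) → Program → Program
preprocess r E e k = setup r E ++ while (reg 4) body ∷ header r e ++ clear ++ k

-- Exact numbers of steps, as `After` requires. A round of the loop is one test, five assignments
-- and six pushes of two steps; the 30 are one load, ten pushes and nine resets.
loopTime preprocessTime : ℕ → ℕ
loopTime zero    = 1
loopTime (suc j) = 18 + loopTime j
preprocessTime n = 6 + (loopTime n + 30)

module Preprocessing {n : ℕ} (r β A : ℕ) (z : Fin n → ℤ)
  (0<r : 0 < r) (z≤A : ∀ i → ℤ.∣ z i ∣ ≤ A) (KA<β : suc (2 * r) * A < β)
  (w E e-1 : ℕ) (β≡ : β ≡ 2 ^ (w ℕ./ suc E)) (w< : w < 2 ^ w) (E< : suc E < 2 ^ w)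
  where

  open Reduction r β A z 0<r z≤A KA<β renaming (w to wd; h to ht)

  private
    K e V N : ℕ
    K = suc (2 * r)
    e = suc e-1
    V = 2 ^ w
    N = 2 * K * U

    source target : ℕ → ℕ
    source = cell (encodeKSum z)
    target = cell (encode2DK reduction (reciprocal e-1))

    block : Fin (2 + n * 2) → List ℕ
    block i = wd (kind {n} i) ∷ ht (kind {n} i) ∷ 1 ∷ []

    target-block : ∀ i ρ {c} → c < 3 →
      target ((toℕ ρ * 3 + c) + (toℕ i * 6 + 10)) ≡ cell (block (suc (suc (combine {n} {2} i ρ)))) c
    target-block i ρ {c} c<3 = trans (cong target address)
      (cell-blocks block 3 (λ _ → refl) (λ j → suc (suc j)) (combine {n} {2} i ρ) c<3)
      where
      rearrange : ∀ i ρ c → ρ * 3 + c + (i * 6 + 10) ≡ 10 + ((2 * i + ρ) * 3 + c)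
      rearrange = solve-∀
      address : (toℕ ρ * 3 + c) + (toℕ i * 6 + 10) ≡ 10 + (toℕ (combine {n} {2} i ρ) * 3 + c)
      address = trans (rearrange (toℕ i) (toℕ ρ) c)
        (cong (λ a → 10 + (a * 3 + c)) (sym (Fin.toℕ-combine i ρ)))

    target-beyond : ∀ {a} → n * 6 + 10 ≤ a → target a ≡ 0
    target-beyond {a} le = cell-beyond (encode2DK reduction (reciprocal e-1)) (subst (_≤ a) (sym len) le)
      where
      rearrange : ∀ n → 4 + (2 + n * 2) * 3 ≡ n * 6 + 10
      rearrange = solve-∀
      len : length (encode2DK reduction (reciprocal e-1)) ≡ n * 6 + 10
      len = trans (cong (λ l → 4 + l) (length-blocks block 3 (λ _ → refl) (λ j → j))) (rearrange n)

    source-beyond : ∀ {a} → n * 6 + 10 ≤ a → source a ≡ 0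
    source-beyond {a} le = cell-beyond (encodeKSum z) (≤-trans len le)
      where
      open ≤-Reasoning
      len : length (encodeKSum z) ≤ n * 6 + 10
      len = begin
        length (encodeKSum z) ≡⟨ cong suc (length-blocks (λ i → encodeℤ (z i)) 2 (λ i → length-encodeℤ (z i)) (λ j → j)) ⟩
        suc (n * 2)           ≤⟨ s≤s (*-monoʳ-≤ n (s≤s (s≤s z≤n))) ⟩
        suc (n * 6)           ≤⟨ m≤m+n (suc (n * 6)) 9 ⟩
        suc (n * 6) + 9       ≡⟨ +-suc (n * 6) 9 ⟨
        n * 6 + 10            ∎

    source-block : ∀ i {c} → c < 2 → source (suc (toℕ i * 2 + c)) ≡ cell (encodeℤ (z i)) c
    source-block i = cell-blocks (λ i → encodeℤ (z i)) 2 (λ i → length-encodeℤ (z i)) (λ j → j) i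

    decode : ∀ a → ℤ.∣ a ∣ ≤ β → let s = cell (encodeℤ a) 0 ; v = cell (encodeℤ a) 1 in
             v ≡ ℤ.∣ a ∣ × 2 * (s * v) ≤ β + v × (β + v) ∸ 2 * (s * v) ≡ ℤ.∣ + β ℤ.+ a ∣
    decode (+ a) _ = refl , z≤n , refl
    decode -[1+ a ] sa≤β = refl , le , (begin
      β + suc a ∸ 2 * (1 * suc a)          ≡⟨ cong (β + suc a ∸_) (rearrange (suc a)) ⟩
      β + suc a ∸ (suc a + suc a)          ≡⟨ cong (_∸ (suc a + suc a)) (+-comm β (suc a)) ⟩
      suc a + β ∸ (suc a + suc a)          ≡⟨ [m+n]∸[m+o]≡n∸o (suc a) β (suc a) ⟩
      β ∸ suc a                            ≡⟨ cong ℤ.∣_∣ (ℤ.⊖-≥ sa≤β) ⟨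
      ℤ.∣ β ℤ.⊖ suc a ∣                    ∎)
      where
      open ≡-Reasoning
      rearrange : ∀ a → 2 * (1 * a) ≡ a + a
      rearrange = solve-∀
      le : 2 * (1 * suc a) ≤ β + suc a
      le = subst (_≤ β + suc a) (sym (rearrange (suc a))) (+-monoˡ-≤ (suc a) sa≤β)

    -- The loop invariant: with `j` integers left, the new encoding is complete from address
    -- `6 * j + 10` upwards and the old one intact below `2 * j + 1`. Nothing is claimed about the
    -- cells between.
    High Low : (ℕ → ℕ) → ℕ → Set
    High m a = ∀ b → a ≤ b → m b ≡ target b
    Low m a = ∀ b → b < a → m b ≡ source b

    record Regs (R : ℕ → ℕ) (a j : ℕ) : Set where
      field
        r0  : R 0 ≡ 0
        r1  : R 1 ≡ β
        r2  : R 2 ≡ 2 * U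
        r3  : R 3 ≡ K * U
        r4  : R 4 ≡ j
        r5  : R 5 ≡ a
        r7  : R 7 ≡ g
        r10 : ∀ i → R (10 + i) ≡ 0

    push-correct : ∀ {t k P R m e a b} → R 5 ≡ suc a → suc a < V → b ≤ a →
      Evaluates w (state (update R 5 a) m) e (target a) → High m (suc a) → Low m b →
      (∀ m′ → High m′ a → Low m′ b → After w P t (k , state (update R 5 a) m′)) →
      After w P (2 + t) (push e ++ k , state R m)
    push-correct {R = R} {m} {e} {a} {b} R5 a< b≤a e⇓ hi lo rest =
      assign (ev-sub (ev-reg R5) (ev-lit (≤-<-trans (s≤s z≤n) a<)) (s≤s z≤n) a<)
        (store (ev-reg refl) e⇓ (rest (update m a (target a)) hi′ lo′))
      where
      hi′ : High (update m a (target a)) a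
      hi′ c a≤c with m≤n⇒m<n∨m≡n a≤c
      ... | inj₁ a<c = trans (update-other m (target a) (<⇒≢ a<c)) (hi c a<c)
      ... | inj₂ refl = update-same m a (target a)
      lo′ : Low (update m a (target a)) b
      lo′ c c<b = trans (update-other m (target a) (≢-sym (<⇒≢ (<-≤-trans c<b b≤a)))) (lo c c<b)

  -- One inequality bounds all words of the computation: literals and addresses by `20 + 8 * n`, the
  -- denominator of ε by `suc e-1`, and sizes by the side of the knapsack.
  module _ (fits : 20 + 8 * n + suc e-1 + 2 * suc (2 * r) * U < 2 ^ w) where

    private
      N< : ∀ {a} → a ≤ N → a < V
      N< le = ≤-<-trans (≤-trans le (m≤n+m N (20 + 8 * n + e))) fits

      n< : ∀ {a} → a ≤ 20 + 8 * n → a < V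
      n< le = ≤-<-trans (≤-trans le (≤-trans (m≤m+n _ e) (m≤m+n _ N))) fits

      20< : ∀ {a} → a ≤ 20 → a < V
      20< le = n< (≤-trans le (m≤m+n 20 (8 * n)))

      1< : 1 < V
      1< = 20< (m≤m+n 1 19)

      2< : 2 < V
      2< = 20< (m≤m+n 2 18)

      A≤β : A ≤ β
      A≤β = <⇒≤ A<β

      c≤c*β : ∀ c → c ≤ c * β
      c≤c*β c = m≤m*n c β {{>-nonZero 0<β}}

    loop-correct : ∀ {t k P} j → j ≤ n → ∀ R m → Regs R (j * 6 + 10) j → High m (j * 6 + 10) → Low m (j * 2 + 1) →
      (∀ R′ m′ → Regs R′ 10 0 → High m′ 10 → Low m′ 1 → After w P t (k , state R′ m′)) →
      After w P (loopTime j + t) (while (reg 4) body ∷ k , state R m)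
    loop-correct zero _ R m regs hi lo rest =
      while-stop (ev-reg (Regs.r4 regs)) (rest R m regs hi lo)
    loop-correct {t} {k} {P} (suc j) j<n R m regs hi lo rest =
      while-continue (ev-reg r4)
      (assign (ev-op mul (ev-reg r4) (ev-lit 2<) 2j<)
      (assign (ev-load (ev-reg refl) value≡)
      (assign (ev-load (ev-sub (ev-reg refl) (ev-lit 1<) (s≤s z≤n) 2j<) sign≡)
      (assign (ev-≡ (ev-sub (ev-op add (ev-reg r1) (ev-reg refl) (N< β+v≤))
                 (ev-op mul (ev-lit 2<) (ev-op mul (ev-reg refl) (ev-reg refl) (N< sv≤)) (N< 2sv≤))
                 2sv≤β+v (N< β+v≤))
               shifted≡′)
      (push-correct r5 (A< 5 5≤9) (B≤ 5) (ev-≡ (ev-lit 1<) (sym (t₁ 2 ≤-refl))) hi lo₀ λ m₁ hi lo →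
      push-correct refl (A< 4 4≤9) (B≤ 4)
        (ev-≡ (ev-op add (ev-reg r3) (ev-reg refl) (N< KU+b≤)) (sym (t₁ 1 (s≤s (s≤s z≤n))))) hi lo λ m₂ hi lo →
      push-correct refl (A< 3 3≤9) (B≤ 3)
        (ev-≡ (ev-sub (ev-reg r2) (ev-reg refl) b≤2U (N< 2U≤N)) (sym (t₁ 0 (s≤s z≤n)))) hi lo λ m₃ hi lo →
      push-correct refl (A< 2 2≤9) (B≤ 2) (ev-≡ (ev-lit 1<) (sym (t₀ 2 ≤-refl))) hi lo λ m₄ hi lo →
      push-correct refl (A< 1 1≤9) (B≤ 1)
        (ev-≡ (ev-sub (ev-reg r3) (ev-reg refl) b≤KU (N< KU≤N)) (sym (t₀ 1 (s≤s (s≤s z≤n))))) hi lo λ m₅ hi lo →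
      push-correct refl (A< 0 z≤n) (B≤ 0)
        (ev-≡ (ev-op add (ev-reg r2) (ev-reg refl) (N< 2U+b≤)) (sym (t₀ 0 (s≤s z≤n)))) hi lo λ m₆ hi lo →
      assign (ev-sub (ev-reg r4) (ev-lit 1<) (s≤s z≤n) j<)
      (loop-correct j (<⇒≤ j<n) _ m₆
        (record { r0 = r0 ; r1 = r1 ; r2 = r2 ; r3 = r3 ; r4 = refl ; r5 = refl ; r7 = r7 ; r10 = r10 })
        hi lo rest))))))
      where
      open Regs regs
      i : Fin n
      i = fromℕ< j<n
      toℕ-i : toℕ i ≡ j
      toℕ-i = Fin.toℕ-fromℕ< j<n
      s v b : ℕ
      s = cell (encodeℤ (z i)) 0
      v = cell (encodeℤ (z i)) 1
      b = shifted i
      decoded = decode (z i) (≤-trans (z≤A i) A≤β)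
      v≤A : v ≤ A
      v≤A = subst (_≤ A) (sym (proj₁ decoded)) (z≤A i)
      2sv≤β+v = proj₁ (proj₂ decoded)
      shifted≡′ = proj₂ (proj₂ decoded)
      β+v≤ : β + v ≤ N
      β+v≤ = ≤-trans (+-monoʳ-≤ β (≤-trans v≤A A≤β)) 2β≤N
      2sv≤ : 2 * (s * v) ≤ N
      2sv≤ = ≤-trans 2sv≤β+v β+v≤
      sv≤ : s * v ≤ N
      sv≤ = ≤-trans (m≤m+n (s * v) _) 2sv≤
      value≡ : m (suc j * 2) ≡ v
      value≡ = trans (lo _ (s≤s (s≤s (≤-reflexive (+-comm 1 (j * 2))))))
        (trans (cong source (cong suc (trans (+-comm 1 (j * 2)) (cong (λ a → a * 2 + 1) (sym toℕ-i))))) (source-block i {1} ≤-refl))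
      sign≡ : m (suc (j * 2)) ≡ s
      sign≡ = trans (lo _ (s≤s (≤-trans (≤-reflexive (+-comm 1 (j * 2))) (n≤1+n _))))
        (trans (cong source (cong suc (trans (sym (+-identityʳ (j * 2))) (cong (λ a → a * 2 + 0) (sym toℕ-i))))) (source-block i {0} (s≤s z≤n)))
      2j<  : suc j * 2 < V
      2j<  = n< (≤-trans (*-mono-≤ j<n (≤-refl {2})) (≤-trans (≤-trans (≤-reflexive (*-comm n 2)) (*-monoˡ-≤ n (m≤m+n 2 6))) (m≤n+m (8 * n) 20)))
      j< : suc j < V
      j< = n< (≤-trans j<n (≤-trans (m≤n*m n 8) (m≤n+m (8 * n) 20)))
      lo₀ : Low m (j * 2 + 1)
      lo₀ c c< = lo c (≤-trans c< (≤-trans (n≤1+n _) (n≤1+n _)))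
      5≤9 : 5 ≤ 9
      5≤9 = m≤m+n 5 4
      4≤9 = m≤m+n 4 5
      3≤9 = m≤m+n 3 6
      2≤9 = m≤m+n 2 7
      1≤9 = m≤m+n 1 8
      A< : ∀ d → d ≤ 9 → suc (d + (j * 6 + 10)) < V
      A< d d≤9 = n< (begin
        suc (d + (j * 6 + 10))  ≤⟨ s≤s (+-monoˡ-≤ (j * 6 + 10) d≤9) ⟩
        10 + (j * 6 + 10)       ≡⟨ cong (λ a → 10 + a) (+-comm (j * 6) 10) ⟩
        20 + j * 6              ≤⟨ +-monoʳ-≤ 20 (*-monoˡ-≤ 6 (<⇒≤ j<n)) ⟩
        20 + n * 6              ≡⟨ cong (λ a → 20 + a) (*-comm n 6) ⟩
        20 + 6 * n              ≤⟨ +-monoʳ-≤ 20 (*-monoˡ-≤ n (m≤m+n 6 2)) ⟩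
        20 + 8 * n              ∎)
        where open ≤-Reasoning
      B≤ : ∀ d → j * 2 + 1 ≤ d + (j * 6 + 10)
      B≤ d = ≤-trans (+-mono-≤ (*-monoʳ-≤ j (m≤m+n 2 4)) (m≤m+n 1 9)) (m≤n+m _ d)
      b≤2U : b ≤ 2 * U
      b≤2U = ≤-trans (shifted≤g i) g≤2U
      b≤KU : b ≤ K * U
      b≤KU = ≤-trans (shifted≤g i) g≤KU
      2U+b≤ : 2 * U + b ≤ N
      2U+b≤ = ≤-trans (+-monoʳ-≤ (2 * U) (shifted≤g i)) 2U+g≤N
      KU+b≤ : K * U + b ≤ N
      KU+b≤ = ≤-trans (+-monoʳ-≤ (K * U) (shifted≤g i)) KU+g≤N
      t₀ : ∀ c → c < 3 → target (c + (j * 6 + 10)) ≡ cell (wd (plus i) ∷ ht (plus i) ∷ 1 ∷ []) c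
      t₀ c c<3 = trans (cong (λ j → target (c + (j * 6 + 10))) (sym toℕ-i)) (trans (target-block i zero c<3)
        (cong (λ κ → cell (wd κ ∷ ht κ ∷ 1 ∷ []) c) (kind-index (plus i))))
      t₁ : ∀ c → c < 3 → target ((3 + c) + (j * 6 + 10)) ≡ cell (wd (minus i) ∷ ht (minus i) ∷ 1 ∷ []) c
      t₁ c c<3 = trans (cong (λ j → target ((3 + c) + (j * 6 + 10))) (sym toℕ-i)) (trans (target-block i (suc zero) c<3)
        (cong (λ κ → cell (wd κ ∷ ht κ ∷ 1 ∷ []) c) (kind-index (minus i))))

    private
      lit< : ∀ c → c * β ≤ N → c < V
      lit< c le = N< (≤-trans (c≤c*β c) le)

      unitU*β : ∀ c → c * unitU r * β ≡ c * U
      unitU*β c = rearrange c r β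
        where
        rearrange : ∀ c r β → c * (suc (2 * suc (2 * r)) * (2 * r) + 2 * r) * β
                            ≡ c * (suc (2 * suc (2 * r)) * (2 * r * β) + 2 * r * β)
        rearrange = solve-∀

      ev-multiple : ∀ {s} c {a} → regs s 1 ≡ β → a ≡ c * β → a ≤ N → Evaluates w s (op mul (lit c) (reg 1)) a
      ev-multiple c s1 refl le = ev-op mul (ev-lit (lit< c le)) (ev-reg s1) (N< le)

      n*6+10≤ : n * 6 + 10 ≤ 20 + 8 * n
      n*6+10≤ = begin
        n * 6 + 10   ≡⟨ +-comm (n * 6) 10 ⟩
        10 + n * 6   ≡⟨ cong (λ a → 10 + a) (*-comm n 6) ⟩
        10 + 6 * n   ≤⟨ +-mono-≤ (m≤m+n 10 10) (*-monoˡ-≤ n (m≤m+n 6 2)) ⟩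
        20 + 8 * n   ∎
        where open ≤-Reasoning

      n*2≤ : 2 + n * 2 ≤ 20 + 8 * n
      n*2≤ = +-mono-≤ (m≤m+n 2 18) (≤-trans (≤-reflexive (*-comm n 2)) (*-monoˡ-≤ n (m≤m+n 2 6)))

    header-correct : ∀ {t k P} R m → Regs R 10 0 → High m 10 → Low m 1 →
      (∀ s → s ≈ state (λ _ → 0) target → After w P t (k , s)) →
      After w P (30 + t) (header r e ++ clear ++ k , state R m)
    header-correct {t} {k} {P} R m regs hi lo rest =
      assign (ev-load (ev-lit 0<V) (lo 0 (s≤s z≤n)))
      (push-correct r5 (20< (m≤m+n 10 10)) z≤n (ev-lit 1<) hi (λ _ ()) λ m₁ hi lo →
      push-correct refl (20< (m≤m+n 9 11)) z≤n (ev-sub (ev-reg r3) (ev-reg r7) g≤KU (N< KU≤N)) hi lo λ m₂ hi lo →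
      push-correct refl (20< (m≤m+n 8 12)) z≤n (ev-op add (ev-reg r2) (ev-reg r7) (N< 2U+g≤N)) hi lo λ m₃ hi lo →
      push-correct refl (20< (m≤m+n 7 13)) z≤n (ev-lit 1<) hi lo λ m₄ hi lo →
      push-correct refl (20< (m≤m+n 6 14)) z≤n (ev-op add (ev-reg r3) (ev-reg r7) (N< KU+g≤N)) hi lo λ m₅ hi lo →
      push-correct refl (20< (m≤m+n 5 15)) z≤n (ev-sub (ev-reg r2) (ev-reg r7) g≤2U (N< 2U≤N)) hi lo λ m₆ hi lo →
      push-correct refl (20< (m≤m+n 4 16)) z≤n
        (ev-op add (ev-lit 2<) (ev-op mul (ev-reg refl) (ev-lit 2<) (n< (≤-trans (m≤n+m (n * 2) 2) n*2≤))) (n< n*2≤)) hi lo λ m₇ hi lo →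
      push-correct refl (20< (m≤m+n 3 17)) z≤n
        (ev-multiple (2 * suc (2 * r) * unitU r) r1 (sym (unitU*β (2 * suc (2 * r)))) ≤-refl) hi lo λ m₈ hi lo →
      push-correct refl (20< (m≤m+n 2 18)) z≤n (ev-lit e<V) hi lo λ m₉ hi lo →
      push-correct refl 1< z≤n (ev-lit 1<) hi lo λ m₁₀ hi lo →
      assign (ev-lit 0<V) (assign (ev-lit 0<V) (assign (ev-lit 0<V) (assign (ev-lit 0<V) (assign (ev-lit 0<V)
      (assign (ev-lit 0<V) (assign (ev-lit 0<V) (assign (ev-lit 0<V) (assign (ev-lit 0<V)
      (rest _ ((λ { 0 → r0 ; 1 → refl ; 2 → refl ; 3 → refl ; 4 → refl ; 5 → refl ; 6 → refl ; 7 → refl ; 8 → refl ; 9 → refl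
                  ; (suc (suc (suc (suc (suc (suc (suc (suc (suc (suc i)))))))))) → r10 i })
              , λ a → hi a z≤n)))))))))))
      where
      open Regs regs
      0<V : 0 < V
      0<V = 20< z≤n
      e<V : e < V
      e<V = ≤-<-trans (≤-trans (m≤n+m e (20 + 8 * n)) (m≤m+n _ N)) fits

    preprocess-correct : ∀ {t k P} →
      (∀ s → s ≈ state (λ _ → 0) target → After w P t (k , s)) →
      After w P (preprocessTime n + t) (initial (preprocess r E e k) (encodeKSum z))
    preprocess-correct {t} {k} {P} rest =
      assign (ev-≡ (ev-op shl (ev-lit 1<) (ev-op div (ev-wordSize w<) (ev-lit E<) (≤-<-trans (m/n≤m w (suc E)) w<))
                      (subst (_< V) (sym power) (N< β≤N))) power)
      (assign (ev-multiple (2 * unitU r) refl (sym (unitU*β 2)) 2U≤N)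
      (assign (ev-multiple (suc (2 * r) * unitU r) refl (sym (unitU*β (suc (2 * r)))) KU≤N)
      (assign (ev-multiple (2 * r) refl refl g≤N)
      (assign (ev-load (ev-lit (20< z≤n)) refl)
      (assign (ev-op add (ev-op mul (ev-reg refl) (ev-lit (20< (m≤m+n 6 14))) (n< (≤-trans (m≤m+n (n * 6) 10) n*6+10≤)))
                (ev-lit (20< (m≤m+n 10 10))) (n< n*6+10≤))
      (After-cast (sym (+-assoc (loopTime n) 30 t))
      (loop-correct n ≤-refl _ _
        (record { r0 = refl ; r1 = refl ; r2 = refl ; r3 = refl ; r4 = refl ; r5 = refl ; r7 = refl ; r10 = λ _ → refl })
        -- Before anything is written, the invariant holds because both encodings have ended and
        -- memory is 0 there.
        (λ a le → trans (source-beyond le) (sym (target-beyond le)))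
        (λ a _ → refl)
        (λ R m regs hi lo → header-correct R m regs hi lo rest))))))))
      where
      power : 1 * 2 ^ (w ℕ./ suc E) ≡ β
      power = trans (*-identityˡ (2 ^ (w ℕ./ suc E))) (sym β≡)

-- The resulting k-Sum algorithm

encoded-abs : ∀ a → cell (encodeℤ a) 1 ≡ ℤ.∣ a ∣
encoded-abs (+ _)    = refl
encoded-abs -[1+ _ ] = refl

length-encodeKSum : ∀ {n} (z : Fin n → ℤ) → length (encodeKSum z) ≡ suc (n * 2)
length-encodeKSum z = cong suc (length-blocks (λ i → encodeℤ (z i)) 2 (λ i → length-encodeℤ (z i)) (λ j → j))

∣z∣≤max : ∀ {n} (z : Fin n → ℤ) i → ℤ.∣ z i ∣ ≤ foldr _⊔_ 0 (encodeKSum z)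
∣z∣≤max z i = subst (_≤ foldr _⊔_ 0 (encodeKSum z))
  (trans (cell-blocks (λ i → encodeℤ (z i)) 2 (λ i → length-encodeℤ (z i)) (λ j → j) i ≤-refl) (encoded-abs (z i)))
  (cell≤max (encodeKSum z) (suc (toℕ i * 2 + 1)))

loopTime≡ : ∀ n → loopTime n ≡ 18 * n + 1
loopTime≡ zero    = refl
loopTime≡ (suc n) = trans (cong (λ a → 18 + a) (loopTime≡ n)) (rearrange n)
  where
  rearrange : ∀ n → 18 + (18 * n + 1) ≡ 18 * suc n + 1
  rearrange = solve-∀

-- The instance has `2 + 2 * n ≤ 4 * n` items, which costs the factor `4 ^ suc m`. Preprocessing and
-- the final comparison take `38 + 18 * n` steps, absorbed because the exponent is at least one.
total-time : ∀ {n t f} m → 1 ≤ n → t ≤ f * (2 + n * 2) ^ suc m →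
             preprocessTime n + suc t ≤ (56 + f * 4 ^ suc m) * n ^ suc m
total-time {n} {t} {f} m 1≤n t≤ = begin
  preprocessTime n + suc t                         ≡⟨ cong (λ l → 6 + (l + 30) + suc t) (loopTime≡ n) ⟩
  6 + (18 * n + 1 + 30) + suc t                    ≡⟨ rearrange n t ⟩
  38 * 1 + 18 * n + t                              ≤⟨ +-mono-≤ (+-mono-≤ (*-monoʳ-≤ 38 1≤n^m) (*-monoʳ-≤ 18 n≤n^m)) t≤′ ⟩
  38 * n ^ suc m + 18 * n ^ suc m + f * (4 ^ suc m * n ^ suc m)  ≡⟨ rearrange′ (n ^ suc m) f (4 ^ suc m) ⟩
  (56 + f * 4 ^ suc m) * n ^ suc m                 ∎
  where
  open ≤-Reasoning
  instance
    n≢0 : NonZero n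
    n≢0 = >-nonZero 1≤n
  1≤n^m : 1 ≤ n ^ suc m
  1≤n^m = m^n>0 n (suc m)
  n≤n^m : n ≤ n ^ suc m
  n≤n^m = m≤m*n n (n ^ m) {{m^n≢0 n m}}
  rearrange : ∀ n t → 6 + (18 * n + 1 + 30) + suc t ≡ 38 * 1 + 18 * n + t
  rearrange = solve-∀
  rearrange′ : ∀ a f b → 38 * a + 18 * a + f * (b * a) ≡ (56 + f * b) * a
  rearrange′ = solve-∀
  2+2n≤4n : 2 + n * 2 ≤ 4 * n
  2+2n≤4n = ≤-trans (+-monoˡ-≤ (n * 2) (*-monoʳ-≤ 2 1≤n)) (≤-reflexive (double n))
    where
    double : ∀ n → 2 * n + n * 2 ≡ 4 * n
    double = solve-∀
  t≤′ : t ≤ f * (4 ^ suc m * n ^ suc m)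
  t≤′ = ≤-trans t≤ (*-monoʳ-≤ f (≤-trans (^-monoˡ-≤ (suc m) 2+2n≤4n) (≤-reflexive (^-distribʳ-* (suc m) 4 n))))
    where
    ^-distribʳ-* : ∀ k a b → (a * b) ^ k ≡ a ^ k * b ^ k
    ^-distribʳ-* zero    a b = refl
    ^-distribʳ-* (suc k) a b = trans (cong (λ c → a * b * c) (^-distribʳ-* k a b)) (swap a b (a ^ k) (b ^ k))
      where
      swap : ∀ a b c d → a * b * (c * d) ≡ a * c * (b * d)
      swap = solve-∀

-- What a scheme guarantees for the single value ε = 1/(9(m + 1)), where the
-- exponent is m + 1.
Solves2DK : Variant → ℕ → Program → ℕ → ℕ → Set
Solves2DK v m p κ f =
  ∀ I → Cardinality I → 1 ≤ Instance.n I → ∀ w → WordsSuffice κ w (encode2DK I ε) →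
  Σ[ t ∈ ℕ ] TimeBound t f (Instance.n I) (ℕ→ℚ (suc m))
    × (∀ (ω : Tape w t) → Σ[ S ∈ Solution I ] Outputs I (run w ω (initial p (encode2DK I ε))) S × Approximate I v ε S)
  where ε = reciprocal (m + 8 * suc m)

module FromScheme (v : Variant) (m : ℕ) (1≤m : 1 ≤ m) (p : Program) (κ f : ℕ) (scheme : Solves2DK v m p κ f) where

  r K e-1 E D : ℕ
  r   = suc (suc m)
  K   = suc (2 * r)
  e-1 = m + 8 * suc m
  -- So `suc E = 2 * (1 + κ)`: the instance is measured by at most `β * β`, and the scheme asks for
  -- the power `1 + κ` of that.
  E   = suc (2 * κ)
  -- Collects what `β` has to dominate: `K` for `K * A < β`, the literal `suc E`, and the
  -- coefficients in the estimate `X ≤ β * β`.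
  D   = 31 + suc e-1 + 2 * K * unitU r + suc E + K

  ε : ℚ
  ε = reciprocal e-1

  decide : Program
  -- Comparing with `2 * K - 1` by `lt` tests for at least `2 * K` packed items.
  decide = preprocess r E (suc e-1) (p ++ (0 ≔ op lt (lit (pred (2 * K))) (reg 0)) ∷ [])

  -- The constant 9 at work: `2 * K = 4 * m + 10` is at most `9 * m + 9` once `m ≥ 1`, so ε is small
  -- enough for the approximation to reach `2 * K` items.
  2K≤e : 2 * K ≤ suc e-1
  2K≤e = begin
    2 * K                     ≡⟨ rearrange m ⟩
    4 * m + 5 * 1 + 5         ≤⟨ +-monoˡ-≤ 5 (+-monoʳ-≤ (4 * m) (*-monoʳ-≤ 5 1≤m)) ⟩
    4 * m + 5 * m + 5         ≤⟨ m≤m+n _ 4 ⟩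
    4 * m + 5 * m + 5 + 4     ≡⟨ rearrange′ m ⟩
    suc e-1                   ∎
    where
    open ≤-Reasoning
    rearrange : ∀ m → 2 * suc (2 * suc (suc m)) ≡ 4 * m + 5 * 1 + 5
    rearrange = solve-∀
    rearrange′ : ∀ m → 4 * m + 5 * m + 5 + 4 ≡ suc (m + 8 * suc m)
    rearrange′ = solve-∀

  κ′ : ℕ
  -- Then `1 + κ′` is `suc (suc D) * suc E`, the exponent in `≤2^[w/E]`. It depends on the scheme
  -- and `m`, not on the integers.
  κ′ = E + suc D * suc E

  module Run {n : ℕ} (1≤n : 1 ≤ n) (z : Fin n → ℤ) (w : ℕ) (words : WordsSuffice κ′ w (encodeKSum z)) where

    A b β : ℕ
    A = foldr _⊔_ 0 (encodeKSum z)
    b = 1 + length (encodeKSum z) + A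
    β = 2 ^ (w ℕ./ suc E)

    Db≤β : D * b ≤ β
    Db≤β = ≤2^[w/E] b D E w (s≤s (s≤s z≤n)) words

    β≤2^w : β ≤ 2 ^ w
    β≤2^w = ≤-trans (m≤m*n β (β ^ E) {{m^n≢0 β E {{m^n≢0 2 (w ℕ./ suc E)}}}}) (2^[w/E]^E≤ E w)

    K≤D : K ≤ D
    K≤D = m≤n+m K (31 + suc e-1 + 2 * K * unitU r + suc E)

    KA<β : K * A < β
    KA<β = <-≤-trans (≤-<-trans (*-monoˡ-≤ A K≤D) (*-monoʳ-< D {A} {b} (s≤s (m≤n+m A (length (encodeKSum z)))))) Db≤β

    open Reduction r β A z (s≤s z≤n) (∣z∣≤max z) KA<β renaming (w to wd; h to ht)

    n≤b : n ≤ b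
    n≤b = begin
      n                                ≤⟨ m≤m*n n 2 ⟩
      n * 2                            ≤⟨ n≤1+n (n * 2) ⟩
      suc (n * 2)                      ≡⟨ length-encodeKSum z ⟨
      length (encodeKSum z)            ≤⟨ m≤m+n _ A ⟩
      length (encodeKSum z) + A        ≤⟨ n≤1+n _ ⟩
      b                                ∎
      where open ≤-Reasoning

    D≤β : D ≤ β
    D≤β = ≤-trans (m≤m*n D b) Db≤β

    n≤β : n ≤ β
    n≤β = ≤-trans n≤b (≤-trans (m≤n*m b D) Db≤β)

    N = 2 * K * U

    N≡ : N ≡ 2 * K * unitU r * β
    N≡ = rearrange (2 * K) r β
      where
      rearrange : ∀ c r β → c * (suc (2 * suc (2 * r)) * (2 * r * β) + 2 * r * β)
                          ≡ c * (suc (2 * suc (2 * r)) * (2 * r) + 2 * r) * β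
      rearrange = solve-∀

    -- Dominates both the size measure of the 2DK encoding and every word that preprocessing
    -- computes.
    X : ℕ
    X = 21 + 8 * n + suc e-1 + N

    X≤β² : X ≤ β * β
    X≤β² = begin
      21 + 8 * n + suc e-1 + N
        ≡⟨ cong (λ a → 21 + 8 * n + suc e-1 + a) N≡ ⟩
      21 + 8 * n + suc e-1 + 2 * K * unitU r * β
        ≤⟨ +-monoˡ-≤ _ (+-mono-≤ (+-mono-≤ (m≤m*n 21 β {{nonZero-β}}) (*-monoʳ-≤ 8 n≤β)) (m≤m*n (suc e-1) β {{nonZero-β}})) ⟩
      21 * β + 8 * β + suc e-1 * β + 2 * K * unitU r * β
        ≡⟨ collect-β β (suc e-1) (2 * K * unitU r) ⟩
      (29 + suc e-1 + 2 * K * unitU r) * β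
        ≤⟨ *-monoˡ-≤ β (≤-trans (≤-trans (≤-trans (+-monoˡ-≤ (2 * K * unitU r) (+-monoˡ-≤ (suc e-1) (m≤m+n 29 2))) (m≤m+n _ (suc E))) (m≤m+n _ K)) D≤β) ⟩
      β * β ∎
      where
      open ≤-Reasoning
      nonZero-β : NonZero β
      nonZero-β = >-nonZero 0<β
      collect-β : ∀ β e c → 21 * β + 8 * β + e * β + c * β ≡ (29 + e + c) * β
      collect-β = solve-∀

    X^≤ : X ^ (1 + κ) ≤ 2 ^ w
    X^≤ = begin
      X ^ (1 + κ)          ≤⟨ ^-monoˡ-≤ (1 + κ) X≤β² ⟩
      (β * β) ^ (1 + κ)    ≡⟨ cong (λ a → (β * a) ^ (1 + κ)) (*-identityʳ β) ⟨
      (β ^ 2) ^ (1 + κ)    ≡⟨ ^-*-assoc β 2 (1 + κ) ⟩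
      β ^ (2 * (1 + κ))    ≡⟨ cong (β ^_) (*-suc 2 κ) ⟩
      β ^ suc E            ≤⟨ 2^[w/E]^E≤ E w ⟩
      2 ^ w                ∎
      where open ≤-Reasoning

    fits : 20 + 8 * n + suc e-1 + N < 2 ^ w
    fits = ≤-trans (m≤m*n X (X ^ κ) {{m^n≢0 X κ}}) X^≤

    E< : suc E < 2 ^ w
    E< = <-≤-trans (≤-trans (m<n+m (suc E) {31 + suc e-1 + 2 * K * unitU r} (s≤s z≤n)) (m≤m+n _ K)) (≤-trans D≤β β≤2^w)

    words2DK : WordsSuffice κ w (encode2DK reduction ε)
    words2DK = ≤-trans (^-monoˡ-≤ (1 + κ) (begin
      1 + length (encode2DK reduction ε) + foldr _⊔_ 0 (encode2DK reduction ε)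
        ≤⟨ +-mono-≤ (s≤s (≤-reflexive (cong (λ l → 4 + l) (length-blocks block 3 (λ _ → refl) (λ j → j))))) max≤ ⟩
      1 + (4 + (2 + n * 2) * 3) + (suc e-1 + N + (2 + n * 2))
        ≡⟨ rearrange n (suc e-1) N ⟩
      13 + 8 * n + suc e-1 + N
        ≤⟨ +-monoˡ-≤ N (+-monoˡ-≤ (suc e-1) (+-monoˡ-≤ (8 * n) (m≤m+n 13 8))) ⟩
      X ∎)) X^≤
      where
      open ≤-Reasoning
      block : Fin (2 + n * 2) → List ℕ
      block i = wd (kind {n} i) ∷ ht (kind {n} i) ∷ 1 ∷ []
      M = suc e-1 + N + (2 + n * 2)
      1≤M : 1 ≤ M
      1≤M = s≤s z≤n
      e≤M : suc e-1 ≤ M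
      e≤M = ≤-trans (m≤m+n (suc e-1) N) (m≤m+n _ (2 + n * 2))
      N≤M : N ≤ M
      N≤M = ≤-trans (m≤n+m N (suc e-1)) (m≤m+n _ (2 + n * 2))
      n′≤M : 2 + n * 2 ≤ M
      n′≤M = m≤n+m (2 + n * 2) (suc e-1 + N)
      max≤ : foldr _⊔_ 0 (encode2DK reduction ε) ≤ M
      max≤ = ⊔-lub 1≤M (⊔-lub e≤M (⊔-lub N≤M (⊔-lub n′≤M
        (max-concatMap block (λ i → ⊔-lub (≤-trans (w≤N (kind {n} i)) N≤M)
          (⊔-lub (≤-trans (h≤N (kind {n} i)) N≤M) (⊔-lub 1≤M z≤n))) (allFin (2 + n * 2))))))
      rearrange : ∀ n e N → 1 + (4 + (2 + n * 2) * 3) + (e + N + (2 + n * 2)) ≡ 13 + 8 * n + e + N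
      rearrange = solve-∀

    -- The answer depends only on the number of selected items; that they can be packed is part of
    -- `Approximate`, so the placements in memory are never read.
    Good : Config → Set
    Good c = Σ[ S ∈ Solution reduction ] regs (proj₂ c) 0 ≡ length S × Approximate reduction v ε S

    schemeRun = scheme reduction (λ _ → refl) (s≤s z≤n) w words2DK

    t : ℕ
    t = proj₁ schemeRun

    after-scheme : ∀ s → s ≈ state (λ _ → 0) (cell (encode2DK reduction ε)) →
      After w (λ c → proj₁ c ≡ [] × Good c) t (p , s)
    after-scheme s s≈ = run⇒After t (p , s) λ ω → transfer ω (proj₂ (proj₂ schemeRun) ω)
      where
      transfer : ∀ ω → (Σ[ S ∈ Solution reduction ] Outputs reduction (run w ω (initial p (encode2DK reduction ε))) S × Approximate reduction v ε S) →
                 proj₁ (run w ω (p , s)) ≡ [] × Good (run w ω (p , s))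
      transfer ω (S , (halted , count , _) , approximate) =
        let k≡ , regs≡ , _ = run-cong w ω p s≈ in
        trans k≡ halted , S , trans (regs≡ 0) count , approximate

    time : ℕ
    time = preprocessTime n + suc t

    time≤ : time ≤ (56 + f * 4 ^ suc m) * n ^ suc m
    time≤ = total-time {n} {t} {f} m 1≤n (TimeBound⇒≤ {C = f} {2 + n * 2} (suc m) (proj₁ (proj₂ schemeRun)))

    Answer : Config → Set
    Answer c = Σ[ s ∈ State ] Good ([] , s)
      × c ≡ ([] , state (update (regs s) 0 (eval w s (op lt (lit (pred (2 * K))) (reg 0)))) (mem s))

    answer : ∀ (ω : Tape w time) → Answer (run w ω (initial decide (encodeKSum z)))
    answer = After⇒run {w} {Answer} {time} {initial decide (encodeKSum z)}
      (Preprocessing.preprocess-correct r β A z (s≤s z≤n) (∣z∣≤max z) KA<β w E e-1 refl (m<2^m w) E< fits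
        {suc t} {p ++ (0 ≔ op lt (lit (pred (2 * K))) (reg 0)) ∷ []} {Answer}
        (λ s s≈ → After-assign-last {w} {t} {Good} p s 0 (op lt (lit (pred (2 * K))) (reg 0)) (after-scheme s s≈)))

    open ≤-Reasoning

    register : ∀ s → eval w s (op lt (lit (pred (2 * K))) (reg 0)) ≡ bit (pred (2 * K) <ᵇ regs s 0)
    register s = Evaluates.value (ev-op {w} {s} lt {lit (pred (2 * K))} {reg 0} (ev-lit 2K<) (ev-reg refl) (≤-<-trans (bit≤1 (pred (2 * K) <ᵇ regs s 0)) 1<))
      where
      1< : 1 < 2 ^ w
      1< = <-≤-trans (s≤s (s≤s z≤n)) (≤-trans D≤β β≤2^w)
      2K< : pred (2 * K) < 2 ^ w
      2K< = begin-strict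
        pred (2 * K)  <⟨ ≤-refl ⟩
        2 * K         ≤⟨ 2K≤e ⟩
        suc e-1       ≤⟨ ≤-trans (m≤n+m (suc e-1) (20 + 8 * n)) (m≤m+n _ N) ⟩
        20 + 8 * n + suc e-1 + N  <⟨ fits ⟩
        2 ^ w         ∎

    correct : ∀ a → (∀ S → Approximate reduction v ε S → bit (pred (2 * K) <ᵇ length S) ≡ a) →
              ∀ ω → answers a (run w ω (initial decide (encodeKSum z))) ≡ true
    correct a good ω = conclude (answer ω)
      where
      n≡ᵇn : ∀ n → (n ≡ᵇ n) ≡ true
      n≡ᵇn zero    = refl
      n≡ᵇn (suc n) = n≡ᵇn n
      conclude : ∀ {c} → Answer c → answers a c ≡ true
      conclude (s , (S , count , approximate) , c≡) = trans (cong (answers a) c≡)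
        (trans (cong (_≡ᵇ a) (trans (register s) (trans (cong (λ l → bit (pred (2 * K) <ᵇ l)) count) (good S approximate))))
               (n≡ᵇn a))

    accepts : HasKSum (2 * r) z → ∀ S → Approximate reduction v ε S → bit (pred (2 * K) <ᵇ length S) ≡ 1
    accepts ksum S approximate =
      let S′ , feasible , length≡ = Packing.HasKSum⇒packing r β A z (s≤s z≤n) (∣z∣≤max z) KA<β v ksum in
      bit-true (<⇒<ᵇ (approximate⇒≤length reduction (λ _ → refl) v e-1 S S′ 2K≤e feasible length≡ approximate))
      where
      bit-true : ∀ {b} → T b → bit b ≡ 1
      bit-true {true} _ = refl

    rejects : ¬ HasKSum (2 * r) z → ∀ S → Approximate reduction v ε S → bit (pred (2 * K) <ᵇ length S) ≡ 0
    rejects ¬ksum S (feasible , _) = bit-false λ 2K≤ → ¬ksum (packing⇒HasKSum v S feasible (<ᵇ⇒< _ _ 2K≤))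
      where
      bit-false : ∀ {b} → ¬ T b → bit b ≡ 0
      bit-false {false} _  = refl
      bit-false {true}  ¬b = ⊥-elim (¬b tt)

  solves : SolvesKSum (2 * r) ((+ ⌈ 2 * r /2⌉ / 1) ℚ.- 1ℚ) decide
  solves = κ′ , 56 + f * 4 ^ suc m , λ n 1≤n z w words →
    let open Run 1≤n z w words in
    time ,
    subst (TimeBound time (56 + f * 4 ^ suc m) n) (sym (exponent (suc m))) (≤⇒TimeBound {time} {56 + f * 4 ^ suc m} {n} (suc m) time≤) ,
    (λ ksum → always⇒WithHighProbability n w time _ (correct 1 (accepts ksum))) ,
    (λ ¬ksum → always⇒WithHighProbability n w time _ (correct 0 (rejects ¬ksum)))

-- A single ε is used, so `κ ε` and `f ε` become constants of one k-Sum algorithm, which saves a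
-- full factor of `n`: δ is 1.
no-scheme : KSumConjecture → ∀ v ε₀ → Positive ε₀ → ¬ CardinalityScheme v (ℚ._≤ ε₀) (+ 1 / 9)
no-scheme conjecture v ε₀ positive (p , κ , f , scheme) =
  conjecture (2 * r , 1ℚ , s≤s (s≤s z≤n) , _ , decide , solves)
  where
  m : ℕ
  -- If `q` is the denominator of `ε₀`, then `ε₀ ≥ 1/q`, which exceeds the chosen ε,
  -- `1/(9 * (q + 1))`; moreover `q ≥ 1`, as `FromScheme` demands.
  m = ℚ.↧ₙ ε₀
  ε : ℚ
  ε = reciprocal (m + 8 * suc m)
  scheme-ε : Solves2DK v m p (κ ε) (f ε)
  scheme-ε I cardinality 1≤n w words =
    let t , bound , output = scheme ε (reciprocal≤ ε₀ {{positive}} (m + 8 * suc m) (≤-trans (m≤m+n m (8 * suc m)) (n≤1+n _))) I cardinality 1≤n w words in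
    t , subst (TimeBound t (f ε) (Instance.n I)) (ninth÷reciprocal m) bound , output
  open FromScheme v m (s≤s z≤n) p (κ ε) (f ε) scheme-ε

theorem5 : KSumConjecture → (v : Variant) →
    NeedsExponentΩ[1/ε] v × ¬ CardinalityScheme v (λ _ → ⊤) (+ 1 / 9)
theorem5 conjecture v =
    (+ 1 / 9 , _ , no-scheme conjecture v)
  , λ { (p , κ , f , scheme) → no-scheme conjecture v 1ℚ _ (p , κ , f , λ ε _ → scheme ε tt) }
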